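{- Let $\mathcal D$ be a finite set with $T=|\mathcal D|\ge 1$, let $\mathcal Q$ be a nonempty finite family of functions with $k=|\mathcal Q|\ge 1$, let $n\ge 1$ be an integer, and suppose every $q\in\mathcal Q$ maps $\mathcal D$ to $[-1,1]$. For every real $\varepsilon>0$ there exists a randomized mechanism $M_2$, with inputs $x\in\mathcal D^n$ and output in $\mathbb R^{\mathcal Q}$, that is pure $\varepsilon$-differentially private and satisfies $$\sup_{x\in\mathcal D^n}\frac1{\sqrt k}\,\mathbb E\,\|M_2(x)-F(x)\|_2\le 62e\,\min\left\{1,\sqrt{\frac{\log(2T)}{\varepsilon n}}\right\}.$$
   Context: For $x=(x_1,\dots,x_n)\in\mathcal D^n$ and $q\in\mathcal Q$, put $F_q(x)=\frac1n\sum_{i=1}^n q(x_i)$ and $F(x)=(F_q(x))_{q\in\mathcal Q}\in\mathbb R^{\mathcal Q}$. Here $\|z\|_2=(\sum_{q\in\mathcal Q}z_q^2)^{1/2}$, $\log$ is the natural logarithm, and $e$ is Euler's number. All probability spaces are finite: a randomized mechanism assigns to each $x\in\mathcal D^n$ a random output whose law has finite support. Two databases $x,x'\in\mathcal D^n$ are neighboring if they differ in exactly one coordinate (Hamming distance one). A mechanism $M$ is pure $\varepsilon$-differentially private if for all neighboring $x,x'$ and every subset $E$ of its output space, $\mathbb P[M(x)\in E]\le e^{\varepsilon}\,\mathbb P[M(x')\in E]$. -}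

module Defs where

open import Algebra.Bundles using (CommutativeRing; Semiring)
open import Algebra.Structures using (IsCommutativeRing)
import Algebra.Construct.NaturalChoice.Max as Max
import Algebra.Construct.NaturalChoice.Min as Min
import Algebra.Definitions.RawSemiring as RawSemiring
open import Axiom.ExcludedMiddle using (ExcludedMiddle)
open import Data.Bool.Base using (if_then_else_)
open import Data.Fin.Base using (Fin; toℕ)
open import Data.Nat.Base as ℕ using (ℕ; _!)
open import Data.Product.Base using (∃; _×_; _,_)
open import Data.Vec.Base using (Vec; lookup)
open import Data.Vec.Functional using (Vector)
open import Data.Vec.Functional.Relation.Binary.Pointwise using (Pointwise)
open import Level using (0ℓ)
open import Relation.Binary.Bundles using (TotalOrder)
open import Relation.Binary.Core using (Rel)
open import Relation.Binary.Definitions using (_Respects_)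
open import Relation.Binary.PropositionalEquality.Core using (_≡_; _≢_)
open import Relation.Binary.Structures using (IsTotalOrder)
import Relation.Binary.Construct.NonStrictToStrict as NonStrictToStrict
open import Relation.Nullary using (¬_; yes; no; does; contradiction)
open import Relation.Unary using (Pred)

-- The real numbers, characterised (uniquely up to isomorphism) as a Dedekind
-- complete ordered field.  Equality is a setoid equality, so that the usual
-- constructions of the reals are instances without quotient types.
record RealNumbers : Set₁ where
  infix  8 -_
  infixl 7 _*_
  infixl 6 _+_
  infix  4 _≈_ _≤_
  field
    ℝ                 : Set
    _≈_ _≤_           : Rel ℝ 0ℓ
    _+_ _*_           : ℝ → ℝ → ℝ
    -_                : ℝ → ℝ
    0# 1#             : ℝ
    isCommutativeRing : IsCommutativeRing _≈_ _+_ _*_ -_ 0# 1#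
    isTotalOrder      : IsTotalOrder _≈_ _≤_
    0≉1               : ¬ (0# ≈ 1#)
    inverse           : ∀ x → ¬ (x ≈ 0#) → ∃ λ y → x * y ≈ 1#
    +-monoʳ-≤         : ∀ x {y z} → y ≤ z → x + y ≤ x + z
    *-nonneg          : ∀ {x y} → 0# ≤ x → 0# ≤ y → 0# ≤ x * y

  IsUpperBound : Pred ℝ 0ℓ → Pred ℝ 0ℓ
  IsUpperBound S u = ∀ y → S y → y ≤ u

  IsLub : Pred ℝ 0ℓ → Pred ℝ 0ℓ
  IsLub S s = IsUpperBound S s × (∀ u → IsUpperBound S u → s ≤ u)

  field
    complete : (S : Pred ℝ 0ℓ) → ∃ S → ∃ (IsUpperBound S) → ∃ (IsLub S)

  commutativeRing : CommutativeRing 0ℓ 0ℓ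
  commutativeRing = record { isCommutativeRing = isCommutativeRing }

  totalOrder : TotalOrder 0ℓ 0ℓ 0ℓ
  totalOrder = record { isTotalOrder = isTotalOrder }

-- Neighbouring databases differ in exactly one coordinate.
Neighbouring : {D : Set} {n : ℕ} → Rel (Vec D n) 0ℓ
Neighbouring x x′ =
  ∃ λ i → lookup x i ≢ lookup x′ i × (∀ j → j ≢ i → lookup x j ≡ lookup x′ j)

module Analysis (lem : ExcludedMiddle 0ℓ) (R : RealNumbers) where

  open RealNumbers R public
  open RawSemiring (Semiring.rawSemiring (CommutativeRing.semiring commutativeRing)) public
    using (sum; _^_) renaming (_×_ to _·_)
  open NonStrictToStrict _≈_ _≤_ public using (_<_)
  open Min totalOrder public using (_⊓_)
  open Max totalOrder public using (_⊔_)

  infixl 7 _/_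
  infixl 6 _-_

  -- Description operator: an element satisfying P, and 0 if there is none.  It
  -- is applied only to properties that hold of at most one real up to _≈_.
  the : Pred ℝ 0ℓ → ℝ
  the P with lem {∃ P}
  ... | yes (x , _) = x
  ... | no  _       = 0#

  the-spec : (P : Pred ℝ 0ℓ) → ∃ P → P (the P)
  the-spec P p with lem {∃ P}
  ... | yes (_ , px) = px
  ... | no  ¬p       = contradiction p ¬p

  fromℕ : ℕ → ℝ
  fromℕ n = n · 1#

  _-_ : ℝ → ℝ → ℝ
  x - y = x + (- y)

  -- x / 0 is 0.
  _/_ : ℝ → ℝ → ℝ
  x / y = x * the (λ z → y * z ≈ 1#)

  ∣_∣ : ℝ → ℝ
  ∣ x ∣ = x ⊔ (- x)

  Range : {A : Set} → (A → ℝ) → Pred ℝ 0ℓ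
  Range f y = ∃ λ a → y ≈ f a

  sup : {A : Set} → (A → ℝ) → ℝ
  sup f = the (IsLub (Range f))

  sup-isLub : {A : Set} (f : A → ℝ) → A → ∃ (IsUpperBound (Range f)) →
              IsLub (Range f) (sup f)
  sup-isLub f a bounded =
    the-spec _ (complete (Range f) (f a , a , CommutativeRing.refl commutativeRing) bounded)

  IsLimit : (ℕ → ℝ) → Pred ℝ 0ℓ
  IsLimit s l = ∀ δ → 0# < δ → ∃ λ N → ∀ m → N ℕ.≤ m → ∣ s m - l ∣ < δ

  lim : (ℕ → ℝ) → ℝ
  lim s = the (IsLimit s)

  exp : ℝ → ℝ
  exp x = lim λ N → sum {N} λ i → x ^ toℕ i / fromℕ (toℕ i !)

  -- The natural logarithm, as the inverse of exp.
  log : ℝ → ℝ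
  log y = the λ x → exp x ≈ y

  sqrt : ℝ → ℝ
  sqrt x = the λ y → 0# ≤ y × y * y ≈ x

  ‖_‖₂ : {k : ℕ} → Vector ℝ k → ℝ
  ‖ z ‖₂ = sqrt (sum λ j → z j * z j)

  -- A finitely supported law on A, given by weighted points; repeated points
  -- and zero weights are allowed.
  record Law (A : Set) : Set where
    field
      size   : ℕ
      point  : Fin size → A
      weight : Fin size → ℝ
      nonneg : ∀ i → 0# ≤ weight i
      total  : sum weight ≈ 1#

  open Law

  𝔼 : {A : Set} → Law A → (A → ℝ) → ℝ
  𝔼 μ f = sum λ i → weight μ i * f (point μ i)

  ℙ : {A : Set} → Law A → Pred A 0ℓ → ℝ
  ℙ μ E = 𝔼 μ λ a → if does (lem {E a}) then 1# else 0#

  Mechanism : Set → ℕ → ℕ → Set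
  Mechanism D n k = Vec D n → Law (Vector ℝ k)

  -- Subsets of ℝᵏ are the predicates respecting coordinatewise equality.
  PureDP : {D : Set} {n k : ℕ} → ℝ → Mechanism D n k → Set₁
  PureDP {k = k} ε M =
    ∀ x x′ → Neighbouring x x′ →
    (E : Pred (Vector ℝ k) 0ℓ) → E Respects (Pointwise _≈_) →
    ℙ (M x) E ≤ exp ε * ℙ (M x′) E

  F : {D : Set} {n k : ℕ} → (Fin k → D → ℝ) → Vec D n → Vector ℝ k
  F {n = n} q x j = 1# / fromℕ n * sum λ i → q j (lookup x i)

{-# OPTIONS --safe #-}
{-
Write the rescaled database as a vector w of query sums, and call the differences of two rows
of the query matrix atoms.  Changing one entry of the database changes w by one atom, so the
least number of atoms whose sum is ℓ²-close to w - y is a sensitivity one score for y.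
(Entries are repeated 12^L times, so that this integer score is fine enough even for large ε.)

By Maurey's lemma every sum of ρ atoms is approximated, with root mean square error 2 ρ / √m,
by ρ / m times a sum of only m atoms, so the exponential mechanism can search a net of
(T²)^m points.  One such search gives only the exponent 1/3 in the error.  But it does not
only find a point near w: it shows that w minus that point is, up to the error of the net, a
sum of fewer atoms, so that it can be searched again with a much smaller net.  Iterating with
radii ρ decreasing geometrically, the net errors and the privacy costs are both dominated by
the first stage, and L stages with 4^L proportional to ε n / log (2 T) cost at most ε in
privacy and have error at most 12 / 2^L.
-}
module Submission where

open import Defs
open import Axiom.ExcludedMiddle using (ExcludedMiddle)
open import Data.Fin.Base using (Fin)
open import Data.Nat.Base as ℕ using (ℕ)
open import Data.Product.Base using (Σ-syntax; _×_)
open import Function.Bundles using (_↔_)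
open import Level using (0ℓ)

open import Algebra.Bundles using (CommutativeRing; Semiring)
import Algebra.Construct.NaturalChoice.Max as Max
import Algebra.Construct.NaturalChoice.MaxOp as MaxOp
import Algebra.Construct.NaturalChoice.Min as Min
import Algebra.Construct.NaturalChoice.MinOp as MinOp
import Algebra.Properties.CommutativeMonoid.Sum as MonoidSum
import Algebra.Properties.Ring as RingProperties
import Algebra.Properties.Semiring.Exp as Exp
import Algebra.Properties.Semiring.Mult as Mult
import Algebra.Properties.Semiring.Sum as SemiringSum
import Algebra.Solver.Ring as RingSolver
open import Algebra.Solver.Ring.AlmostCommutativeRing
  using (fromCommutativeRing; _-Raw-AlmostCommutative⟶_)
open import Data.Bool.Base using (true; false; if_then_else_)
open import Data.Fin.Base using (zero; suc; toℕ; fromℕ<; _↑ˡ_; _↑ʳ_; combine; remQuot; finToFun; funToFin)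
open import Data.Fin.Properties using (remQuot-combine; finToFun-funToFin)
open import Data.Integer.Base as ℤ using (ℤ; +_; -[1+_]; _⊖_)
import Data.Integer.Properties as ℤₚ
open import Data.Maybe.Base using (Maybe; just; nothing)
open import Data.Nat.Base using (zero; suc; _!)
import Data.Nat.Properties as ℕₚ
open import Data.Nat.Solver using (module +-*-Solver)
open import Data.Product.Base using (∃; _,_; proj₁; proj₂)
open import Data.Sum.Base using (_⊎_; inj₁; inj₂)
open import Data.Vec.Base using (Vec; lookup; replicate)
open import Data.Vec.Functional using (Vector; _∷_)
open import Function.Base using (_∘_)
open import Function.Bundles using (Inverse)
open import Relation.Binary.Bundles using (TotalOrder)
open import Relation.Binary.PropositionalEquality as ≡ using (_≡_; _≢_)
import Relation.Binary.Reasoning.PartialOrder as OrderReasoning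
open import Relation.Binary.Structures using (IsTotalOrder)
open import Relation.Nullary using (¬_; Dec; yes; no; does; contradiction)
open import Relation.Unary using (Pred)

-- If the radii shrink by a factor r from stage to stage while the log-sizes of the nets differ by a
-- factor 4, the mesh of stage j is proportional to (r / 2)^j and its privacy cost to (4 / r)^j.
-- Both are dominated by the largest j, the stage that is run first, exactly when 2 < r < 4; hence r
-- = 3, and 12 = 3 · 4 for the repetitions. The data enter only through the weights: the codes of
-- the successive choices, and the output that belongs to each code, are the same for all databases.
-- Privacy is therefore a comparison of weights, code by code. Before normalisation all weights are
-- natural powers of the reciprocal of one real `b = exp ϑ`, with `b ^ W` equal to (2 T)². So
-- scores, radii, meshes and costs are natural numbers, and their sums are exact identities. The
-- depth L is the largest with 12 · 4^L · log (2 T) ≤ ε n. Failure at L + 1 gives 1 / 2^L ≤ 7 √(log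
-- (2 T) / (ε n)), so that the error 12 / 2^L is at most 84 times that root, and 84 is below 62 e.

module Arithmetic where

  -- Error and privacy budgets of the stages, in natural numbers

  open import Data.Nat.Base
  open +-*-Solver

  prefixSum : (ℕ → ℕ) → ℕ → ℕ
  prefixSum f zero    = 0
  prefixSum f (suc j) = f j + prefixSum f j

  -- Bounds the expected final error when j stages remain and the residual is within r of a sum of s
  -- atoms. The remaining meshes add to r; the final radius, the remaining excesses and the part of
  -- s above `ρ j` are counted in atoms, each of size at most 2.
  errorBound : (η κ ρ : ℕ → ℕ) → ℕ → ℕ → ℕ → ℕ
  errorBound η κ ρ j r s = r + prefixSum η j + 2 * (ρ 0 + prefixSum κ j + (s ∸ ρ j))

  errorBound-suc : ∀ η κ ρ j r s →
    r + η j + prefixSum η j + 2 * (ρ 0 + prefixSum κ j) + 2 * (s ∸ ρ (suc j) + κ j) ≡ errorBound η κ ρ (suc j) r s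
  errorBound-suc η κ ρ j r s = solve 7
    (λ r e n p x k s → (r :+ e :+ n :+ con 2 :* (p :+ x)) :+ con 2 :* (s :+ k) := r :+ (e :+ n) :+ con 2 :* (p :+ (k :+ x) :+ s))
    ≡.refl r (η j) (prefixSum η j) (ρ 0) (prefixSum κ j) (κ j) (s ∸ ρ (suc j))

  -- Parameters of the stages, the last stage being stage 0.  Stage j starts within radius
  -- ρ (suc j) (counted in atoms), uses the net of the h j-fold multiples of sums of (g j)²
  -- atoms, whose mesh is η j, and the base b ^ τ j; it ends within radius ρ j up to a mean excess of κ j.
  -- The radii shrink by 3 and the log-sizes of the nets by 4, so that η j / W and the privacy
  -- costs τ j / W are geometric.  L ∸ j is truncated: only j ≤ L is meaningful.
  module Schedule (n : ℕ) (1≤n : 1 ≤ n) (L : ℕ) where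

    open ≡.≡-Reasoning

    P₃ P₄ P₁₂ : ℕ
    P₃  = 3 ^ L
    P₄  = 4 ^ L
    P₁₂ = P₃ * P₄

    h g η κ τ ρ : ℕ → ℕ
    h j = n * (4 ^ (L ∸ j) * 3 ^ suc j)
    g j = 2 ^ j
    η j = 2 * (h j * g j)
    κ j = n * (4 ^ (L ∸ j) * 3 ^ j)
    τ j = 4 ^ j * 3 ^ (L ∸ j)
    ρ j = n * (P₄ * 3 ^ j)

    -- Number of atoms in the initial vector, since each of the n entries is repeated `P₁₂` times;
    -- it equals `ρ L`.
    W : ℕ
    W = P₁₂ * n

    1≤W : 1 ≤ W
    1≤W = ℕₚ.*-mono-≤ {1} {P₁₂} (ℕₚ.*-mono-≤ (ℕₚ.m^n>0 3 L) (ℕₚ.m^n>0 4 L)) 1≤n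

    split-power : ∀ a {j} → j ≤ L → a ^ (L ∸ j) * a ^ j ≡ a ^ L
    split-power a {j} j≤L = ≡.trans (≡.sym (ℕₚ.^-distribˡ-+-* a (L ∸ j) j)) (≡.cong (a ^_) (ℕₚ.m∸n+n≡m j≤L))

    pop-power : ∀ a {j} → j < L → a ^ (L ∸ j) ≡ a * a ^ (L ∸ suc j)
    pop-power a {j} j<L = ≡.cong (a ^_) (ℕₚ.+-∸-assoc 1 j<L)

    g*g : ∀ j → g j * g j ≡ 4 ^ j
    g*g zero    = ≡.refl
    g*g (suc j) = ≡.trans (ℕₚ.[m*n]*[o*p]≡[m*o]*[n*p] 2 (2 ^ j) 2 (2 ^ j)) (≡.cong (4 *_) (g*g j))

    -- An equality in fact: `h j` is chosen so that one net point of stage j can stand for all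
    -- `ρ (suc j)` atoms.
    ρ-suc : ∀ j → j < L → ρ (suc j) ≤ h j * (g j * g j)
    ρ-suc j j<L = ℕₚ.≤-reflexive (begin
      n * (P₄ * t)          ≡⟨ ≡.cong (λ p → n * (p * t)) (split-power 4 (ℕₚ.<⇒≤ j<L)) ⟨
      n * (f * 4 ^ j * t)
        ≡⟨ solve 4 (λ n f g t → n :* (f :* g :* t) := n :* (f :* t) :* g) ≡.refl n f (4 ^ j) t ⟩
      n * (f * t) * 4 ^ j ≡⟨ ≡.cong (n * (f * t) *_) (g*g j) ⟨
      h j * (g j * g j)     ∎)
      where
      f = 4 ^ (L ∸ j)
      t = 3 ^ suc j

    -- Since `b ^ W` will be (2 T)², this makes `b ^ τ j` to the power `ρ j` equal to (2 T)^(2 ·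
    -- 4^j), at least the number of net points. So the multitude of candidates costs the search no
    -- more than a score of `ρ j`.
    τ*ρ : ∀ j → j < L → τ j * ρ j ≡ W * 4 ^ j
    τ*ρ j j<L = begin
      4 ^ j * t * (n * (P₄ * 3 ^ j))
        ≡⟨ solve 5 (λ a t n p s → a :* t :* (n :* (p :* s)) := (t :* s) :* p :* n :* a) ≡.refl (4 ^ j) t n P₄ (3 ^ j) ⟩
      (t * 3 ^ j) * P₄ * n * 4 ^ j    ≡⟨ ≡.cong (λ p → p * P₄ * n * 4 ^ j) (split-power 3 (ℕₚ.<⇒≤ j<L)) ⟩
      W * 4 ^ j                                ∎
      where
      t = 3 ^ (L ∸ j)

    -- The mean excess of an exponential search is inversely proportional to its privacy cost; the
    -- factor 12^L in `W` makes the division of `W` by `τ j` exact.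
    κ*τ : ∀ j → j < L → κ j * τ j ≡ W
    κ*τ j j<L = begin
      n * (f * 3 ^ j) * (4 ^ j * t)
        ≡⟨ solve 5 (λ n f s a t → n :* (f :* s) :* (a :* t) := (t :* s) :* (f :* a) :* n) ≡.refl n f (3 ^ j) (4 ^ j) t ⟩
      (t * 3 ^ j) * (f * 4 ^ j) * n
        ≡⟨ ≡.cong₂ (λ p q → p * q * n) (split-power 3 (ℕₚ.<⇒≤ j<L)) (split-power 4 (ℕₚ.<⇒≤ j<L)) ⟩
      W                                            ∎
      where
      f = 4 ^ (L ∸ j)
      t = 3 ^ (L ∸ j)

    -- This sum and the next two are geometric, with ratios 4/3, 3/2 and 3/4; the term that a closed
    -- form would subtract stands on the other side.
    τ-sum : ∀ j → j ≤ L → prefixSum τ j + 3 * P₃ ≡ 3 * (3 ^ (L ∸ j) * 4 ^ j)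
    τ-sum zero    _   = ≡.cong (3 *_) (≡.sym (ℕₚ.*-identityʳ P₃))
    τ-sum (suc j) j<L = begin
      τ j + prefixSum τ j + 3 * P₃    ≡⟨ ℕₚ.+-assoc (τ j) (prefixSum τ j) (3 * P₃) ⟩
      τ j + (prefixSum τ j + 3 * P₃)  ≡⟨ ≡.cong (λ e → τ j + e) (τ-sum j (ℕₚ.<⇒≤ j<L)) ⟩
      4 ^ j * 3 ^ (L ∸ j) + 3 * (3 ^ (L ∸ j) * 4 ^ j)
        ≡⟨ ≡.cong (λ p → 4 ^ j * p + 3 * (p * 4 ^ j)) (pop-power 3 j<L) ⟩
      4 ^ j * (3 * t) + 3 * (3 * t * 4 ^ j)
        ≡⟨ solve 2 (λ f t → f :* (con 3 :* t) :+ con 3 :* (con 3 :* t :* f) := con 3 :* (t :* (con 4 :* f))) ≡.refl (4 ^ j) t ⟩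
      3 * (t * (4 * 4 ^ j))         ∎
      where
      t = 3 ^ (L ∸ suc j)

    η-sum : ∀ j → j ≤ L → prefixSum η j + 12 * (n * P₄) ≡ 12 * (n * (4 ^ (L ∸ j) * (3 ^ j * 2 ^ j)))
    η-sum zero    _   = ≡.cong (λ p → 12 * (n * p)) (≡.sym (ℕₚ.*-identityʳ P₄))
    η-sum (suc j) j<L = begin
      η j + prefixSum η j + 12 * (n * P₄)   ≡⟨ ℕₚ.+-assoc (η j) (prefixSum η j) (12 * (n * P₄)) ⟩
      η j + (prefixSum η j + 12 * (n * P₄)) ≡⟨ ≡.cong (λ e → η j + e) (η-sum j (ℕₚ.<⇒≤ j<L)) ⟩
      2 * (n * (4 ^ (L ∸ j) * (3 * s)) * p) + 12 * (n * (4 ^ (L ∸ j) * (s * p)))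
        ≡⟨ ≡.cong (λ f → 2 * (n * (f * (3 * s)) * p) + 12 * (n * (f * (s * p)))) (pop-power 4 j<L) ⟩
      2 * (n * (4 * f * (3 * s)) * p) + 12 * (n * (4 * f * (s * p)))
        ≡⟨ solve 4 (λ n f s p → con 2 :* (n :* (con 4 :* f :* (con 3 :* s)) :* p) :+ con 12 :* (n :* (con 4 :* f :* (s :* p)))
                             := con 12 :* (n :* (f :* (con 3 :* s :* (con 2 :* p))))) ≡.refl n f s p ⟩
      12 * (n * (f * (3 * s * (2 * p)))) ∎
      where
      f = 4 ^ (L ∸ suc j)
      s = 3 ^ j
      p = 2 ^ j

    κ-sum : ∀ j → j ≤ L → prefixSum κ j + 4 * κ j ≡ 4 * (n * P₄)
    κ-sum zero    _   = ≡.cong (λ p → 4 * (n * p)) (ℕₚ.*-identityʳ P₄)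
    κ-sum (suc j) j<L = begin
      κ j + prefixSum κ j + 4 * κ (suc j)   ≡⟨ ≡.cong (λ e → κ j + prefixSum κ j + e) κ-suc ⟩
      κ j + prefixSum κ j + 3 * κ j
        ≡⟨ solve 2 (λ k e → k :+ e :+ con 3 :* k := e :+ con 4 :* k) ≡.refl (κ j) (prefixSum κ j) ⟩
      prefixSum κ j + 4 * κ j                 ≡⟨ κ-sum j (ℕₚ.<⇒≤ j<L) ⟩
      4 * (n * P₄)                       ∎
      where
      f = 4 ^ (L ∸ suc j)
      κ-suc : 4 * κ (suc j) ≡ 3 * κ j
      κ-suc = begin
        4 * (n * (f * (3 * 3 ^ j)))
          ≡⟨ solve 3 (λ n f s → con 4 :* (n :* (f :* (con 3 :* s))) := con 3 :* (n :* (con 4 :* f :* s))) ≡.refl n f (3 ^ j) ⟩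
        3 * (n * (4 * f * 3 ^ j))     ≡⟨ ≡.cong (λ p → 3 * (n * (p * 3 ^ j))) (pop-power 4 j<L) ⟨
        3 * κ j                               ∎

    τ-sum≤ : prefixSum τ L ≤ 3 * P₄
    τ-sum≤ = ℕₚ.≤-trans (ℕₚ.m≤m+n (prefixSum τ L) (3 * P₃)) (ℕₚ.≤-reflexive (≡.trans (τ-sum L ℕₚ.≤-refl)
      (≡.trans (≡.cong (λ e → 3 * (3 ^ e * P₄)) (ℕₚ.n∸n≡0 L)) (≡.cong (3 *_) (ℕₚ.*-identityˡ P₄)))))


    V : ℕ
    V = n * (3 ^ L * 2 ^ L)

    1≤V : 1 ≤ V
    1≤V = ℕₚ.*-mono-≤ 1≤n (ℕₚ.*-mono-≤ (ℕₚ.m^n>0 3 L) (ℕₚ.m^n>0 2 L))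

    V*P₂≡W : V * 2 ^ L ≡ W
    V*P₂≡W = begin
      n * (3 ^ L * 2 ^ L) * 2 ^ L
        ≡⟨ solve 3 (λ n t s → n :* (t :* s) :* s := t :* (s :* s) :* n) ≡.refl n (3 ^ L) (2 ^ L) ⟩
      3 ^ L * (2 ^ L * 2 ^ L) * n   ≡⟨ ≡.cong (λ p → 3 ^ L * p * n) (g*g L) ⟩
      W                             ∎

    1≤h : ∀ j → 1 ≤ h j
    1≤h j = ℕₚ.*-mono-≤ 1≤n (ℕₚ.*-mono-≤ (ℕₚ.m^n>0 4 (L ∸ j)) (ℕₚ.m^n>0 3 (suc j)))

    1≤g : ∀ j → 1 ≤ g j
    1≤g j = ℕₚ.m^n>0 2 j

    -- With M = n · 4^L, the closed form of `prefixSum η L` leaves exactly 12 M to spare. The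
    -- initial tolerance 1 takes at most 2 M; the final radius M and the excesses, at most 4 M, are
    -- doubled and take 10 M.
    total-error : errorBound η κ ρ L 1 W ≤ 12 * V
    total-error = bound
      where
      M = n * P₄
      E = prefixSum η L
      1≤M : 1 ≤ M
      1≤M = ℕₚ.*-mono-≤ 1≤n (ℕₚ.m^n>0 4 L)
      κ-sum≤ : prefixSum κ L ≤ 4 * M
      κ-sum≤ = ℕₚ.≤-trans (ℕₚ.m≤m+n (prefixSum κ L) (4 * κ L)) (ℕₚ.≤-reflexive (κ-sum L ℕₚ.≤-refl))
      ρ0≡ : ρ 0 ≡ M
      ρ0≡ = ≡.cong (n *_) (ℕₚ.*-identityʳ P₄)
      W∸ρ≡0 : W ∸ ρ L ≡ 0
      W∸ρ≡0 = ℕₚ.m≤n⇒m∸n≡0 (ℕₚ.≤-reflexive (solve 3 (λ n p q → q :* p :* n := n :* (p :* q)) ≡.refl n P₄ P₃))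
      bound : errorBound η κ ρ L 1 W ≤ 12 * V
      bound = ℕₚ.≤-trans (ℕₚ.+-mono-≤ (ℕₚ.+-monoˡ-≤ E (ℕₚ.≤-trans 1≤M (ℕₚ.m≤m+n M M)))
          (ℕₚ.*-monoʳ-≤ 2 (ℕₚ.+-mono-≤ (ℕₚ.+-mono-≤ (ℕₚ.≤-reflexive ρ0≡) κ-sum≤) (ℕₚ.≤-reflexive W∸ρ≡0))))
        (ℕₚ.≤-reflexive (begin
          M + M + E + 2 * (M + 4 * M + 0)
            ≡⟨ solve 2 (λ m e → m :+ m :+ e :+ con 2 :* (m :+ con 4 :* m :+ con 0) := e :+ con 12 :* m) ≡.refl M E ⟩
          E + 12 * M                        ≡⟨ η-sum L ℕₚ.≤-refl ⟩
          12 * (n * (4 ^ (L ∸ L) * (3 ^ L * 2 ^ L)))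
            ≡⟨ ≡.cong (λ e → 12 * (n * (4 ^ e * (3 ^ L * 2 ^ L)))) (ℕₚ.n∸n≡0 L) ⟩
          12 * (n * (1 * (3 ^ L * 2 ^ L)))  ≡⟨ ≡.cong (λ p → 12 * (n * p)) (ℕₚ.*-identityˡ (3 ^ L * 2 ^ L)) ⟩
          12 * (n * (3 ^ L * 2 ^ L))        ∎))

    -- Changing an entry moves the vector by `P₁₂` atoms, and an exponential search pays for each of
    -- them twice, in the weight and in the normaliser.
    total-privacy : n * (prefixSum τ L * (P₁₂ + P₁₂)) ≤ 6 * P₄ * W
    total-privacy = ℕₚ.≤-trans (ℕₚ.*-monoʳ-≤ n (ℕₚ.*-monoˡ-≤ (P₁₂ + P₁₂) τ-sum≤))
      (ℕₚ.≤-reflexive (solve 3 (λ n p q → n :* (con 3 :* p :* (q :+ q)) := con 6 :* p :* (q :* n)) ≡.refl n P₄ P₁₂))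

open Arithmetic

module Proof (lem : ExcludedMiddle 0ℓ) (R : RealNumbers) where

  open Analysis lem R public
  open CommutativeRing commutativeRing public
    using ( semiring; ring; refl; sym; trans
          ; +-cong; +-congˡ; +-congʳ; *-cong; *-congˡ; *-congʳ; -‿cong
          ; +-assoc; +-comm; +-identityˡ; +-identityʳ; -‿inverseˡ; -‿inverseʳ
          ; *-assoc; *-comm; *-identityˡ; *-identityʳ; distribˡ; distribʳ
          ; zeroˡ; zeroʳ; +-commutativeMonoid)
  open RingProperties ring public using (-0#≈0#; -‿distribˡ-*; -‿distribʳ-*; -‿involutive; -‿+-comm)
  open Mult semiring public using (×1-homo-*; ×-homo-+)
  open Exp semiring public using (^-homo-*; ^-assocʳ; ^-congˡ)
  open MonoidSum +-commutativeMonoid public using (∑-distrib-+; ∑-comm)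
    renaming (sum-cong-≋ to sum-cong)
  open SemiringSum semiring public using (*-distribˡ-sum; *-distribʳ-sum)
  open IsTotalOrder isTotalOrder public using (total; antisym)
    renaming (reflexive to ≤-reflexive; refl to ≤-refl; trans to ≤-trans)
  open OrderReasoning (TotalOrder.poset totalOrder) public

  -- Integer coefficients for the ring solver

  private
    -- Unlike `fromℕ`, this sends 1 to `1#` itself and not to `1# + 0#`, so that `con (+ 1)`
    -- evaluates definitionally to `1#`.
    ⟦_⟧ₙ : ℕ → ℝ
    ⟦ 0 ⟧ₙ           = 0#
    ⟦ 1 ⟧ₙ           = 1#
    ⟦ suc (suc n) ⟧ₙ = 1# + ⟦ suc n ⟧ₙ

    ⟦_⟧ : ℤ → ℝ
    ⟦ + n ⟧      = ⟦ n ⟧ₙ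
    ⟦ -[1+ n ] ⟧ = - ⟦ suc n ⟧ₙ

    ⟦⟧ₙ-fromℕ : ∀ n → ⟦ n ⟧ₙ ≈ fromℕ n
    ⟦⟧ₙ-fromℕ 0             = refl
    ⟦⟧ₙ-fromℕ 1             = sym (+-identityʳ 1#)
    ⟦⟧ₙ-fromℕ (suc (suc n)) = +-congˡ (⟦⟧ₙ-fromℕ (suc n))

    ⟦⟧ₙ-suc : ∀ n → ⟦ suc n ⟧ₙ ≈ 1# + ⟦ n ⟧ₙ
    ⟦⟧ₙ-suc zero    = sym (+-identityʳ 1#)
    ⟦⟧ₙ-suc (suc n) = refl

    ⟦⟧ₙ-+ : ∀ m n → ⟦ m ℕ.+ n ⟧ₙ ≈ ⟦ m ⟧ₙ + ⟦ n ⟧ₙ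
    ⟦⟧ₙ-+ m n = begin-equality
      ⟦ m ℕ.+ n ⟧ₙ      ≈⟨ ⟦⟧ₙ-fromℕ (m ℕ.+ n) ⟩
      fromℕ (m ℕ.+ n)   ≈⟨ ×-homo-+ 1# m n ⟩
      fromℕ m + fromℕ n ≈⟨ +-cong (⟦⟧ₙ-fromℕ m) (⟦⟧ₙ-fromℕ n) ⟨
      ⟦ m ⟧ₙ + ⟦ n ⟧ₙ   ∎

    ⟦⟧ₙ-* : ∀ m n → ⟦ m ℕ.* n ⟧ₙ ≈ ⟦ m ⟧ₙ * ⟦ n ⟧ₙ
    ⟦⟧ₙ-* m n = begin-equality
      ⟦ m ℕ.* n ⟧ₙ      ≈⟨ ⟦⟧ₙ-fromℕ (m ℕ.* n) ⟩
      fromℕ (m ℕ.* n)   ≈⟨ ×1-homo-* m n ⟩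
      fromℕ m * fromℕ n ≈⟨ *-cong (⟦⟧ₙ-fromℕ m) (⟦⟧ₙ-fromℕ n) ⟨
      ⟦ m ⟧ₙ * ⟦ n ⟧ₙ   ∎

    ⟦⟧-neg : ∀ i → ⟦ ℤ.- i ⟧ ≈ - ⟦ i ⟧
    ⟦⟧-neg (+ zero)  = sym -0#≈0#
    ⟦⟧-neg (+ suc n) = refl
    ⟦⟧-neg -[1+ n ]  = sym (-‿involutive _)

    ⟦⟧-⊖ : ∀ m n → ⟦ m ⊖ n ⟧ ≈ ⟦ m ⟧ₙ - ⟦ n ⟧ₙ
    ⟦⟧-⊖ zero    zero    = sym (-‿inverseʳ 0#)
    ⟦⟧-⊖ zero    (suc n) = sym (+-identityˡ _)
    ⟦⟧-⊖ (suc m) zero    = sym (trans (+-congˡ -0#≈0#) (+-identityʳ _))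
    ⟦⟧-⊖ (suc m) (suc n) = begin-equality
      ⟦ suc m ⊖ suc n ⟧                 ≡⟨ ≡.cong ⟦_⟧ (ℤₚ.[1+m]⊖[1+n]≡m⊖n m n) ⟩
      ⟦ m ⊖ n ⟧                         ≈⟨ ⟦⟧-⊖ m n ⟩
      ⟦ m ⟧ₙ - ⟦ n ⟧ₙ                   ≈⟨ +-congʳ (+-identityˡ _) ⟨
      (0# + ⟦ m ⟧ₙ) - ⟦ n ⟧ₙ            ≈⟨ +-congʳ (+-congʳ (-‿inverseʳ 1#)) ⟨
      ((1# - 1#) + ⟦ m ⟧ₙ) - ⟦ n ⟧ₙ     ≈⟨ +-congʳ (+-congʳ (+-comm _ _)) ⟩
      ((- 1# + 1#) + ⟦ m ⟧ₙ) - ⟦ n ⟧ₙ   ≈⟨ +-congʳ (+-assoc _ _ _) ⟩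
      (- 1# + (1# + ⟦ m ⟧ₙ)) - ⟦ n ⟧ₙ   ≈⟨ +-congʳ (+-comm _ _) ⟩
      ((1# + ⟦ m ⟧ₙ) - 1#) - ⟦ n ⟧ₙ     ≈⟨ +-assoc _ _ _ ⟩
      (1# + ⟦ m ⟧ₙ) + (- 1# - ⟦ n ⟧ₙ)   ≈⟨ +-congˡ (-‿+-comm _ _) ⟩
      (1# + ⟦ m ⟧ₙ) - (1# + ⟦ n ⟧ₙ)     ≈⟨ +-cong (⟦⟧ₙ-suc m) (-‿cong (⟦⟧ₙ-suc n)) ⟨
      ⟦ suc m ⟧ₙ - ⟦ suc n ⟧ₙ           ∎

    ⟦⟧-+ : ∀ i j → ⟦ i ℤ.+ j ⟧ ≈ ⟦ i ⟧ + ⟦ j ⟧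
    ⟦⟧-+ (+ m)    (+ n)    = ⟦⟧ₙ-+ m n
    ⟦⟧-+ (+ m)    -[1+ n ] = ⟦⟧-⊖ m (suc n)
    ⟦⟧-+ -[1+ m ] (+ n)    = trans (⟦⟧-⊖ n (suc m)) (+-comm _ _)
    ⟦⟧-+ -[1+ m ] -[1+ n ] = begin-equality
      - ⟦ suc (suc (m ℕ.+ n)) ⟧ₙ  ≡⟨ ≡.cong (λ l → - ⟦ suc l ⟧ₙ) (ℕₚ.+-suc m n) ⟨
      - ⟦ suc m ℕ.+ suc n ⟧ₙ      ≈⟨ -‿cong (⟦⟧ₙ-+ (suc m) (suc n)) ⟩
      - (⟦ suc m ⟧ₙ + ⟦ suc n ⟧ₙ) ≈⟨ -‿+-comm _ _ ⟨
      - ⟦ suc m ⟧ₙ - ⟦ suc n ⟧ₙ   ∎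

    ⟦⟧-*⁺ : ∀ m j → ⟦ + m ℤ.* j ⟧ ≈ ⟦ m ⟧ₙ * ⟦ j ⟧
    ⟦⟧-*⁺ m (+ n) = begin-equality
      ⟦ + m ℤ.* + n ⟧ ≡⟨ ≡.cong ⟦_⟧ (ℤₚ.pos-* m n) ⟨
      ⟦ m ℕ.* n ⟧ₙ    ≈⟨ ⟦⟧ₙ-* m n ⟩
      ⟦ m ⟧ₙ * ⟦ n ⟧ₙ ∎
    ⟦⟧-*⁺ m -[1+ n ] = begin-equality
      ⟦ + m ℤ.* -[1+ n ] ⟧       ≡⟨ ≡.cong ⟦_⟧ (ℤₚ.neg-distribʳ-* (+ m) (+ suc n)) ⟨
      ⟦ ℤ.- (+ m ℤ.* + suc n) ⟧  ≈⟨ ⟦⟧-neg (+ m ℤ.* + suc n) ⟩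
      - ⟦ + m ℤ.* + suc n ⟧      ≈⟨ -‿cong (⟦⟧-*⁺ m (+ suc n)) ⟩
      - (⟦ m ⟧ₙ * ⟦ suc n ⟧ₙ)    ≈⟨ -‿distribʳ-* _ _ ⟩
      ⟦ m ⟧ₙ * - ⟦ suc n ⟧ₙ      ∎
    ⟦⟧-* : ∀ i j → ⟦ i ℤ.* j ⟧ ≈ ⟦ i ⟧ * ⟦ j ⟧
    ⟦⟧-* (+ m) j = ⟦⟧-*⁺ m j
    ⟦⟧-* -[1+ m ] j = begin-equality
      ⟦ -[1+ m ] ℤ.* j ⟧         ≡⟨ ≡.cong ⟦_⟧ (ℤₚ.neg-distribˡ-* (+ suc m) j) ⟨
      ⟦ ℤ.- (+ suc m ℤ.* j) ⟧    ≈⟨ ⟦⟧-neg (+ suc m ℤ.* j) ⟩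
      - ⟦ + suc m ℤ.* j ⟧        ≈⟨ -‿cong (⟦⟧-*⁺ (suc m) j) ⟩
      - (⟦ suc m ⟧ₙ * ⟦ j ⟧)     ≈⟨ -‿distribˡ-* _ _ ⟩
      - ⟦ suc m ⟧ₙ * ⟦ j ⟧       ∎

    ℤ⟶ℝ : ℤ.+-*-rawRing -Raw-AlmostCommutative⟶ fromCommutativeRing commutativeRing
    ℤ⟶ℝ = record
      { ⟦_⟧ = ⟦_⟧ ; +-homo = ⟦⟧-+ ; *-homo = ⟦⟧-* ; -‿homo = ⟦⟧-neg ; 0-homo = refl ; 1-homo = refl }

    ≟-coefficient : ∀ i j → Maybe (⟦ i ⟧ ≈ ⟦ j ⟧)
    ≟-coefficient i j with i ℤₚ.≟ j
    ... | yes ≡.refl = just refl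
    ... | no  _      = nothing

  open RingSolver ℤ.+-*-rawRing (fromCommutativeRing commutativeRing) ℤ⟶ℝ ≟-coefficient public
    using (Polynomial; solve; _:=_; _:+_; _:*_; _:-_; :-_; con)

  -- Unlike con (+ m), numeral m evaluates definitionally to fromℕ m.
  numeral : ∀ {n} → ℕ → Polynomial n
  numeral zero    = con (+ 0)
  numeral (suc m) = con (+ 1) :+ numeral m

  -- Ordered field arithmetic

  ≤-offset : ∀ {x y} p → 0# ≤ p → y ≈ x + p → x ≤ y
  ≤-offset {x} {y} p 0≤p eq = begin
    x      ≈⟨ +-identityʳ x ⟨
    x + 0# ≤⟨ +-monoʳ-≤ x 0≤p ⟩
    x + p  ≈⟨ eq ⟨
    y      ∎

  +-mono-≤ : ∀ {a b c d} → a ≤ b → c ≤ d → a + c ≤ b + d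
  +-mono-≤ {a} {b} {c} {d} a≤b c≤d = begin
    a + c ≤⟨ +-monoʳ-≤ a c≤d ⟩
    a + d ≈⟨ +-comm a d ⟩
    d + a ≤⟨ +-monoʳ-≤ d a≤b ⟩
    d + b ≈⟨ +-comm d b ⟩
    b + d ∎

  +-monoˡ-≤ : ∀ x {y z} → y ≤ z → y + x ≤ z + x
  +-monoˡ-≤ x y≤z = +-mono-≤ y≤z ≤-refl

  +-nonneg : ∀ {x y} → 0# ≤ x → 0# ≤ y → 0# ≤ x + y
  +-nonneg {x} {y} 0≤x 0≤y = ≤-trans 0≤x (≤-offset y 0≤y refl)

  x≤y⇒0≤y-x : ∀ {x y} → x ≤ y → 0# ≤ y - x
  x≤y⇒0≤y-x {x} {y} x≤y = begin
    0#    ≈⟨ -‿inverseʳ x ⟨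
    x - x ≤⟨ +-monoˡ-≤ (- x) x≤y ⟩
    y - x ∎

  0≤y-x⇒x≤y : ∀ {x y} → 0# ≤ y - x → x ≤ y
  0≤y-x⇒x≤y {x} {y} h = ≤-offset (y - x) h (solve 2 (λ x y → y := x :+ (y :- x)) refl x y)

  neg-mono-≤ : ∀ {x y} → x ≤ y → - y ≤ - x
  neg-mono-≤ {x} {y} x≤y = ≤-offset (y - x) (x≤y⇒0≤y-x x≤y)
    (solve 2 (λ x y → :- x := :- y :+ (y :- x)) refl x y)

  +-cancelˡ-≤ : ∀ x {y z} → x + y ≤ x + z → y ≤ z
  +-cancelˡ-≤ x {y} {z} h = ≤-offset _ (x≤y⇒0≤y-x h)
    (solve 3 (λ x y z → z := y :+ ((x :+ z) :- (x :+ y))) refl x y z)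

  *-monoˡ-≤ : ∀ {c x y} → 0# ≤ c → x ≤ y → c * x ≤ c * y
  *-monoˡ-≤ {c} {x} {y} 0≤c x≤y = ≤-offset _ (*-nonneg 0≤c (x≤y⇒0≤y-x x≤y))
    (solve 3 (λ c x y → c :* y := c :* x :+ c :* (y :- x)) refl c x y)

  *-monoʳ-≤ : ∀ {c x y} → 0# ≤ c → x ≤ y → x * c ≤ y * c
  *-monoʳ-≤ {c} {x} {y} 0≤c x≤y = begin
    x * c ≈⟨ *-comm x c ⟩
    c * x ≤⟨ *-monoˡ-≤ 0≤c x≤y ⟩
    c * y ≈⟨ *-comm c y ⟩
    y * c ∎

  *-mono-≤ : ∀ {a b c d} → 0# ≤ a → 0# ≤ d → a ≤ b → c ≤ d → a * c ≤ b * d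
  *-mono-≤ 0≤a 0≤d a≤b c≤d = ≤-trans (*-monoˡ-≤ 0≤a c≤d) (*-monoʳ-≤ 0≤d a≤b)

  square-nonneg : ∀ x → 0# ≤ x * x
  square-nonneg x with total 0# x
  ... | inj₁ 0≤x = *-nonneg 0≤x 0≤x
  ... | inj₂ x≤0 = begin
    0#        ≤⟨ *-nonneg 0≤-x 0≤-x ⟩
    - x * - x ≈⟨ solve 1 (λ x → :- x :* :- x := x :* x) refl x ⟩
    x * x     ∎
    where
    0≤-x : 0# ≤ - x
    0≤-x = ≤-trans (≤-reflexive (sym -0#≈0#)) (neg-mono-≤ x≤0)

  0≤1 : 0# ≤ 1#
  0≤1 = ≤-trans (square-nonneg 1#) (≤-reflexive (*-identityˡ 1#))

  0<1 : 0# < 1#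
  0<1 = 0≤1 , 0≉1

  ≰⇒> : ∀ {x y} → ¬ (x ≤ y) → y < x
  ≰⇒> {x} {y} x≰y with total x y
  ... | inj₁ x≤y = contradiction x≤y x≰y
  ... | inj₂ y≤x = y≤x , λ y≈x → x≰y (≤-reflexive (sym y≈x))

  ≮⇒≤ : ∀ {x y} → ¬ (y < x) → x ≤ y
  ≮⇒≤ {x} {y} y≮x with lem {x ≤ y}
  ... | yes x≤y = x≤y
  ... | no  x≰y = contradiction (≰⇒> x≰y) y≮x

  <⇒≱ : ∀ {x y} → x < y → ¬ (y ≤ x)
  <⇒≱ (x≤y , x≉y) y≤x = x≉y (antisym x≤y y≤x)

  x<y⇒0<y-x : ∀ {x y} → x < y → 0# < y - x
  x<y⇒0<y-x (x≤y , x≉y) = x≤y⇒0≤y-x x≤y , λ eq →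
    x≉y (antisym x≤y (0≤y-x⇒x≤y (begin
      0#         ≈⟨ -0#≈0# ⟨
      - 0#       ≈⟨ -‿cong eq ⟩
      - (_ - _)  ≈⟨ solve 2 (λ x y → :- (y :- x) := x :- y) refl _ _ ⟩
      _ - _      ∎)))

  0<-trans-≤ : ∀ {x y} → 0# < x → x ≤ y → 0# < y
  0<-trans-≤ 0<x x≤y = ≰⇒> λ y≤0 → <⇒≱ 0<x (≤-trans x≤y y≤0)

  infix 9 _⁻¹

  _⁻¹ : ℝ → ℝ
  x ⁻¹ = the λ y → x * y ≈ 1#

  *-inverseʳ : ∀ {x} → 0# < x → x * x ⁻¹ ≈ 1#
  *-inverseʳ {x} (_ , 0≉x) = the-spec _ (inverse x λ x≈0 → 0≉x (sym x≈0))

  *-inverseˡ : ∀ {x} → 0# < x → x ⁻¹ * x ≈ 1#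
  *-inverseˡ 0<x = trans (*-comm _ _) (*-inverseʳ 0<x)

  ⁻¹-positive : ∀ {x} → 0# < x → 0# < x ⁻¹
  ⁻¹-positive {x} 0<x = ≰⇒> λ x⁻¹≤0 → <⇒≱ 0<1 (begin
    1#        ≈⟨ *-inverseʳ 0<x ⟨
    x * x ⁻¹  ≤⟨ *-monoˡ-≤ (proj₁ 0<x) x⁻¹≤0 ⟩
    x * 0#    ≈⟨ zeroʳ x ⟩
    0#        ∎)

  x⁻¹*[x*y]≈y : ∀ {x} y → 0# < x → x ⁻¹ * (x * y) ≈ y
  x⁻¹*[x*y]≈y {x} y 0<x = begin-equality
    x ⁻¹ * (x * y) ≈⟨ *-assoc _ _ _ ⟨
    x ⁻¹ * x * y   ≈⟨ *-congʳ (*-inverseˡ 0<x) ⟩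
    1# * y         ≈⟨ *-identityˡ y ⟩
    y              ∎

  x*[x⁻¹*y]≈y : ∀ {x} y → 0# < x → x * (x ⁻¹ * y) ≈ y
  x*[x⁻¹*y]≈y {x} y 0<x = begin-equality
    x * (x ⁻¹ * y) ≈⟨ *-assoc _ _ _ ⟨
    x * x ⁻¹ * y   ≈⟨ *-congʳ (*-inverseʳ 0<x) ⟩
    1# * y         ≈⟨ *-identityˡ y ⟩
    y              ∎

  *-cancelˡ-≤ : ∀ {c x y} → 0# < c → c * x ≤ c * y → x ≤ y
  *-cancelˡ-≤ {c} {x} {y} 0<c h = begin
    x              ≈⟨ x⁻¹*[x*y]≈y x 0<c ⟨
    c ⁻¹ * (c * x) ≤⟨ *-monoˡ-≤ (proj₁ (⁻¹-positive 0<c)) h ⟩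
    c ⁻¹ * (c * y) ≈⟨ x⁻¹*[x*y]≈y y 0<c ⟩
    y              ∎

  *-positive : ∀ {x y} → 0# < x → 0# < y → 0# < x * y
  *-positive {x} {y} 0<x 0<y = ≰⇒> λ xy≤0 → <⇒≱ 0<y (*-cancelˡ-≤ 0<x (≤-trans xy≤0 (≤-reflexive (sym (zeroʳ x)))))

  square-cancel-≤ : ∀ {x y} → 0# ≤ y → x * x ≤ y * y → x ≤ y
  square-cancel-≤ {x} {y} 0≤y h with total x y
  ... | inj₁ x≤y = x≤y
  ... | inj₂ y≤x with lem {x ≤ y}
  ...   | yes x≤y = x≤y
  ...   | no  x≰y = contradiction (*-cancelˡ-≤ 0<x (≤-trans h (*-monoʳ-≤ 0≤y y≤x))) x≰y
    where
    0<x : 0# < x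
    0<x = ≰⇒> λ x≤0 → x≰y (≤-trans x≤0 0≤y)

  fromℕ-nonneg : ∀ n → 0# ≤ fromℕ n
  fromℕ-nonneg zero    = ≤-refl
  fromℕ-nonneg (suc n) = +-nonneg 0≤1 (fromℕ-nonneg n)

  fromℕ-mono : ∀ {m n} → m ℕ.≤ n → fromℕ m ≤ fromℕ n
  fromℕ-mono {n = n} ℕ.z≤n = fromℕ-nonneg n
  fromℕ-mono (ℕ.s≤s m≤n)   = +-monoʳ-≤ 1# (fromℕ-mono m≤n)

  fromℕ-positive : ∀ {n} → 1 ℕ.≤ n → 0# < fromℕ n
  fromℕ-positive {suc n} _ = 0<-trans-≤ 0<1 (≤-offset (fromℕ n) (fromℕ-nonneg n) refl)

  fromℕ-+ : ∀ m n → fromℕ (m ℕ.+ n) ≈ fromℕ m + fromℕ n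
  fromℕ-+ = ×-homo-+ 1#

  fromℕ-* : ∀ m n → fromℕ (m ℕ.* n) ≈ fromℕ m * fromℕ n
  fromℕ-* = ×1-homo-*

  fromℕ-1 : fromℕ 1 ≈ 1#
  fromℕ-1 = +-identityʳ 1#

  fromℕ-^ : ∀ m n → fromℕ (m ℕ.^ n) ≈ fromℕ m ^ n
  fromℕ-^ m zero    = fromℕ-1
  fromℕ-^ m (suc n) = trans (fromℕ-* m (m ℕ.^ n)) (*-congˡ (fromℕ-^ m n))

  -- If the naturals were bounded, their supremum minus 1 would bound them as well.
  archimedean : ∀ x → ∃ λ n → x ≤ fromℕ n
  archimedean x with lem {∃ λ n → x ≤ fromℕ n}
  ... | yes p = p
  ... | no ¬p with complete (λ y → ∃ λ n → y ≈ fromℕ n) (0# , 0 , refl) (x , λ y (n , y≈n) →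
                     ≤-trans (≤-reflexive y≈n) (proj₁ (≰⇒> λ x≤n → ¬p (n , x≤n))))
  ...   | s , s-upper , s-least = contradiction (s-least (s - 1#) s-1-upper) (<⇒≱ s-1<s)
    where
    s-1-upper : ∀ y → (∃ λ n → y ≈ fromℕ n) → y ≤ s - 1#
    s-1-upper y (n , y≈n) = begin
      y                    ≈⟨ y≈n ⟩
      fromℕ n              ≈⟨ solve 1 (λ n → n := (con (+ 1) :+ n) :- con (+ 1)) refl (fromℕ n) ⟩
      fromℕ (suc n) - 1#   ≤⟨ +-monoˡ-≤ (- 1#) (s-upper _ (suc n , refl)) ⟩
      s - 1#               ∎
    s-1<s : s - 1# < s
    s-1<s = ≰⇒> λ s≤s-1 → <⇒≱ 0<1 (+-cancelˡ-≤ (s - 1#) (begin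
      (s - 1#) + 1#  ≈⟨ solve 1 (λ s → (s :- con (+ 1)) :+ con (+ 1) := s) refl s ⟩
      s              ≤⟨ s≤s-1 ⟩
      s - 1#         ≈⟨ +-identityʳ _ ⟨
      (s - 1#) + 0#  ∎))

  ^-nonneg : ∀ {x} n → 0# ≤ x → 0# ≤ x ^ n
  ^-nonneg zero    0≤x = 0≤1
  ^-nonneg (suc n) 0≤x = *-nonneg 0≤x (^-nonneg n 0≤x)

  ^-positive : ∀ {x} n → 0# < x → 0# < x ^ n
  ^-positive zero    0<x = 0<1
  ^-positive (suc n) 0<x = *-positive 0<x (^-positive n 0<x)

  ^-mono-≤ : ∀ {x y} n → 0# ≤ x → x ≤ y → x ^ n ≤ y ^ n
  ^-mono-≤ zero    0≤x x≤y = ≤-refl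
  ^-mono-≤ (suc n) 0≤x x≤y = *-mono-≤ 0≤x (^-nonneg n (≤-trans 0≤x x≤y)) x≤y (^-mono-≤ n 0≤x x≤y)

  1≤x⇒1≤x^n : ∀ {x} n → 1# ≤ x → 1# ≤ x ^ n
  1≤x⇒1≤x^n zero    1≤x = ≤-refl
  1≤x⇒1≤x^n {x} (suc n) 1≤x = begin
    1#        ≈⟨ *-identityˡ 1# ⟨
    1# * 1#   ≤⟨ *-mono-≤ 0≤1 (^-nonneg n (≤-trans 0≤1 1≤x)) 1≤x (1≤x⇒1≤x^n n 1≤x) ⟩
    x * x ^ n ∎

  sum-mono : ∀ {n} {f g : Fin n → ℝ} → (∀ i → f i ≤ g i) → sum f ≤ sum g
  sum-mono {zero}  f≤g = ≤-refl
  sum-mono {suc n} f≤g = +-mono-≤ (f≤g zero) (sum-mono λ i → f≤g (suc i))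

  sum-nonneg : ∀ {n} {f : Fin n → ℝ} → (∀ i → 0# ≤ f i) → 0# ≤ sum f
  sum-nonneg {zero}  0≤f = ≤-refl
  sum-nonneg {suc n} 0≤f = +-nonneg (0≤f zero) (sum-nonneg λ i → 0≤f (suc i))

  sum-const : ∀ n x → sum {n} (λ _ → x) ≈ fromℕ n * x
  sum-const zero    x = sym (zeroˡ x)
  sum-const (suc n) x = trans (+-congˡ (sum-const n x))
    (solve 2 (λ x n → x :+ n :* x := (con (+ 1) :+ n) :* x) refl x (fromℕ n))

  term≤sum : ∀ {n} {f : Fin n → ℝ} → (∀ i → 0# ≤ f i) → ∀ i → f i ≤ sum f
  term≤sum 0≤f zero    = ≤-offset _ (sum-nonneg λ i → 0≤f (suc i)) refl
  term≤sum 0≤f (suc i) = ≤-trans (term≤sum (λ i → 0≤f (suc i)) i) (≤-offset _ (0≤f zero) (+-comm _ _))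

  ⊓-sel : ∀ x y → x ⊓ y ≈ x ⊎ x ⊓ y ≈ y
  ⊓-sel = MinOp.⊓-sel (Min.minOperator totalOrder)

  x≤∣x∣ : ∀ x → x ≤ ∣ x ∣
  x≤∣x∣ x = MaxOp.x≤x⊔y (Max.maxOperator totalOrder) x (- x)

  -x≤∣x∣ : ∀ x → - x ≤ ∣ x ∣
  -x≤∣x∣ x = MaxOp.x≤y⊔x (Max.maxOperator totalOrder) x (- x)

  ∣∣-< : ∀ {x δ} → x < δ → - x < δ → ∣ x ∣ < δ
  ∣∣-< {x} {δ} x<δ -x<δ = ≰⇒> λ δ≤∣x∣ → helper δ≤∣x∣ (MaxOp.⊔-sel (Max.maxOperator totalOrder) x (- x))
    where
    helper : δ ≤ ∣ x ∣ → ¬ (∣ x ∣ ≈ x ⊎ ∣ x ∣ ≈ - x)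
    helper h (inj₁ eq) = <⇒≱ x<δ (≤-trans h (≤-reflexive eq))
    helper h (inj₂ eq) = <⇒≱ -x<δ (≤-trans h (≤-reflexive eq))

  -- Limits

  limit-≤ : ∀ {s l} B N → IsLimit s l → (∀ m → N ℕ.≤ m → s m ≤ B) → l ≤ B
  limit-≤ {s} {l} B N l-limit s≤B with lem {l ≤ B}
  ... | yes l≤B = l≤B
  ... | no  l≰B with l-limit (l - B) (x<y⇒0<y-x (≰⇒> l≰B))
  ...   | M , close = contradiction (begin
    l - B            ≤⟨ +-monoʳ-≤ l (neg-mono-≤ (s≤B m (ℕₚ.m≤m⊔n N M))) ⟩
    l - s m          ≈⟨ solve 2 (λ l s → l :- s := :- (s :- l)) refl l (s m) ⟩
    - (s m - l)      ≤⟨ -x≤∣x∣ _ ⟩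
    ∣ s m - l ∣      ∎) (<⇒≱ (close m (ℕₚ.m≤n⊔m N M)))
    where
    m = N ℕ.⊔ M

  limit-≥ : ∀ {s l} B N → IsLimit s l → (∀ m → N ℕ.≤ m → B ≤ s m) → B ≤ l
  limit-≥ {s} {l} B N l-limit B≤s with lem {B ≤ l}
  ... | yes B≤l = B≤l
  ... | no  B≰l with l-limit (B - l) (x<y⇒0<y-x (≰⇒> B≰l))
  ...   | M , close = contradiction (begin
    B - l            ≤⟨ +-monoˡ-≤ (- l) (B≤s m (ℕₚ.m≤m⊔n N M)) ⟩
    s m - l          ≤⟨ x≤∣x∣ _ ⟩
    ∣ s m - l ∣      ∎) (<⇒≱ (close m (ℕₚ.m≤n⊔m N M)))
    where
    m = N ℕ.⊔ M

  monotone-limit : ∀ (s : ℕ → ℝ) B → (∀ {m n} → m ℕ.≤ n → s m ≤ s n) → (∀ n → s n ≤ B) → ∃ (IsLimit s)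
  monotone-limit s B mono s≤B
    with complete (λ y → ∃ λ n → y ≈ s n) (s 0 , 0 , refl)
           (B , λ y (n , y≈sn) → ≤-trans (≤-reflexive y≈sn) (s≤B n))
  ... | l , upper , least = l , limit
    where
    limit : IsLimit s l
    limit δ 0<δ with lem {∃ λ N → ¬ (s N ≤ l - δ)}
    ... | no ¬p = contradiction (least (l - δ) λ y (n , y≈sn) → ≤-trans (≤-reflexive y≈sn) (below n))
                    (<⇒≱ (≰⇒> λ l≤l-δ → <⇒≱ 0<δ (+-cancelˡ-≤ (l - δ) (begin
                      (l - δ) + δ  ≈⟨ solve 2 (λ l d → (l :- d) :+ d := l) refl l δ ⟩
                      l            ≤⟨ l≤l-δ ⟩
                      l - δ        ≈⟨ +-identityʳ _ ⟨
                      (l - δ) + 0# ∎))))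
      where
      below : ∀ n → s n ≤ l - δ
      below n with lem {s n ≤ l - δ}
      ... | yes p = p
      ... | no ¬q = contradiction (n , ¬q) ¬p
    ... | yes (N , sN≰l-δ) = N , λ m N≤m → ∣∣-<
      (≰⇒> λ δ≤ → <⇒≱ 0<δ (≤-trans δ≤ (begin
        s m - l  ≤⟨ +-monoˡ-≤ (- l) (upper _ (m , refl)) ⟩
        l - l    ≈⟨ -‿inverseʳ l ⟩
        0#       ∎)))
      (≰⇒> λ δ≤ → sN≰l-δ (begin
        s N              ≤⟨ mono N≤m ⟩
        s m              ≈⟨ solve 2 (λ s l → s := l :- (:- (s :- l))) refl (s m) l ⟩
        l - - (s m - l)  ≤⟨ +-monoʳ-≤ l (neg-mono-≤ δ≤) ⟩
        l - δ            ∎))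

  the-none : (P : Pred ℝ 0ℓ) → ¬ ∃ P → the P ≡ 0#
  the-none P ¬p with lem {∃ P}
  ... | yes p = contradiction p ¬p
  ... | no  _ = ≡.refl

  -- Sums over initial segments of the naturals

  abstract

    Σ< : ℕ → (ℕ → ℝ) → ℝ
    Σ< n f = sum {n} (f ∘ toℕ)

    Σ<-zero : ∀ f → Σ< 0 f ≈ 0#
    Σ<-zero f = refl

    Σ<-head : ∀ n f → Σ< (suc n) f ≈ f 0 + Σ< n (f ∘ suc)
    Σ<-head n f = refl

    Σ<-last : ∀ n f → Σ< (suc n) f ≈ Σ< n f + f n
    Σ<-last zero    f = +-comm _ _
    Σ<-last (suc n) f = trans (+-congˡ (Σ<-last n (f ∘ suc))) (sym (+-assoc _ _ _))

    Σ<-mono : ∀ n {f g} → (∀ i → i ℕ.< n → f i ≤ g i) → Σ< n f ≤ Σ< n g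
    Σ<-mono zero    f≤g = ≤-refl
    Σ<-mono (suc n) f≤g = +-mono-≤ (f≤g 0 (ℕ.s≤s ℕ.z≤n)) (Σ<-mono n λ i i<n → f≤g (suc i) (ℕ.s≤s i<n))

    Σ<-nonneg : ∀ n {f} → (∀ i → 0# ≤ f i) → 0# ≤ Σ< n f
    Σ<-nonneg n 0≤f = sum-nonneg {n} λ i → 0≤f (toℕ i)

    Σ<-extend : ∀ {m n f} → (∀ i → 0# ≤ f i) → m ℕ.≤ n → Σ< m f ≤ Σ< n f
    Σ<-extend {n = n} 0≤f ℕ.z≤n = Σ<-nonneg n 0≤f
    Σ<-extend 0≤f (ℕ.s≤s m≤n)   = +-monoʳ-≤ _ (Σ<-extend (λ i → 0≤f (suc i)) m≤n)

    Σ<-+ : ∀ n f g → Σ< n (λ i → f i + g i) ≈ Σ< n f + Σ< n g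
    Σ<-+ n f g = ∑-distrib-+ {n} (f ∘ toℕ) (g ∘ toℕ)

    Σ<-*ˡ : ∀ n c f → c * Σ< n f ≈ Σ< n (λ i → c * f i)
    Σ<-*ˡ n c f = *-distribˡ-sum {n} c (f ∘ toℕ)

    Σ<-*ʳ : ∀ n c f → Σ< n f * c ≈ Σ< n (λ i → f i * c)
    Σ<-*ʳ n c f = *-distribʳ-sum {n} c (f ∘ toℕ)

  Σ<-cong : ∀ n {f g} → (∀ i → i ℕ.< n → f i ≈ g i) → Σ< n f ≈ Σ< n g
  Σ<-cong n f≈g = antisym (Σ<-mono n λ i i<n → ≤-reflexive (f≈g i i<n))
    (Σ<-mono n λ i i<n → ≤-reflexive (sym (f≈g i i<n)))

  Σ<-1 : ∀ f → Σ< 1 f ≈ f 0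
  Σ<-1 f = trans (Σ<-last 0 f) (trans (+-congʳ (Σ<-zero f)) (+-identityˡ _))

  -- `conv` is a coefficient of the Cauchy product; `triangle` is the sum of all `a i * b j` with i
  -- + j < n, taken by rows.
  conv triangle : (ℕ → ℝ) → (ℕ → ℝ) → ℕ → ℝ
  conv a b m     = Σ< (suc m) λ i → a i * b (m ℕ.∸ i)
  triangle a b n = Σ< n λ i → a i * Σ< (n ℕ.∸ i) b

  suc-∸ : ∀ {n i} → i ℕ.< suc n → suc n ℕ.∸ i ≡ suc (n ℕ.∸ i)
  suc-∸ (ℕ.s≤s i≤n) = ℕₚ.+-∸-assoc 1 i≤n

  triangle-conv : ∀ a b n → triangle a b n ≈ Σ< n (conv a b)
  triangle-conv a b zero    = trans (Σ<-zero _) (sym (Σ<-zero _))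
  triangle-conv a b (suc n) = begin-equality
    Σ< (suc n) (λ i → a i * Σ< (suc n ℕ.∸ i) b)                      ≈⟨ Σ<-cong (suc n) inner ⟩
    Σ< (suc n) (λ i → a i * Σ< (n ℕ.∸ i) b + a i * b (n ℕ.∸ i))      ≈⟨ Σ<-+ (suc n) _ _ ⟩
    Σ< (suc n) (λ i → a i * Σ< (n ℕ.∸ i) b) + conv a b n             ≈⟨ +-congʳ (Σ<-last n _) ⟩
    triangle a b n + a n * Σ< (n ℕ.∸ n) b + conv a b n               ≈⟨ +-congʳ (+-congˡ empty) ⟩
    triangle a b n + 0# + conv a b n                                 ≈⟨ +-congʳ (+-identityʳ _) ⟩
    triangle a b n + conv a b n                                      ≈⟨ +-congʳ (triangle-conv a b n) ⟩
    Σ< n (conv a b) + conv a b n                                     ≈⟨ Σ<-last n (conv a b) ⟨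
    Σ< (suc n) (conv a b)                                            ∎
    where
    inner : ∀ i → i ℕ.< suc n →
            a i * Σ< (suc n ℕ.∸ i) b ≈ a i * Σ< (n ℕ.∸ i) b + a i * b (n ℕ.∸ i)
    inner i i≤n = begin-equality
      a i * Σ< (suc n ℕ.∸ i) b                       ≡⟨ ≡.cong (λ l → a i * Σ< l b) (suc-∸ i≤n) ⟩
      a i * Σ< (suc (n ℕ.∸ i)) b                     ≈⟨ *-congˡ (Σ<-last (n ℕ.∸ i) b) ⟩
      a i * (Σ< (n ℕ.∸ i) b + b (n ℕ.∸ i))           ≈⟨ distribˡ _ _ _ ⟩
      a i * Σ< (n ℕ.∸ i) b + a i * b (n ℕ.∸ i)       ∎
    empty : a n * Σ< (n ℕ.∸ n) b ≈ 0#
    empty = begin-equality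
      a n * Σ< (n ℕ.∸ n) b  ≡⟨ ≡.cong (λ l → a n * Σ< l b) (ℕₚ.n∸n≡0 n) ⟩
      a n * Σ< 0 b          ≈⟨ *-congˡ (Σ<-zero b) ⟩
      a n * 0#              ≈⟨ zeroʳ _ ⟩
      0#                    ∎

  triangle≤rectangle : ∀ {a b} n → (∀ i → 0# ≤ a i) → (∀ i → 0# ≤ b i) →
                       triangle a b n ≤ Σ< n a * Σ< n b
  triangle≤rectangle {a} {b} n 0≤a 0≤b = begin
    triangle a b n                 ≤⟨ Σ<-mono n (λ i _ → *-monoˡ-≤ (0≤a i) (Σ<-extend 0≤b (ℕₚ.m∸n≤m n i))) ⟩
    Σ< n (λ i → a i * Σ< n b)      ≈⟨ Σ<-*ʳ n _ a ⟨
    Σ< n a * Σ< n b                ∎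

  -- A pair with i < m and j < n has i + j < m + n. This and `triangle≤rectangle` yield the two
  -- halves of `exp-+` from partial sums alone.
  rectangle≤triangle : ∀ {a b} m n → (∀ i → 0# ≤ a i) → (∀ i → 0# ≤ b i) →
                       Σ< m a * Σ< n b ≤ triangle a b (m ℕ.+ n)
  rectangle≤triangle {a} {b} m n 0≤a 0≤b = begin
    Σ< m a * Σ< n b                                ≈⟨ Σ<-*ʳ m _ a ⟩
    Σ< m (λ i → a i * Σ< n b)
      ≤⟨ Σ<-mono m (λ i i<m → *-monoˡ-≤ (0≤a i) (Σ<-extend 0≤b (longer i<m))) ⟩
    Σ< m (λ i → a i * Σ< (m ℕ.+ n ℕ.∸ i) b)
      ≤⟨ Σ<-extend (λ i → *-nonneg (0≤a i) (Σ<-nonneg (m ℕ.+ n ℕ.∸ i) 0≤b)) (ℕₚ.m≤m+n m n) ⟩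
    triangle a b (m ℕ.+ n)                         ∎
    where
    longer : ∀ {i} → i ℕ.< m → n ℕ.≤ m ℕ.+ n ℕ.∸ i
    longer {i} i<m = ≡.subst (n ℕ.≤_) (≡.sym (ℕₚ.+-∸-comm n (ℕₚ.<⇒≤ i<m))) (ℕₚ.m≤n+m n (m ℕ.∸ i))

  -- The sum of a i * b j over i , j < n ≤ i + j is monotone in a.
  rectangle-triangle-mono : ∀ {a a′ b} n → (∀ i → a i ≤ a′ i) → (∀ i → 0# ≤ b i) →
    Σ< n a * Σ< n b - triangle a b n ≤ Σ< n a′ * Σ< n b - triangle a′ b n
  rectangle-triangle-mono {a} {a′} {b} n a≤a′ 0≤b = begin
    Σ< n a * Σ< n b - triangle a b n      ≈⟨ split a ⟩
    Σ< n (λ i → a i * tail i)             ≤⟨ Σ<-mono n (λ i _ → *-monoʳ-≤ (0≤tail i) (a≤a′ i)) ⟩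
    Σ< n (λ i → a′ i * tail i)            ≈⟨ split a′ ⟨
    Σ< n a′ * Σ< n b - triangle a′ b n    ∎
    where
    tail : ℕ → ℝ
    tail i = Σ< n b - Σ< (n ℕ.∸ i) b
    0≤tail : ∀ i → 0# ≤ tail i
    0≤tail i = x≤y⇒0≤y-x (Σ<-extend 0≤b (ℕₚ.m∸n≤m n i))
    split : ∀ a → Σ< n a * Σ< n b - triangle a b n ≈ Σ< n (λ i → a i * tail i)
    split a = begin-equality
      Σ< n a * Σ< n b - triangle a b n                              ≈⟨ +-congʳ (Σ<-*ʳ n _ a) ⟩
      Σ< n (λ i → a i * Σ< n b) - triangle a b n                    ≈⟨ +-congʳ (Σ<-cong n λ i _ →
        solve 3 (λ a b t → a :* b := a :* (b :- t) :+ a :* t) refl (a i) (Σ< n b) (Σ< (n ℕ.∸ i) b)) ⟩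
      Σ< n (λ i → a i * tail i + a i * Σ< (n ℕ.∸ i) b) - triangle a b n ≈⟨ +-congʳ (Σ<-+ n _ _) ⟩
      (Σ< n (λ i → a i * tail i) + triangle a b n) - triangle a b n
        ≈⟨ solve 2 (λ x y → (x :+ y) :- y := x) refl (Σ< n (λ i → a i * tail i)) (triangle a b n) ⟩
      Σ< n (λ i → a i * tail i)                                     ∎

  -- The exponential series

  expTerm : ℝ → ℕ → ℝ
  expTerm x i = x ^ i / fromℕ (i !)

  expSum : ℝ → ℕ → ℝ
  expSum x n = Σ< n (expTerm x)

  abstract

    exp-spec : ∀ {x} → ∃ (IsLimit (expSum x)) → IsLimit (expSum x) (exp x)
    exp-spec {x} = the-spec (IsLimit (expSum x))

    exp-junk : ∀ {x} → ¬ ∃ (IsLimit (expSum x)) → exp x ≡ 0#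
    exp-junk {x} = the-none (IsLimit (expSum x))

  0<n! : ∀ n → 0# < fromℕ (n !)
  0<n! n = fromℕ-positive (ℕₚ.1≤n! n)

  expTerm-nonneg : ∀ {x} → 0# ≤ x → ∀ i → 0# ≤ expTerm x i
  expTerm-nonneg 0≤x i = *-nonneg (^-nonneg i 0≤x) (proj₁ (⁻¹-positive (0<n! i)))

  expTerm-cong : ∀ {x y} → x ≈ y → ∀ i → expTerm x i ≈ expTerm y i
  expTerm-cong x≈y i = *-congʳ (^-congˡ i x≈y)

  1⁻¹≈1 : fromℕ 1 ⁻¹ ≈ 1#
  1⁻¹≈1 = begin-equality
    fromℕ 1 ⁻¹              ≈⟨ *-identityˡ _ ⟨
    1# * fromℕ 1 ⁻¹         ≈⟨ *-congʳ fromℕ-1 ⟨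
    fromℕ 1 * fromℕ 1 ⁻¹    ≈⟨ *-inverseʳ (fromℕ-positive {1} ℕₚ.≤-refl) ⟩
    1#                      ∎

  expTerm-0 : ∀ x → expTerm x 0 ≈ 1#
  expTerm-0 x = trans (*-identityˡ _) 1⁻¹≈1

  expTerm-1 : ∀ x → expTerm x 1 ≈ x
  expTerm-1 x = begin-equality
    x * 1# * fromℕ 1 ⁻¹ ≈⟨ *-cong (*-identityʳ x) 1⁻¹≈1 ⟩
    x * 1#              ≈⟨ *-identityʳ x ⟩
    x                   ∎

  expTerm-suc : ∀ x i → fromℕ (suc i) * expTerm x (suc i) ≈ x * expTerm x i
  expTerm-suc x i = begin-equality
    s * (x * p * q)               ≈⟨ *-identityˡ _ ⟨
    1# * (s * (x * p * q))        ≈⟨ *-congʳ (*-inverseʳ (0<n! i)) ⟨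
    (f * r) * (s * (x * p * q))   ≈⟨ solve 6 (λ f r s x p q →
      (f :* r) :* (s :* (x :* p :* q)) := ((s :* f) :* q) :* (x :* (p :* r))) refl f r s x p q ⟩
    ((s * f) * q) * (x * (p * r)) ≈⟨ *-congʳ (*-congʳ (fromℕ-* (suc i) (i !))) ⟨
    (fromℕ (suc i !) * q) * (x * (p * r)) ≈⟨ *-congʳ (*-inverseʳ (0<n! (suc i))) ⟩
    1# * (x * (p * r))            ≈⟨ *-identityˡ _ ⟩
    x * (p * r)                   ∎
    where
    s = fromℕ (suc i)
    f = fromℕ (i !)
    p = x ^ i
    q = fromℕ (suc i !) ⁻¹
    r = fromℕ (i !) ⁻¹

  -- Both sides satisfy (m + 1) c (m + 1) = (x + y) c m.
  expTerm-+ : ∀ x y m → expTerm (x + y) m ≈ conv (expTerm x) (expTerm y) m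
  expTerm-+ x y zero = begin-equality
    expTerm (x + y) 0                    ≈⟨ expTerm-0 (x + y) ⟩
    1#                                   ≈⟨ *-identityʳ 1# ⟨
    1# * 1#                              ≈⟨ *-cong (expTerm-0 x) (expTerm-0 y) ⟨
    expTerm x 0 * expTerm y 0            ≈⟨ Σ<-1 _ ⟨
    conv (expTerm x) (expTerm y) 0       ∎
  expTerm-+ x y (suc m) = begin-equality
    expTerm (x + y) (suc m)                            ≈⟨ x⁻¹*[x*y]≈y _ 0<M ⟨
    M ⁻¹ * (M * expTerm (x + y) (suc m))               ≈⟨ *-congˡ (expTerm-suc (x + y) m) ⟩
    M ⁻¹ * ((x + y) * expTerm (x + y) m)               ≈⟨ *-congˡ (*-congˡ (expTerm-+ x y m)) ⟩
    M ⁻¹ * ((x + y) * conv a b m)                      ≈⟨ *-congˡ (distribʳ _ _ _) ⟩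
    M ⁻¹ * (x * conv a b m + y * conv a b m)           ≈⟨ *-congˡ (+-cong left right) ⟩
    M ⁻¹ * (Σ< (suc (suc m)) (λ i → fromℕ i * a i * b (suc m ℕ.∸ i)) +
            Σ< (suc (suc m)) (λ i → a i * (fromℕ (suc m ℕ.∸ i) * b (suc m ℕ.∸ i))))
              ≈⟨ *-congˡ (Σ<-+ (suc (suc m)) _ _) ⟨
    M ⁻¹ * Σ< (suc (suc m)) (λ i → fromℕ i * a i * b (suc m ℕ.∸ i) +
            a i * (fromℕ (suc m ℕ.∸ i) * b (suc m ℕ.∸ i))) ≈⟨ *-congˡ (Σ<-cong (suc (suc m)) merge) ⟩
    M ⁻¹ * Σ< (suc (suc m)) (λ i → M * (a i * b (suc m ℕ.∸ i))) ≈⟨ *-congˡ (Σ<-*ˡ (suc (suc m)) M _) ⟨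
    M ⁻¹ * (M * conv a b (suc m))                      ≈⟨ x⁻¹*[x*y]≈y _ 0<M ⟩
    conv a b (suc m)                                   ∎
    where
    a = expTerm x
    b = expTerm y
    M = fromℕ (suc m)
    0<M : 0# < M
    0<M = fromℕ-positive {suc m} (ℕ.s≤s ℕ.z≤n)
    left : x * conv a b m ≈ Σ< (suc (suc m)) (λ i → fromℕ i * a i * b (suc m ℕ.∸ i))
    left = begin-equality
      x * conv a b m                                               ≈⟨ Σ<-*ˡ (suc m) x _ ⟩
      Σ< (suc m) (λ i → x * (a i * b (m ℕ.∸ i)))                   ≈⟨ Σ<-cong (suc m) (λ i _ →
        trans (sym (*-assoc _ _ _)) (*-congʳ (sym (expTerm-suc x i)))) ⟩
      Σ< (suc m) (λ i → fromℕ (suc i) * a (suc i) * b (m ℕ.∸ i))   ≈⟨ +-identityˡ _ ⟨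
      0# + Σ< (suc m) (λ i → fromℕ (suc i) * a (suc i) * b (m ℕ.∸ i))
        ≈⟨ +-congʳ (trans (*-congʳ (zeroˡ _)) (zeroˡ _)) ⟨
      0# * a 0 * b (suc m) + Σ< (suc m) (λ i → fromℕ (suc i) * a (suc i) * b (m ℕ.∸ i)) ≈⟨ Σ<-head (suc m) _ ⟨
      Σ< (suc (suc m)) (λ i → fromℕ i * a i * b (suc m ℕ.∸ i))     ∎
    right : y * conv a b m ≈ Σ< (suc (suc m)) (λ i → a i * (fromℕ (suc m ℕ.∸ i) * b (suc m ℕ.∸ i)))
    right = begin-equality
      y * conv a b m                                               ≈⟨ Σ<-*ˡ (suc m) y _ ⟩
      Σ< (suc m) (λ i → y * (a i * b (m ℕ.∸ i)))                   ≈⟨ Σ<-cong (suc m) step ⟩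
      Σ< (suc m) g                                                 ≈⟨ +-identityʳ _ ⟨
      Σ< (suc m) g + 0#                                            ≈⟨ +-congˡ last ⟨
      Σ< (suc m) g + g (suc m)                                     ≈⟨ Σ<-last (suc m) g ⟨
      Σ< (suc (suc m)) g                                           ∎
      where
      g : ℕ → ℝ
      g i = a i * (fromℕ (suc m ℕ.∸ i) * b (suc m ℕ.∸ i))
      step : ∀ i → i ℕ.< suc m → y * (a i * b (m ℕ.∸ i)) ≈ g i
      step i i≤m = begin-equality
        y * (a i * b (m ℕ.∸ i))
          ≈⟨ solve 3 (λ y a b → y :* (a :* b) := a :* (y :* b)) refl y (a i) (b (m ℕ.∸ i)) ⟩
        a i * (y * b (m ℕ.∸ i))                                ≈⟨ *-congˡ (expTerm-suc y (m ℕ.∸ i)) ⟨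
        a i * (fromℕ (suc (m ℕ.∸ i)) * b (suc (m ℕ.∸ i)))
          ≡⟨ ≡.cong (λ l → a i * (fromℕ l * b l)) (suc-∸ i≤m) ⟨
        g i                                                    ∎
      last : g (suc m) ≈ 0#
      last = begin-equality
        g (suc m)                   ≡⟨ ≡.cong (λ l → a (suc m) * (fromℕ l * b l)) (ℕₚ.n∸n≡0 m) ⟩
        a (suc m) * (0# * b 0)      ≈⟨ *-congˡ (zeroˡ _) ⟩
        a (suc m) * 0#              ≈⟨ zeroʳ _ ⟩
        0#                          ∎
    merge : ∀ i → i ℕ.< suc (suc m) →
            fromℕ i * a i * b (suc m ℕ.∸ i) + a i * (fromℕ (suc m ℕ.∸ i) * b (suc m ℕ.∸ i)) ≈
            M * (a i * b (suc m ℕ.∸ i))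
    merge i (ℕ.s≤s i≤m) = begin-equality
      fromℕ i * a i * b l + a i * (fromℕ l * b l)  ≈⟨ solve 4 (λ i l a b →
        i :* a :* b :+ a :* (l :* b) := (i :+ l) :* (a :* b)) refl (fromℕ i) (fromℕ l) (a i) (b l) ⟩
      (fromℕ i + fromℕ l) * (a i * b l)            ≈⟨ *-congʳ (fromℕ-+ i l) ⟨
      fromℕ (i ℕ.+ l) * (a i * b l)
        ≡⟨ ≡.cong (λ l′ → fromℕ l′ * (a i * b l)) (ℕₚ.m+[n∸m]≡n i≤m) ⟩
      M * (a i * b l)                              ∎
      where l = suc m ℕ.∸ i

  expSum-+ : ∀ x y n → expSum (x + y) n ≈ triangle (expTerm x) (expTerm y) n
  expSum-+ x y n = trans (Σ<-cong n λ i _ → expTerm-+ x y i) (sym (triangle-conv _ _ n))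

  expSum-mono : ∀ {x m n} → 0# ≤ x → m ℕ.≤ n → expSum x m ≤ expSum x n
  expSum-mono 0≤x = Σ<-extend (expTerm-nonneg 0≤x)

  expSum-monoˡ : ∀ {x y} n → 0# ≤ x → x ≤ y → expSum x n ≤ expSum y n
  expSum-monoˡ n 0≤x x≤y = Σ<-mono n λ i _ →
    *-monoʳ-≤ (proj₁ (⁻¹-positive (0<n! i))) (^-mono-≤ i 0≤x x≤y)

  expSum-+≤* : ∀ {x y} n → 0# ≤ x → 0# ≤ y → expSum (x + y) n ≤ expSum x n * expSum y n
  expSum-+≤* {x} {y} n 0≤x 0≤y = ≤-trans (≤-reflexive (expSum-+ x y n))
    (triangle≤rectangle n (expTerm-nonneg 0≤x) (expTerm-nonneg 0≤y))

  expSum-*≤+ : ∀ {x y} m n → 0# ≤ x → 0# ≤ y → expSum x m * expSum y n ≤ expSum (x + y) (m ℕ.+ n)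
  expSum-*≤+ {x} {y} m n 0≤x 0≤y = ≤-trans
    (rectangle≤triangle m n (expTerm-nonneg 0≤x) (expTerm-nonneg 0≤y))
    (≤-reflexive (sym (expSum-+ x y (m ℕ.+ n))))

  expTerm≤^ : ∀ {x} i → 0# ≤ x → expTerm x i ≤ x ^ i
  expTerm≤^ {x} i 0≤x = *-cancelˡ-≤ (0<n! i) (begin
    fromℕ (i !) * (x ^ i * fromℕ (i !) ⁻¹)  ≈⟨ solve 3 (λ f p r → f :* (p :* r) := p :* (f :* r)) refl _ _ _ ⟩
    x ^ i * (fromℕ (i !) * fromℕ (i !) ⁻¹)  ≈⟨ *-congˡ (*-inverseʳ (0<n! i)) ⟩
    x ^ i * 1#                              ≈⟨ *-comm _ _ ⟩
    1# * x ^ i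
      ≤⟨ *-monoʳ-≤ (^-nonneg i 0≤x) (≤-trans (≤-reflexive (sym fromℕ-1)) (fromℕ-mono (ℕₚ.1≤n! i))) ⟩
    fromℕ (i !) * x ^ i                     ∎)

  geometric : ∀ {x} n → 0# ≤ x → x ≤ 1# → (1# - x) * Σ< n (x ^_) ≤ 1#
  geometric {x} zero    0≤x x≤1 = ≤-trans (≤-reflexive (trans (*-congˡ (Σ<-zero _)) (zeroʳ _))) 0≤1
  geometric {x} (suc n) 0≤x x≤1 = begin
    (1# - x) * Σ< (suc n) (x ^_)                  ≈⟨ *-congˡ (Σ<-head n (x ^_)) ⟩
    (1# - x) * (1# + Σ< n (λ i → x * x ^ i))      ≈⟨ *-congˡ (+-congˡ (Σ<-*ˡ n x (x ^_))) ⟨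
    (1# - x) * (1# + x * Σ< n (x ^_))             ≈⟨ solve 2 (λ x g →
      (con (+ 1) :- x) :* (con (+ 1) :+ x :* g) := (con (+ 1) :- x) :+ x :* ((con (+ 1) :- x) :* g)) refl x (Σ< n (x ^_)) ⟩
    (1# - x) + x * ((1# - x) * Σ< n (x ^_))       ≤⟨ +-monoʳ-≤ _ (*-monoˡ-≤ 0≤x (geometric n 0≤x x≤1)) ⟩
    (1# - x) + x * 1#
      ≈⟨ solve 1 (λ x → (con (+ 1) :- x) :+ x :* con (+ 1) := con (+ 1)) refl x ⟩
    1#                                            ∎

  [1-x]*expSum≤1 : ∀ {x} n → 0# ≤ x → x ≤ 1# → (1# - x) * expSum x n ≤ 1#
  [1-x]*expSum≤1 {x} n 0≤x x≤1 = ≤-trans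
    (*-monoˡ-≤ (x≤y⇒0≤y-x x≤1) (Σ<-mono n λ i _ → expTerm≤^ i 0≤x)) (geometric n 0≤x x≤1)

  ½ : ℝ
  ½ = fromℕ 2 ⁻¹

  0<2 : 0# < fromℕ 2
  0<2 = fromℕ-positive {2} (ℕ.s≤s ℕ.z≤n)

  0<½ : 0# < ½
  0<½ = ⁻¹-positive 0<2

  ½+½≈1 : ½ + ½ ≈ 1#
  ½+½≈1 = trans (solve 1 (λ h → h :+ h := numeral 2 :* h) refl ½) (*-inverseʳ 0<2)

  ½≤1 : ½ ≤ 1#
  ½≤1 = ≤-offset ½ (proj₁ 0<½) (sym ½+½≈1)

  expSum-½-bound : ∀ n → expSum ½ n ≤ fromℕ 2
  expSum-½-bound n = *-cancelˡ-≤ 0<½ (begin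
    ½ * expSum ½ n           ≈⟨ *-congʳ (solve 1 (λ h → h := (h :+ h) :- h) refl ½) ⟩
    (½ + ½ - ½) * expSum ½ n ≈⟨ *-congʳ (+-congʳ ½+½≈1) ⟩
    (1# - ½) * expSum ½ n    ≤⟨ [1-x]*expSum≤1 n (proj₁ 0<½) ½≤1 ⟩
    1#                       ≈⟨ *-inverseˡ 0<2 ⟨
    ½ * fromℕ 2              ∎)

  -- At ½ the comparison with a geometric series gives 2, and each further ½ in the argument at most
  -- doubles the bound. This gives convergence at every nonnegative argument.
  expSum-m½-bound : ∀ m n → expSum (fromℕ m * ½) n ≤ fromℕ 2 ^ m
  expSum-m½-bound zero    n = begin
    expSum (0# * ½) n            ≈⟨ Σ<-cong n (λ i _ → expTerm-cong (zeroˡ ½) i) ⟩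
    expSum 0# n                  ≈⟨ solve 1 (λ e → e := (con (+ 1) :- con (+ 0)) :* e) refl (expSum 0# n) ⟩
    (1# - 0#) * expSum 0# n      ≤⟨ [1-x]*expSum≤1 n ≤-refl 0≤1 ⟩
    1#                           ∎
  expSum-m½-bound (suc m) n = begin
    expSum (fromℕ (suc m) * ½) n       ≈⟨ Σ<-cong n (λ i _ → expTerm-cong
      (solve 2 (λ m h → (con (+ 1) :+ m) :* h := h :+ m :* h) refl (fromℕ m) ½) i) ⟩
    expSum (½ + fromℕ m * ½) n         ≤⟨ expSum-+≤* n (proj₁ 0<½) 0≤m½ ⟩
    expSum ½ n * expSum (fromℕ m * ½) n ≤⟨ *-mono-≤ (Σ<-nonneg n (expTerm-nonneg (proj₁ 0<½)))
                                             (^-nonneg m (proj₁ 0<2)) (expSum-½-bound n) (expSum-m½-bound m n) ⟩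
    fromℕ 2 * fromℕ 2 ^ m              ∎
    where
    0≤m½ = *-nonneg (fromℕ-nonneg m) (proj₁ 0<½)

  exp-limit : ∀ {x} → 0# ≤ x → IsLimit (expSum x) (exp x)
  exp-limit {x} 0≤x with archimedean x
  ... | m , x≤m = exp-spec (monotone-limit (expSum x) (fromℕ 2 ^ (m ℕ.* 2)) (expSum-mono 0≤x) λ n → begin
    expSum x n                         ≤⟨ expSum-monoˡ n 0≤x x≤2m½ ⟩
    expSum (fromℕ (m ℕ.* 2) * ½) n     ≤⟨ expSum-m½-bound (m ℕ.* 2) n ⟩
    fromℕ 2 ^ (m ℕ.* 2)                ∎)
    where
    x≤2m½ : x ≤ fromℕ (m ℕ.* 2) * ½
    x≤2m½ = begin
      x                       ≤⟨ x≤m ⟩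
      fromℕ m                 ≈⟨ *-identityʳ _ ⟨
      fromℕ m * 1#            ≈⟨ *-congˡ (*-inverseʳ 0<2) ⟨
      fromℕ m * (fromℕ 2 * ½) ≈⟨ *-assoc _ _ _ ⟨
      fromℕ m * fromℕ 2 * ½   ≈⟨ *-congʳ (fromℕ-* m 2) ⟨
      fromℕ (m ℕ.* 2) * ½     ∎

  expSum≤exp : ∀ {x} n → 0# ≤ x → expSum x n ≤ exp x
  expSum≤exp {x} n 0≤x = limit-≥ (expSum x n) n (exp-limit 0≤x) λ m → expSum-mono 0≤x

  exp-least : ∀ {x B} → 0# ≤ x → (∀ n → expSum x n ≤ B) → exp x ≤ B
  exp-least {x} {B} 0≤x h = limit-≤ B 0 (exp-limit 0≤x) λ m _ → h m

  -- The factor may vanish, like 1 - x at x = 1; in that case the empty partial sum gives the claim,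
  -- and otherwise division by c does.
  *-exp-least : ∀ {c x B} → 0# ≤ c → 0# ≤ x → (∀ n → c * expSum x n ≤ B) → c * exp x ≤ B
  *-exp-least {c} {x} {B} 0≤c 0≤x h with lem {0# ≈ c}
  ... | yes 0≈c = begin
    c * exp x      ≈⟨ *-congʳ 0≈c ⟨
    0# * exp x     ≈⟨ zeroˡ _ ⟩
    0#             ≈⟨ zeroʳ c ⟨
    c * 0#         ≈⟨ *-congˡ (Σ<-zero _) ⟨
    c * expSum x 0 ≤⟨ h 0 ⟩
    B              ∎
  ... | no 0≉c = begin
    c * exp x
      ≤⟨ *-monoˡ-≤ 0≤c (exp-least 0≤x λ n → *-cancelˡ-≤ (0≤c , 0≉c) (≤-trans (h n) (≤-reflexive (sym (x*[x⁻¹*y]≈y B (0≤c , 0≉c)))))) ⟩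
    c * (c ⁻¹ * B) ≈⟨ x*[x⁻¹*y]≈y B (0≤c , 0≉c) ⟩
    B              ∎

  expSum-nonneg : ∀ {x} n → 0# ≤ x → 0# ≤ expSum x n
  expSum-nonneg n 0≤x = Σ<-nonneg n (expTerm-nonneg 0≤x)

  exp-nonneg : ∀ {x} → 0# ≤ x → 0# ≤ exp x
  exp-nonneg 0≤x = ≤-trans (expSum-nonneg 0 0≤x) (expSum≤exp 0 0≤x)

  exp-+ : ∀ {x y} → 0# ≤ x → 0# ≤ y → exp (x + y) ≈ exp x * exp y
  exp-+ {x} {y} 0≤x 0≤y = antisym
    (exp-least 0≤x+y λ n → ≤-trans (expSum-+≤* n 0≤x 0≤y)
      (*-mono-≤ (expSum-nonneg n 0≤x) (exp-nonneg 0≤y) (expSum≤exp n 0≤x) (expSum≤exp n 0≤y)))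
    (*-exp-least (exp-nonneg 0≤x) 0≤y λ n → begin
      exp x * expSum y n ≈⟨ *-comm _ _ ⟩
      expSum y n * exp x ≤⟨ *-exp-least (expSum-nonneg n 0≤y) 0≤x (λ m → begin
        expSum y n * expSum x m      ≈⟨ *-comm _ _ ⟩
        expSum x m * expSum y n      ≤⟨ expSum-*≤+ m n 0≤x 0≤y ⟩
        expSum (x + y) (m ℕ.+ n)     ≤⟨ expSum≤exp _ 0≤x+y ⟩
        exp (x + y)                  ∎) ⟩
      exp (x + y)        ∎)
    where
    0≤x+y = +-nonneg 0≤x 0≤y

  1+x≤exp : ∀ {x} → 0# ≤ x → 1# + x ≤ exp x
  1+x≤exp {x} 0≤x = begin
    1# + x          ≈⟨ +-cong (expTerm-0 x) (expTerm-1 x) ⟨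
    expTerm x 0 + expTerm x 1 ≈⟨ +-congʳ (Σ<-1 _) ⟨
    expSum x 1 + expTerm x 1  ≈⟨ Σ<-last 1 _ ⟨
    expSum x 2      ≤⟨ expSum≤exp 2 0≤x ⟩
    exp x           ∎

  -- The estimate exp x ≤ 1 / (1 - x), from the geometric series. Together with `1+x≤exp` it takes
  -- the place of continuity in `exp-surjective`.
  [1-x]*exp≤1 : ∀ {x} → 0# ≤ x → x ≤ 1# → (1# - x) * exp x ≤ 1#
  [1-x]*exp≤1 0≤x x≤1 = *-exp-least (x≤y⇒0≤y-x x≤1) 0≤x λ n → [1-x]*expSum≤1 n 0≤x x≤1

  exp-mono : ∀ {x y} → 0# ≤ x → x ≤ y → exp x ≤ exp y
  exp-mono 0≤x x≤y = exp-least 0≤x λ n → ≤-trans (expSum-monoˡ n 0≤x x≤y) (expSum≤exp n (≤-trans 0≤x x≤y))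

  exp-cong : ∀ {x y} → 0# ≤ x → x ≈ y → exp x ≈ exp y
  exp-cong 0≤x x≈y = antisym (exp-mono 0≤x (≤-reflexive x≈y))
    (exp-mono (≤-trans 0≤x (≤-reflexive x≈y)) (≤-reflexive (sym x≈y)))

  1≤exp : ∀ {x} → 0# ≤ x → 1# ≤ exp x
  1≤exp {x} 0≤x = ≤-trans (≤-offset x 0≤x refl) (1+x≤exp 0≤x)

  exp-positive : ∀ {x} → 0# ≤ x → 0# < exp x
  exp-positive 0≤x = 0<-trans-≤ 0<1 (1≤exp 0≤x)

  exp-0 : exp 0# ≈ 1#
  exp-0 = antisym (≤-trans (≤-reflexive (solve 1 (λ e → e := (con (+ 1) :- con (+ 0)) :* e) refl (exp 0#)))
    ([1-x]*exp≤1 ≤-refl 0≤1)) (1≤exp ≤-refl)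

  exp-^ : ∀ {x} n → 0# ≤ x → exp (fromℕ n * x) ≈ exp x ^ n
  exp-^ {x} zero    0≤x = trans (exp-cong (≤-reflexive (sym (zeroˡ x))) (zeroˡ x)) exp-0
  exp-^ {x} (suc n) 0≤x = begin-equality
    exp (fromℕ (suc n) * x)        ≈⟨ exp-cong (*-nonneg (fromℕ-nonneg (suc n)) 0≤x)
      (solve 2 (λ n x → (con (+ 1) :+ n) :* x := x :+ n :* x) refl (fromℕ n) x) ⟩
    exp (x + fromℕ n * x)          ≈⟨ exp-+ 0≤x (*-nonneg (fromℕ-nonneg n) 0≤x) ⟩
    exp x * exp (fromℕ n * x)      ≈⟨ *-congˡ (exp-^ n 0≤x) ⟩
    exp x * exp x ^ n              ∎

  ^-neg-bounds : ∀ {y} i → 0# ≤ y → (- y) ^ i ≤ y ^ i × - (y ^ i) ≤ (- y) ^ i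
  ^-neg-bounds zero    0≤y = ≤-refl , ≤-trans (neg-mono-≤ 0≤1) (≤-trans (≤-reflexive -0#≈0#) 0≤1)
  ^-neg-bounds {y} (suc i) 0≤y with ^-neg-bounds i 0≤y
  ... | upper , lower = (begin
      - y * p          ≈⟨ solve 2 (λ y p → :- y :* p := y :* (:- p)) refl y p ⟩
      y * - p          ≤⟨ *-monoˡ-≤ 0≤y (neg-mono-≤ lower) ⟩
      y * - - (y ^ i)  ≈⟨ *-congˡ (-‿involutive _) ⟩
      y * y ^ i        ∎) , (begin
      - (y * y ^ i)    ≤⟨ neg-mono-≤ (*-monoˡ-≤ 0≤y upper) ⟩
      - (y * p)        ≈⟨ -‿distribˡ-* y p ⟩
      - y * p          ∎)
    where
    p = (- y) ^ i

  exp-approx : ∀ {x δ} → 0# ≤ x → 0# < δ → ∃ λ N → ∀ m → N ℕ.≤ m → exp x - expSum x m ≤ δ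
  exp-approx {x} {δ} 0≤x 0<δ = let N , close = exp-limit 0≤x δ 0<δ in N , λ m N≤m → begin
    exp x - expSum x m          ≈⟨ solve 2 (λ e s → e :- s := :- (s :- e)) refl (exp x) (expSum x m) ⟩
    - (expSum x m - exp x)      ≤⟨ -x≤∣x∣ (expSum x m - exp x) ⟩
    ∣ expSum x m - exp x ∣      ≤⟨ proj₁ (close m N≤m) ⟩
    δ                           ∎

  -- The product of two partial sums is a triangle and a corner. The triangle is a partial sum of
  -- the series at 0; the corner only grows when `- y` is replaced by `y`, and then it is at most a
  -- tail of the series at `y + y`.
  expSum-neg-*-bound : ∀ {y} m → 0# ≤ y →
    expSum (- y) m * expSum y m ≤ 1# + (exp (y + y) - expSum (y + y) m)
  expSum-neg-*-bound {y} m 0≤y = begin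
    u * v                                ≈⟨ solve 2 (λ p t → p := t :+ (p :- t)) refl (u * v) t ⟩
    t + (u * v - t)
      ≤⟨ +-mono-≤ t≤1 (rectangle-triangle-mono m expTerm-neg (expTerm-nonneg 0≤y)) ⟩
    1# + (v * v - triangle (expTerm y) (expTerm y) m)
      ≤⟨ +-monoʳ-≤ 1# (+-mono-≤ (≤-trans (expSum-*≤+ m m 0≤y 0≤y) (expSum≤exp (m ℕ.+ m) (+-nonneg 0≤y 0≤y)))
           (≤-reflexive (-‿cong (sym (expSum-+ y y m))))) ⟩
    1# + (exp (y + y) - expSum (y + y) m) ∎
    where
    u = expSum (- y) m
    v = expSum y m
    t = triangle (expTerm (- y)) (expTerm y) m
    expTerm-neg : ∀ i → expTerm (- y) i ≤ expTerm y i
    expTerm-neg i = *-monoʳ-≤ (proj₁ (⁻¹-positive (0<n! i))) (proj₁ (^-neg-bounds i 0≤y))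
    t≤1 : t ≤ 1#
    t≤1 = begin
      t                     ≈⟨ expSum-+ (- y) y m ⟨
      expSum (- y + y) m    ≈⟨ Σ<-cong m (λ i _ → expTerm-cong (-‿inverseˡ y) i) ⟩
      expSum 0# m           ≤⟨ expSum-monoˡ m ≤-refl (≤-reflexive (sym (zeroˡ ½))) ⟩
      expSum (0# * ½) m     ≤⟨ expSum-m½-bound 0 m ⟩
      1#                    ∎

  1≤expSum : ∀ {y m} → 0# ≤ y → 1 ℕ.≤ m → 1# ≤ expSum y m
  1≤expSum {y} {m} 0≤y 1≤m = begin
    1#                                 ≈⟨ expTerm-0 y ⟨
    expTerm y 0                        ≈⟨ Σ<-1 _ ⟨
    expSum y 1                         ≤⟨ expSum-mono 0≤y 1≤m ⟩
    expSum y m                         ∎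

  expSum-neg-bound : ∀ {y} → 0# ≤ y → ∃ λ N → ∀ m → N ℕ.≤ m → expSum (- y) m ≤ 1# + ½
  -- With `suc N` the zeroth term is always present, so `expSum y m` is at least 1 and multiplying a
  -- nonnegative partial sum by it does not decrease that sum.
  expSum-neg-bound {y} 0≤y = let N , close = exp-approx (+-nonneg 0≤y 0≤y) 0<½ in suc N , bound N close
    where
    bound : ∀ N → (∀ m → N ℕ.≤ m → exp (y + y) - expSum (y + y) m ≤ ½) →
            ∀ m → suc N ℕ.≤ m → expSum (- y) m ≤ 1# + ½
    bound N close m N<m with total (expSum (- y) m) 0#
    ... | inj₁ ≤0 = ≤-trans ≤0 (+-nonneg 0≤1 (proj₁ 0<½))
    ... | inj₂ 0≤ = begin
      expSum (- y) m                     ≈⟨ *-identityʳ _ ⟨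
      expSum (- y) m * 1#                ≤⟨ *-monoˡ-≤ 0≤ (1≤expSum 0≤y (ℕₚ.≤-trans (ℕ.s≤s ℕ.z≤n) N<m)) ⟩
      expSum (- y) m * expSum y m        ≤⟨ expSum-neg-*-bound m 0≤y ⟩
      1# + (exp (y + y) - expSum (y + y) m) ≤⟨ +-monoʳ-≤ 1# (close m (ℕₚ.<⇒≤ N<m)) ⟩
      1# + ½                             ∎

  -- `log` is a description: of its value only the equation `exp (log y) ≈ y` is known, so negative
  -- solutions have to be excluded. If the series at x converges, the limit inherits the eventual
  -- bound on its partial sums; if not, `exp x` is the default value 0.
  exp-neg-bound : ∀ {x} → x ≤ 0# → exp x ≤ 1# + ½
  exp-neg-bound {x} x≤0 = cases (lem {∃ (IsLimit (expSum x))})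
    where
    0≤-x : 0# ≤ - x
    0≤-x = ≤-trans (≤-reflexive (sym -0#≈0#)) (neg-mono-≤ x≤0)
    cases : Dec (∃ (IsLimit (expSum x))) → exp x ≤ 1# + ½
    cases (no ¬limit) = ≡.subst (_≤ 1# + ½) (≡.sym (exp-junk ¬limit)) (+-nonneg 0≤1 (proj₁ 0<½))
    cases (yes limit) = let N , bound = expSum-neg-bound 0≤-x in
      limit-≤ (1# + ½) N (exp-spec limit) λ m N≤m → begin
        expSum x m         ≈⟨ Σ<-cong m (λ i _ → expTerm-cong (-‿involutive x) i) ⟨
        expSum (- - x) m   ≤⟨ bound m N≤m ⟩
        1# + ½             ∎

  -- Logarithm and square root

  -- Let s be the supremum of the x ≥ 0 with exp x ≤ y. If exp s < y, then δ = 1 - exp s / y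
  -- satisfies exp (s + δ) ≤ exp s / (1 - δ) = y, so s is no upper bound. If y < exp s, then with δ
  -- = 1 - y / exp s already s - δ is an upper bound.
  exp-surjective : ∀ {y} → 1# ≤ y → ∃ λ x → 0# ≤ x × exp x ≈ y
  exp-surjective {y} 1≤y = s , 0≤s , antisym es≤y y≤es
    where
    S : Pred ℝ 0ℓ
    S x = 0# ≤ x × exp x ≤ y
    0∈S : S 0#
    0∈S = ≤-refl , ≤-trans (≤-reflexive exp-0) 1≤y
    lub : ∃ (IsLub S)
    lub = complete S (0# , 0∈S) (y , λ x (0≤x , ex≤y) →
      ≤-trans (≤-trans (≤-offset 1# 0≤1 (+-comm _ _)) (1+x≤exp 0≤x)) ex≤y)
    s = proj₁ lub
    upper = proj₁ (proj₂ lub)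
    least = proj₂ (proj₂ lub)
    0<y : 0# < y
    0<y = 0<-trans-≤ 0<1 1≤y
    0≤s : 0# ≤ s
    0≤s = upper 0# 0∈S
    y≤es : y ≤ exp s
    y≤es = ≮⇒≤ λ es<y → <⇒≱ (s<s+δ es<y) (upper (s + δ) (+-nonneg 0≤s (proj₁ (0<δ es<y)) , es+δ≤y es<y))
      where
      δ = 1# - y ⁻¹ * exp s
      0≤ : 0# ≤ y ⁻¹ * exp s
      0≤ = *-nonneg (proj₁ (⁻¹-positive 0<y)) (exp-nonneg 0≤s)
      0<δ : exp s < y → 0# < δ
      0<δ es<y = x<y⇒0<y-x (≰⇒> λ 1≤ → <⇒≱ es<y (begin
        y                  ≈⟨ *-identityʳ y ⟨
        y * 1#             ≤⟨ *-monoˡ-≤ (proj₁ 0<y) 1≤ ⟩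
        y * (y ⁻¹ * exp s) ≈⟨ x*[x⁻¹*y]≈y _ 0<y ⟩
        exp s              ∎))
      δ≤1 : δ ≤ 1#
      δ≤1 = ≤-offset (y ⁻¹ * exp s) 0≤ (solve 1 (λ z → con (+ 1) := (con (+ 1) :- z) :+ z) refl _)
      es+δ≤y : exp s < y → exp (s + δ) ≤ y
      es+δ≤y es<y = let 0≤δ = proj₁ (0<δ es<y) in begin
        exp (s + δ)                       ≈⟨ exp-+ 0≤s 0≤δ ⟩
        exp s * exp δ                     ≈⟨ *-congʳ (x*[x⁻¹*y]≈y _ 0<y) ⟨
        y * (y ⁻¹ * exp s) * exp δ        ≈⟨ *-assoc _ _ _ ⟩
        y * (y ⁻¹ * exp s * exp δ)
          ≈⟨ *-congˡ (*-congʳ (solve 1 (λ z → z := con (+ 1) :- (con (+ 1) :- z)) refl _)) ⟩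
        y * ((1# - δ) * exp δ)            ≤⟨ *-monoˡ-≤ (proj₁ 0<y) ([1-x]*exp≤1 0≤δ δ≤1) ⟩
        y * 1#                            ≈⟨ *-identityʳ y ⟩
        y                                 ∎
      s<s+δ : exp s < y → s < s + δ
      s<s+δ es<y = ≰⇒> λ h → <⇒≱ (0<δ es<y) (+-cancelˡ-≤ s (≤-trans h (≤-reflexive (sym (+-identityʳ s)))))
    es≤y : exp s ≤ y
    es≤y = ≮⇒≤ λ y<e → <⇒≱ (s-δ<s y<e) (least (s - δ) (s-δ-upper y<e))
      where
      e = exp s
      0<e : 0# < e
      0<e = exp-positive 0≤s
      δ = 1# - e ⁻¹ * y
      0<δ : y < e → 0# < δ
      0<δ y<e = x<y⇒0<y-x (≰⇒> λ 1≤ → <⇒≱ y<e (begin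
        e                  ≈⟨ *-identityʳ e ⟨
        e * 1#             ≤⟨ *-monoˡ-≤ (proj₁ 0<e) 1≤ ⟩
        e * (e ⁻¹ * y)     ≈⟨ x*[x⁻¹*y]≈y _ 0<e ⟩
        y                  ∎))
      δ≤1 : δ ≤ 1#
      δ≤1 = ≤-offset (e ⁻¹ * y) (*-nonneg (proj₁ (⁻¹-positive 0<e)) (proj₁ 0<y)) (solve 1 (λ z → con (+ 1) := (con (+ 1) :- z) :+ z) refl _)
      s-δ<s : y < e → s - δ < s
      s-δ<s y<e = ≰⇒> λ h → <⇒≱ (0<δ y<e) (+-cancelˡ-≤ (s - δ) (begin
        (s - δ) + δ  ≈⟨ solve 2 (λ s d → (s :- d) :+ d := s) refl s δ ⟩
        s            ≤⟨ h ⟩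
        s - δ        ≈⟨ +-identityʳ _ ⟨
        (s - δ) + 0# ∎))
      s-δ-upper : y < e → ∀ x → 0# ≤ x × exp x ≤ y → x ≤ s - δ
      s-δ-upper y<e x (0≤x , ex≤y) = ≮⇒≤ λ s-δ<x → <⇒≱ (e<e[1+τ] (x<y⇒0<y-x s-δ<x)) (e[1+τ]≤e (x<y⇒0<y-x s-δ<x))
        where
        τ = x - (s - δ)
        0≤δ = proj₁ (0<δ y<e)
        e[1+τ]≤e : 0# < τ → e * (1# + τ) ≤ e
        e[1+τ]≤e 0<τ = begin
          e * (1# + τ)            ≤⟨ *-monoˡ-≤ (proj₁ 0<e) (1+x≤exp (proj₁ 0<τ)) ⟩
          e * exp τ               ≈⟨ exp-+ 0≤s (proj₁ 0<τ) ⟨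
          exp (s + τ)
            ≈⟨ exp-cong (+-nonneg 0≤s (proj₁ 0<τ)) (solve 3 (λ s x d → s :+ (x :- (s :- d)) := x :+ d) refl s x δ) ⟩
          exp (x + δ)             ≈⟨ exp-+ 0≤x 0≤δ ⟩
          exp x * exp δ           ≤⟨ *-monoʳ-≤ (exp-nonneg 0≤δ) ex≤y ⟩
          y * exp δ               ≈⟨ *-congʳ (x*[x⁻¹*y]≈y y 0<e) ⟨
          e * (e ⁻¹ * y) * exp δ  ≈⟨ *-assoc _ _ _ ⟩
          e * (e ⁻¹ * y * exp δ)
            ≈⟨ *-congˡ (*-congʳ (solve 1 (λ z → z := con (+ 1) :- (con (+ 1) :- z)) refl _)) ⟩
          e * ((1# - δ) * exp δ)  ≤⟨ *-monoˡ-≤ (proj₁ 0<e) ([1-x]*exp≤1 0≤δ δ≤1) ⟩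
          e * 1#                  ≈⟨ *-identityʳ e ⟩
          e                       ∎
        e<e[1+τ] : 0# < τ → e < e * (1# + τ)
        e<e[1+τ] 0<τ = ≰⇒> λ h → <⇒≱ 0<τ (+-cancelˡ-≤ 1# (*-cancelˡ-≤ 0<e (begin
          e * (1# + τ) ≤⟨ h ⟩
          e            ≈⟨ *-identityʳ e ⟨
          e * 1#       ≈⟨ *-congˡ (+-identityʳ 1#) ⟨
          e * (1# + 0#) ∎)))

  exp-log : ∀ {y} → 1# ≤ y → exp (log y) ≈ y
  exp-log {y} 1≤y = let x , _ , ex≈y = exp-surjective 1≤y in the-spec (λ x → exp x ≈ y) (x , ex≈y)

  1+½<2 : 1# + ½ < fromℕ 2
  1+½<2 = ≰⇒> λ h → <⇒≱ 0<½ (+-cancelˡ-≤ (1# + ½) (begin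
    1# + ½ + ½      ≈⟨ +-assoc _ _ _ ⟩
    1# + (½ + ½)    ≈⟨ +-congˡ ½+½≈1 ⟩
    1# + 1#         ≈⟨ +-congˡ fromℕ-1 ⟨
    fromℕ 2         ≤⟨ h ⟩
    1# + ½          ≈⟨ +-identityʳ _ ⟨
    1# + ½ + 0#     ∎))

  -- For 0 ≤ x ≤ 1 this is 2 ≤ exp x ≤ 1 / (1 - x); a negative x is impossible because 3/2 < 2.
  2≤exp⇒½≤ : ∀ {x} → fromℕ 2 ≤ exp x → ½ ≤ x
  2≤exp⇒½≤ {x} 2≤ex = cases (total x 0#) (total x 1#)
    where
    cases : x ≤ 0# ⊎ 0# ≤ x → x ≤ 1# ⊎ 1# ≤ x → ½ ≤ x
    cases (inj₁ x≤0) _          = contradiction (≤-trans 2≤ex (exp-neg-bound x≤0)) (<⇒≱ 1+½<2)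
    cases (inj₂ 0≤x) (inj₂ 1≤x) = ≤-trans ½≤1 1≤x
    cases (inj₂ 0≤x) (inj₁ x≤1) = *-cancelˡ-≤ 0<2 (begin
      fromℕ 2 * ½           ≈⟨ *-inverseʳ 0<2 ⟩
      1#
        ≈⟨ solve 1 (λ l → con (+ 1) := (numeral 2 :* l) :+ ((con (+ 1) :- l) :* numeral 2 :- con (+ 1))) refl x ⟩
      (fromℕ 2 * x) + ((1# - x) * fromℕ 2 - 1#) ≤⟨ +-monoʳ-≤ _ (+-monoˡ-≤ (- 1#) (≤-trans
        (*-monoˡ-≤ (x≤y⇒0≤y-x x≤1) 2≤ex) ([1-x]*exp≤1 0≤x x≤1))) ⟩
      (fromℕ 2 * x) + (1# - 1#) ≈⟨ solve 1 (λ z → z :+ (con (+ 1) :- con (+ 1)) := z) refl (fromℕ 2 * x) ⟩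
      fromℕ 2 * x           ∎)

  -- The root is obtained by halving a logarithm; arguments below 1 are inverted first.
  sqrt-exists-1≤ : ∀ {x} → 1# ≤ x → ∃ λ y → 0# < y × y * y ≈ x
  sqrt-exists-1≤ {x} 1≤x = exp (½ * l) , exp-positive 0≤½l , (begin-equality
    exp (½ * l) * exp (½ * l) ≈⟨ exp-+ 0≤½l 0≤½l ⟨
    exp (½ * l + ½ * l)
      ≈⟨ exp-cong (+-nonneg 0≤½l 0≤½l) (trans (sym (distribʳ l ½ ½)) (trans (*-congʳ ½+½≈1) (*-identityˡ l))) ⟩
    exp l                     ≈⟨ el≈x ⟩
    x                         ∎)
    where
    preimage = exp-surjective 1≤x
    l = proj₁ preimage
    el≈x = proj₂ (proj₂ preimage)
    0≤½l = *-nonneg (proj₁ 0<½) (proj₁ (proj₂ preimage))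

  sqrt-exists-≤1 : ∀ {x} → 0# < x → x ≤ 1# → ∃ λ y → 0# ≤ y × y * y ≈ x
  sqrt-exists-≤1 {x} 0<x x≤1 = y ⁻¹ , proj₁ (⁻¹-positive 0<y) , (begin-equality
    y ⁻¹ * y ⁻¹                         ≈⟨ *-identityˡ _ ⟨
    1# * (y ⁻¹ * y ⁻¹)                  ≈⟨ *-congʳ (*-inverseʳ 0<x) ⟨
    x * x ⁻¹ * (y ⁻¹ * y ⁻¹)            ≈⟨ *-congʳ (*-congˡ (proj₂ (proj₂ root))) ⟨
    x * (y * y) * (y ⁻¹ * y ⁻¹)
      ≈⟨ solve 3 (λ x y i → x :* (y :* y) :* (i :* i) := x :* ((y :* i) :* (y :* i))) refl x y (y ⁻¹) ⟩
    x * ((y * y ⁻¹) * (y * y ⁻¹))       ≈⟨ *-congˡ (*-cong (*-inverseʳ 0<y) (*-inverseʳ 0<y)) ⟩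
    x * (1# * 1#)                       ≈⟨ *-congˡ (*-identityˡ 1#) ⟩
    x * 1#                              ≈⟨ *-identityʳ x ⟩
    x                                   ∎)
    where
    1≤x⁻¹ : 1# ≤ x ⁻¹
    1≤x⁻¹ = *-cancelˡ-≤ 0<x (begin
      x * 1#    ≈⟨ *-identityʳ x ⟩
      x         ≤⟨ x≤1 ⟩
      1#        ≈⟨ *-inverseʳ 0<x ⟨
      x * x ⁻¹  ∎)
    root = sqrt-exists-1≤ 1≤x⁻¹
    y = proj₁ root
    0<y = proj₁ (proj₂ root)

  sqrt-exists : ∀ {x} → 0# ≤ x → ∃ λ y → 0# ≤ y × y * y ≈ x
  sqrt-exists {x} 0≤x with lem {0# ≈ x}
  ... | yes 0≈x = 0# , ≤-refl , trans (zeroˡ 0#) 0≈x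
  ... | no  0≉x with total 1# x
  ...   | inj₁ 1≤x = let y , 0<y , eq = sqrt-exists-1≤ 1≤x in y , proj₁ 0<y , eq
  ...   | inj₂ x≤1 = sqrt-exists-≤1 (0≤x , 0≉x) x≤1

  sqrt-spec : ∀ {x} → 0# ≤ x → 0# ≤ sqrt x × sqrt x * sqrt x ≈ x
  sqrt-spec {x} 0≤x = the-spec (λ y → 0# ≤ y × y * y ≈ x) (sqrt-exists 0≤x)

  -- Splitting sums, averaging and least witnesses

  sum-split : ∀ m {n} (f : Fin (m ℕ.+ n) → ℝ) →
              sum f ≈ sum (λ i → f (i ↑ˡ n)) + sum (λ i → f (m ↑ʳ i))
  sum-split zero    f = sym (+-identityˡ _)
  sum-split (suc m) f = trans (+-congˡ (sum-split m λ i → f (suc i))) (sym (+-assoc _ _ _))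

  average : ∀ n (f : Fin (suc n) → ℝ) B → sum f ≤ fromℕ (suc n) * B → ∃ λ i → f i ≤ B
  average n f B h with lem {f zero ≤ B}
  ... | yes p = zero , p
  average zero f B h | no ¬p = zero , (begin
    f zero      ≈⟨ +-identityʳ _ ⟨
    f zero + 0# ≤⟨ h ⟩
    fromℕ 1 * B ≈⟨ *-congʳ fromℕ-1 ⟩
    1# * B      ≈⟨ *-identityˡ B ⟩
    B           ∎)
  average (suc n) f B h | no ¬p with average n (λ i → f (suc i)) B (+-cancelˡ-≤ B (begin
    B + sum (λ i → f (suc i))      ≤⟨ +-monoˡ-≤ _ (proj₁ (≰⇒> ¬p)) ⟩
    f zero + sum (λ i → f (suc i)) ≤⟨ h ⟩
    (1# + fromℕ (suc n)) * B
      ≈⟨ solve 2 (λ n b → (con (+ 1) :+ n) :* b := b :+ n :* b) refl (fromℕ (suc n)) B ⟩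
    B + fromℕ (suc n) * B          ∎))
  ...   | i , fi≤B = suc i , fi≤B

  least : {P : ℕ → Set} → ∀ c → P c → ∃ λ m → P m × (∀ d → P d → m ℕ.≤ d)
  least zero    p0 = zero , p0 , λ _ _ → ℕ.z≤n
  least {P} (suc c) p with lem {P zero}
  ... | yes p0 = zero , p0 , λ _ _ → ℕ.z≤n
  ... | no ¬p0 with least {λ d → P (suc d)} c p
  ...   | m , pm , m-least = suc m , pm , λ where
    zero    p0 → contradiction p0 ¬p0
    (suc d) pd → ℕ.s≤s (m-least d pd)

  -- Atoms, the score and nets

  module Atoms
    (k N : ℕ) (u : Fin N → Vector ℝ k)
    (u-bound : ∀ a j → u a j * u a j ≤ fromℕ 4)
    (o : Fin N) (u-zero : ∀ j → u o j ≈ 0#)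
    (neg : Fin N → Fin N) (u-neg : ∀ a j → u (neg a) j ≈ - u a j)
    where

    K : ℝ
    K = fromℕ k

    -- The root mean square of the k coordinates is at most r. Both sides are squared, so that no
    -- root has to be taken.
    record Close (r : ℕ) (v : Vector ℝ k) : Set where
      constructor close
      field bound : sum (λ j → v j * v j) ≤ K * (fromℕ r * fromℕ r)

    Close-cong : ∀ {r v w} → (∀ j → v j ≈ w j) → Close r v → Close r w
    Close-cong v≈w (close h) = close (≤-trans (≤-reflexive (sum-cong λ j → sym (*-cong (v≈w j) (v≈w j)))) h)

    Close-mono : ∀ {r s v} → r ℕ.≤ s → Close r v → Close s v
    Close-mono {r} {s} r≤s (close h) = close (≤-trans h (*-monoˡ-≤ (fromℕ-nonneg k)
      (*-mono-≤ (fromℕ-nonneg r) (fromℕ-nonneg s) (fromℕ-mono r≤s) (fromℕ-mono r≤s))))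

    -- Weighted form of (v + w)² ≤ (1 + t / s) v² + (1 + s / t) w², with denominators cleared.
    Close-+ : ∀ {r s v w} → 1 ℕ.≤ r → 1 ℕ.≤ s → Close r v → Close s w → Close (r ℕ.+ s) (λ j → v j + w j)
    Close-+ {r} {s} {v} {w} 1≤r 1≤s (close hv) (close hw) = close (*-cancelˡ-≤ (*-positive 0<a 0<b) (begin
      a * b * sum (λ j → (v j + w j) * (v j + w j))
        ≈⟨ *-distribˡ-sum (a * b) (λ j → (v j + w j) * (v j + w j)) ⟩
      sum (λ j → a * b * ((v j + w j) * (v j + w j)))
        ≤⟨ sum-mono (λ j → pointwise (v j) (w j)) ⟩
      sum (λ j → (a + b) * b * (v j * v j) + (a + b) * a * (w j * w j))
        ≈⟨ ∑-distrib-+ (λ j → (a + b) * b * (v j * v j)) (λ j → (a + b) * a * (w j * w j)) ⟩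
      sum (λ j → (a + b) * b * (v j * v j)) + sum (λ j → (a + b) * a * (w j * w j))
        ≈⟨ +-cong (*-distribˡ-sum ((a + b) * b) (λ j → v j * v j)) (*-distribˡ-sum ((a + b) * a) (λ j → w j * w j)) ⟨
      (a + b) * b * sum (λ j → v j * v j) + (a + b) * a * sum (λ j → w j * w j)
        ≤⟨ +-mono-≤ (*-monoˡ-≤ (*-nonneg 0≤a+b (proj₁ 0<b)) hv) (*-monoˡ-≤ (*-nonneg 0≤a+b (proj₁ 0<a)) hw) ⟩
      (a + b) * b * (K * (a * a)) + (a + b) * a * (K * (b * b))
        ≈⟨ solve 3 (λ a b k → (a :+ b) :* b :* (k :* (a :* a)) :+ (a :+ b) :* a :* (k :* (b :* b))
                              := a :* b :* (k :* ((a :+ b) :* (a :+ b)))) refl a b K ⟩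
      a * b * (K * ((a + b) * (a + b)))
        ≈⟨ *-congˡ (*-congˡ (*-cong (fromℕ-+ r s) (fromℕ-+ r s))) ⟨
      a * b * (K * (fromℕ (r ℕ.+ s) * fromℕ (r ℕ.+ s))) ∎))
      where
      a = fromℕ r
      b = fromℕ s
      0<a : 0# < a
      0<a = fromℕ-positive 1≤r
      0<b : 0# < b
      0<b = fromℕ-positive 1≤s
      0≤a+b : 0# ≤ a + b
      0≤a+b = +-nonneg (proj₁ 0<a) (proj₁ 0<b)
      pointwise : ∀ x y → a * b * ((x + y) * (x + y)) ≤ (a + b) * b * (x * x) + (a + b) * a * (y * y)
      pointwise x y = ≤-offset ((b * x - a * y) * (b * x - a * y)) (square-nonneg _)
        (solve 4 (λ a b x y → (a :+ b) :* b :* (x :* x) :+ (a :+ b) :* a :* (y :* y) :=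
          a :* b :* ((x :+ y) :* (x :+ y)) :+ (b :* x :- a :* y) :* (b :* x :- a :* y)) refl a b x y)

    atomSum : ∀ {c} → (Fin c → Fin N) → Vector ℝ k
    atomSum l j = sum λ t → u (l t) j

    Close-atom : ∀ a → Close 2 (u a)
    Close-atom a = close (begin
      sum (λ j → u a j * u a j)    ≤⟨ sum-mono (u-bound a) ⟩
      sum {k} (λ _ → fromℕ 4)      ≈⟨ sum-const k (fromℕ 4) ⟩
      K * fromℕ 4                  ≈⟨ *-congˡ (fromℕ-* 2 2) ⟩
      K * (fromℕ 2 * fromℕ 2)      ∎)

    record Reach (r c : ℕ) (v : Vector ℝ k) : Set where
      constructor _,_
      field
        atoms : Fin c → Fin N
        near  : Close r (λ j → v j - atomSum atoms j)

    Reach-cong : ∀ {r c v w} → (∀ j → v j ≈ w j) → Reach r c v → Reach r c w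
    Reach-cong v≈w (l , h) = l , Close-cong (λ j → +-congʳ (v≈w j)) h

    Reach-monoʳ : ∀ {r s c v} → r ℕ.≤ s → Reach r c v → Reach s c v
    Reach-monoʳ {v = v} r≤s (l , h) = l , Close-mono {v = λ j → v j - atomSum l j} r≤s h

    Reach-cons : ∀ {r c v} a → Reach r c v → Reach r (suc c) (λ j → v j + u a j)
    Reach-cons {v = v} a (l , h) = a ∷ l , Close-cong (λ j →
      solve 3 (λ v a s → v :- s := (v :+ a) :- (a :+ s)) refl (v j) (u a j) (atomSum l j)) h

    Reach-+ : ∀ {r c v} d (l : Fin d → Fin N) → Reach r c v → Reach r (d ℕ.+ c) (λ j → v j + atomSum l j)
    Reach-+ zero    l h = Reach-cong (λ j → sym (+-identityʳ _)) h
    Reach-+ {r} {c} {v} (suc d) l h = Reach-cong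
      (λ j → solve 3 (λ v a s → (v :+ s) :+ a := v :+ (a :+ s)) refl (v j) (u (l zero) j) (atomSum (λ i → l (suc i)) j))
      (Reach-cons (l zero) (Reach-+ d (λ i → l (suc i)) h))

    Reach-mono : ∀ {r c d v} → c ℕ.≤ d → Reach r c v → Reach r d v
    Reach-mono {r} {c} {d} {v} c≤d h = ≡.subst (λ e → Reach r e v) (ℕₚ.m∸n+n≡m c≤d)
      (Reach-cong (λ j → trans (+-congˡ (zeros j)) (+-identityʳ _)) (Reach-+ (d ℕ.∸ c) (λ _ → o) h))
      where
      zeros : ∀ j → atomSum {d ℕ.∸ c} (λ _ → o) j ≈ 0#
      zeros j = begin-equality
        sum {d ℕ.∸ c} (λ _ → u o j)     ≈⟨ sum-const (d ℕ.∸ c) (u o j) ⟩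
        fromℕ (d ℕ.∸ c) * u o j         ≈⟨ *-congˡ (u-zero j) ⟩
        fromℕ (d ℕ.∸ c) * 0#            ≈⟨ zeroʳ _ ⟩
        0#                              ∎

    -- Turns the final score into an error: the coordinates of an atom are at most 2 in absolute
    -- value, so each atom adds 2 to the tolerance.
    Reach⇒Close : ∀ {r} c {v} → 1 ℕ.≤ r → Reach r c v → Close (r ℕ.+ 2 ℕ.* c) v
    Reach⇒Close {r} zero {v} 1≤r (l , h) = ≡.subst (λ s → Close s v) (≡.sym (ℕₚ.+-identityʳ r))
      (Close-cong (λ j → solve 1 (λ v → v :- con (+ 0) := v) refl (v j)) h)
    Reach⇒Close {r} (suc c) {v} 1≤r (l , h) = ≡.subst (λ s → Close s v) r+2c+2≡
      (Close-cong (λ j → solve 2 (λ v a → (v :- a) :+ a := v) refl (v j) (u (l zero) j))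
        (Close-+ {v = λ j → v j - u (l zero) j} {w = u (l zero)} (ℕₚ.≤-trans 1≤r (ℕₚ.m≤m+n r _)) (ℕ.s≤s ℕ.z≤n)
          (Reach⇒Close c 1≤r ((λ i → l (suc i)) , Close-cong (λ j →
            solve 3 (λ v a s → v :- (a :+ s) := (v :- a) :- s) refl (v j) (u (l zero) j) (atomSum (λ i → l (suc i)) j)) h))
          (Close-atom (l zero))))
      where
      r+2c+2≡ : r ℕ.+ 2 ℕ.* c ℕ.+ 2 ≡ r ℕ.+ 2 ℕ.* suc c
      r+2c+2≡ = ≡.trans (ℕₚ.+-assoc r (2 ℕ.* c) 2) (≡.cong (r ℕ.+_)
        (≡.trans (ℕₚ.+-comm (2 ℕ.* c) 2) (≡.sym (ℕₚ.*-suc 2 c))))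

    -- Junk value: the score is 0 if no sum of atoms is close to v.
    abstract

      score : ℕ → Vector ℝ k → ℕ
      score r v with lem {∃ λ c → Reach r c v}
      ... | yes (c , h) = proj₁ (least {λ c → Reach r c v} c h)
      ... | no  _       = 0

      score-Reach : ∀ {r c v} → Reach r c v → Reach r (score r v) v
      score-Reach {r} {c} {v} h with lem {∃ λ c → Reach r c v}
      ... | yes (c , h) = proj₁ (proj₂ (least {λ c → Reach r c v} c h))
      ... | no  ¬p      = contradiction (c , h) ¬p

      score-≤ : ∀ {r c v} → Reach r c v → score r v ℕ.≤ c
      score-≤ {r} {c} {v} h with lem {∃ λ c → Reach r c v}
      ... | yes (c′ , h′) = proj₂ (proj₂ (least {λ c → Reach r c v} c′ h′)) c h
      ... | no  _         = ℕ.z≤n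

      score-unreachable : ∀ {r v} → ¬ (∃ λ c → Reach r c v) → score r v ≡ 0
      score-unreachable {r} {v} ¬p with lem {∃ λ c → Reach r c v}
      ... | yes p = contradiction p ¬p
      ... | no  _ = ≡.refl

    -- Adding d atoms to a best approximation of v gives one of w. The reverse shift settles the
    -- default value: if no sum of atoms is close to v, none is close to w, and both scores are 0.
    score-sensitivity : ∀ {r v w} d (l l⁻ : Fin d → Fin N) →
      (∀ j → w j ≈ v j + atomSum l j) → (∀ j → v j ≈ w j + atomSum l⁻ j) →
      score r w ℕ.≤ d ℕ.+ score r v
    score-sensitivity {r} {v} {w} d l l⁻ w≈ v≈ = cases (lem {∃ λ c → Reach r c v})
      where
      cases : Dec (∃ λ c → Reach r c v) → score r w ℕ.≤ d ℕ.+ score r v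
      cases (yes (c , h)) = score-≤ (Reach-cong (λ j → sym (w≈ j)) (Reach-+ d l (score-Reach h)))
      cases (no ¬p) = ≡.subst (ℕ._≤ d ℕ.+ score r v) (≡.sym (score-unreachable λ (c , h) →
        ¬p (d ℕ.+ c , Reach-cong (λ j → sym (v≈ j)) (Reach-+ d l⁻ h)))) ℕ.z≤n

    -- Maurey's lemma, derandomised: each new atom is chosen, among those of l, to be no
    -- worse than the average.  Everything is scaled by n = suc c to avoid division.
    module Maurey {c : ℕ} (l : Fin (suc c) → Fin N) where

      n : ℝ
      n = fromℕ (suc c)

      A : Vector ℝ k
      A = atomSum l

      B : ℝ
      B = fromℕ 4 * (K * (n * n))

      deviation : ∀ {i} → (Fin i → Fin N) → Vector ℝ k
      deviation {i} p j = fromℕ i * A j - n * atomSum p j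

      -- The values `u (l t) j` have mean `A j / n`, so the cross terms with s cancel on average.
      -- What remains beside s² is n² times their variance, which is at most 4 n²; the inequality
      -- drops the square of the mean.
      average-square : ∀ s j →
        sum (λ t → (s + (A j - n * u (l t) j)) * (s + (A j - n * u (l t) j))) ≤ n * (s * s + fromℕ 4 * (n * n))
      average-square s j = begin
        sum (λ t → (s + (A j - n * x t)) * (s + (A j - n * x t)))
          ≈⟨ sum-cong (λ t → solve 4 (λ s a n x → (s :+ (a :- n :* x)) :* (s :+ (a :- n :* x)) :=
               ((s :+ a) :* (s :+ a) :+ (:- numeral 2 :* n :* (s :+ a)) :* x) :+ n :* n :* (x :* x)) refl s (A j) n (x t)) ⟩
        sum (λ t → (c₀ + c₁ * x t) + n * n * (x t * x t))
          ≈⟨ ∑-distrib-+ (λ t → c₀ + c₁ * x t) (λ t → n * n * (x t * x t)) ⟩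
        sum (λ t → c₀ + c₁ * x t) + sum (λ t → n * n * (x t * x t))
          ≈⟨ +-cong (trans (∑-distrib-+ (λ _ → c₀) (λ t → c₁ * x t))
               (+-cong (sum-const (suc c) c₀) (sym (*-distribˡ-sum c₁ x)))) (sym (*-distribˡ-sum (n * n) (λ t → x t * x t))) ⟩
        (n * c₀ + c₁ * A j) + n * n * sum (λ t → x t * x t)
          ≤⟨ +-monoʳ-≤ _ (*-monoˡ-≤ (square-nonneg n) (≤-trans (sum-mono λ t → u-bound (l t) j)
               (≤-reflexive (sum-const (suc c) (fromℕ 4))))) ⟩
        (n * c₀ + c₁ * A j) + n * n * (n * fromℕ 4)
          ≤⟨ ≤-offset (n * (A j * A j)) (*-nonneg (fromℕ-nonneg (suc c)) (square-nonneg (A j)))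
               (solve 4 (λ s a n f → n :* (s :* s :+ f :* (n :* n)) :=
                 ((n :* ((s :+ a) :* (s :+ a)) :+ (:- numeral 2 :* n :* (s :+ a)) :* a) :+ n :* n :* (n :* f)) :+ n :* (a :* a))
                 refl s (A j) n (fromℕ 4)) ⟩
        n * (s * s + fromℕ 4 * (n * n)) ∎
        where
        x : Fin (suc c) → ℝ
        x t = u (l t) j
        c₀ = (s + A j) * (s + A j)
        c₁ = - fromℕ 2 * n * (s + A j)

      greedy : ∀ i → ∃ λ (p : Fin i → Fin N) → sum (λ j → deviation p j * deviation p j) ≤ fromℕ i * B
      greedy zero = (λ ()) , (begin
        sum (λ j → deviation {zero} (λ ()) j * deviation {zero} (λ ()) j)
                             ≈⟨ sum-cong (λ j → solve 2 (λ a n → (con (+ 0) :* a :- n :* con (+ 0)) :* (con (+ 0) :* a :- n :* con (+ 0)) := con (+ 0)) refl (A j) n) ⟩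
        sum {k} (λ _ → 0#)   ≈⟨ sum-const k 0# ⟩
        K * 0#               ≈⟨ zeroʳ K ⟩
        0#                   ≈⟨ zeroˡ B ⟨
        0# * B               ∎)
      greedy (suc i) = (l t ∷ p) , (begin
        sum (λ j → deviation (l t ∷ p) j * deviation (l t ∷ p) j)
                    ≈⟨ sum-cong (λ j → *-cong (split j) (split j)) ⟩
        f t         ≤⟨ proj₂ chosen ⟩
        fromℕ (suc i) * B ∎)
        where
        p = proj₁ (greedy i)
        s : Vector ℝ k
        s = deviation p
        g : Fin (suc c) → Fin k → ℝ
        g t j = (s j + (A j - n * u (l t) j)) * (s j + (A j - n * u (l t) j))
        f : Fin (suc c) → ℝ
        f t = sum (g t)
        chosen : ∃ λ t → f t ≤ fromℕ (suc i) * B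
        chosen = average c f (fromℕ (suc i) * B) (begin
          sum f                                            ≈⟨ ∑-comm g ⟩
          sum (λ j → sum (λ t → g t j))                    ≤⟨ sum-mono (λ j → average-square (s j) j) ⟩
          sum (λ j → n * (s j * s j + fromℕ 4 * (n * n)))
            ≈⟨ *-distribˡ-sum n (λ j → s j * s j + fromℕ 4 * (n * n)) ⟨
          n * sum (λ j → s j * s j + fromℕ 4 * (n * n))
            ≈⟨ *-congˡ (∑-distrib-+ (λ j → s j * s j) (λ _ → fromℕ 4 * (n * n))) ⟩
          n * (sum (λ j → s j * s j) + sum {k} (λ _ → fromℕ 4 * (n * n)))
            ≤⟨ *-monoˡ-≤ (fromℕ-nonneg (suc c)) (+-mono-≤ (proj₂ (greedy i)) (≤-reflexive (sum-const k _))) ⟩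
          n * (fromℕ i * B + K * (fromℕ 4 * (n * n)))      ≈⟨ *-congˡ (solve 4 (λ i f k n →
            i :* (f :* (k :* n)) :+ k :* (f :* n) := (con (+ 1) :+ i) :* (f :* (k :* n))) refl (fromℕ i) (fromℕ 4) K (n * n)) ⟩
          n * (fromℕ (suc i) * B)                          ∎)
        t = proj₁ chosen
        split : ∀ j → deviation (l t ∷ p) j ≈ s j + (A j - n * u (l t) j)
        split j = solve 5 (λ i a n x y → (con (+ 1) :+ i) :* a :- n :* (x :+ y) := (i :* a :- n :* y) :+ (a :- n :* x))
          refl (fromℕ i) (A j) n (u (l t) j) (atomSum p j)

    netPoint : ∀ {m} → ℕ → (Fin m → Fin N) → Vector ℝ k
    netPoint h p j = fromℕ h * atomSum p j

    -- The list has n = h · m atoms with m = g², and `deviation p` is m times the difference. Hence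
    -- the mean square error is at most 4 n² / m = (2 h g)²; taking m to be a square keeps this
    -- radius an integer.
    maurey : ∀ h g → 1 ℕ.≤ h → 1 ℕ.≤ g → (l : Fin (h ℕ.* (g ℕ.* g)) → Fin N) →
             ∃ λ (p : Fin (g ℕ.* g) → Fin N) → Close (2 ℕ.* (h ℕ.* g)) (λ j → atomSum l j - netPoint h p j)
    maurey h@(suc _) g@(suc _) _ _ l = p , close (*-cancelˡ-≤ 0<mm (begin
      m * m * sum (λ j → d j * d j)       ≈⟨ *-distribˡ-sum (m * m) (λ j → d j * d j) ⟩
      sum (λ j → m * m * (d j * d j))
        ≈⟨ sum-cong (λ j → trans (solve 2 (λ m d → m :* m :* (d :* d) := (m :* d) :* (m :* d)) refl m (d j))
                                               (*-cong (sym (dev j)) (sym (dev j)))) ⟩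
      sum (λ j → deviation p j * deviation p j) ≤⟨ proj₂ (greedy (g ℕ.* g)) ⟩
      m * (fromℕ 4 * (K * (n * n)))       ≈⟨ *-congˡ (*-cong (fromℕ-* 2 2) (*-congˡ (*-cong n≈ n≈))) ⟩
      m * (fromℕ 2 * fromℕ 2 * (K * (H * m * (H * m))))
        ≈⟨ *-congˡ (*-congˡ (*-congˡ (*-cong (*-congˡ (fromℕ-* g g)) refl))) ⟩
      m * (fromℕ 2 * fromℕ 2 * (K * (H * (G * G) * (H * m)))) ≈⟨ solve 5 (λ m t k h g →
        m :* (t :* t :* (k :* (h :* (g :* g) :* (h :* m)))) := m :* m :* (k :* ((t :* (h :* g)) :* (t :* (h :* g))))) refl m (fromℕ 2) K H G ⟩
      m * m * (K * ((fromℕ 2 * (H * G)) * (fromℕ 2 * (H * G)))) ≈⟨ *-congˡ (*-congˡ (*-cong r≈ r≈)) ⟨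
      m * m * (K * (fromℕ (2 ℕ.* (h ℕ.* g)) * fromℕ (2 ℕ.* (h ℕ.* g)))) ∎))
      where
      open Maurey l
      H = fromℕ h
      G = fromℕ g
      m = fromℕ (g ℕ.* g)
      p = proj₁ (greedy (g ℕ.* g))
      d : Vector ℝ k
      d j = atomSum l j - netPoint h p j
      0<m : 0# < m
      0<m = fromℕ-positive {g ℕ.* g} (ℕ.s≤s ℕ.z≤n)
      0<mm : 0# < m * m
      0<mm = *-positive 0<m 0<m
      n≈ : n ≈ H * m
      n≈ = fromℕ-* h (g ℕ.* g)
      r≈ : fromℕ (2 ℕ.* (h ℕ.* g)) ≈ fromℕ 2 * (H * G)
      r≈ = trans (fromℕ-* 2 (h ℕ.* g)) (*-congˡ (fromℕ-* h g))
      dev : ∀ j → deviation p j ≈ m * d j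
      dev j = trans (+-congˡ (-‿cong (*-congʳ n≈)))
        (solve 4 (λ m a h y → m :* a :- h :* m :* y := m :* (a :- h :* y)) refl m (A j) H (atomSum p j))

    -- A net point is a sum of atoms too, with each atom of p taken h times.
    net-Reach⁺ : ∀ {r c v m} h (p : Fin m → Fin N) → Reach r c v →
                 Reach r (h ℕ.* m ℕ.+ c) (λ j → v j + netPoint h p j)
    net-Reach⁺ {c = c} {v} zero p q = Reach-cong (λ j →
      solve 2 (λ v s → v := v :+ con (+ 0) :* s) refl (v j) (atomSum p j)) q
    net-Reach⁺ {r} {c} {v} {m} (suc h) p q = ≡.subst (λ d → Reach r d (λ j → v j + netPoint (suc h) p j))
      (≡.sym (ℕₚ.+-assoc m (h ℕ.* m) c))
      (Reach-cong (λ j → solve 3 (λ v h s → (v :+ h :* s) :+ s := v :+ (con (+ 1) :+ h) :* s) refl (v j) (fromℕ h) (atomSum p j))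
        (Reach-+ m p (net-Reach⁺ h p q)))

    -- Subtracting a net point amounts to adding negated atoms. So the residual after any choice,
    -- even a bad one, has a genuine score.
    net-Reach⁻ : ∀ {r c v m} h (p : Fin m → Fin N) → Reach r c v →
                 Reach r (h ℕ.* m ℕ.+ c) (λ j → v j - netPoint h p j)
    net-Reach⁻ {v = v} h p q = Reach-cong
      (λ j → trans (+-congˡ (*-congˡ (negated j)))
        (solve 3 (λ v h s → v :+ h :* :- s := v :- h :* s) refl (v j) (fromℕ h) (atomSum p j)))
      (net-Reach⁺ h (λ i → neg (p i)) q)
      where
      negated : ∀ j → atomSum (λ i → neg (p i)) j ≈ - atomSum p j
      negated j = begin-equality
        sum (λ i → u (neg (p i)) j)        ≈⟨ sum-cong (λ i → trans (u-neg (p i) j)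
                                               (solve 1 (λ x → :- x := (:- con (+ 1)) :* x) refl (u (p i) j))) ⟩
        sum (λ i → - 1# * u (p i) j)       ≈⟨ *-distribˡ-sum (- 1#) (λ i → u (p i) j) ⟨
        - 1# * atomSum p j                 ≈⟨ solve 1 (λ x → (:- con (+ 1)) :* x := :- x) refl (atomSum p j) ⟩
        - atomSum p j                      ∎

    -- The list of s atoms, padded with zeros if it is too short, is cut after the first h g². That
    -- piece is replaced by a net point at the price of the mesh, and only the other piece remains
    -- to be searched.
    net-step : ∀ {r s v} h g → 1 ℕ.≤ r → 1 ℕ.≤ h → 1 ℕ.≤ g → Reach r s v →
      ∃ λ (p : Fin (g ℕ.* g) → Fin N) →
        Reach (r ℕ.+ 2 ℕ.* (h ℕ.* g)) (s ℕ.∸ h ℕ.* (g ℕ.* g)) (λ j → v j - netPoint h p j)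
    net-step {r} {s} {v} h g 1≤r 1≤h 1≤g q =
      let R = h ℕ.* (g ℕ.* g)
          e = s ℕ.∸ R
          l , near = Reach-mono {d = R ℕ.+ e} (ℕₚ.m≤n+m∸n s R) q
          l₁ : Fin R → Fin N
          l₁ i = l (i ↑ˡ e)
          l₂ : Fin e → Fin N
          l₂ i = l (R ↑ʳ i)
          p , near′ = maurey h g 1≤h 1≤g l₁
      in p , l₂ , Close-cong
        (λ j → trans (+-congʳ (+-congˡ (-‿cong (sum-split R λ i → u (l i) j))))
          (solve 4 (λ v a b y → (v :- (a :+ b)) :+ (a :- y) := (v :- y) :- b) refl (v j) (atomSum l₁ j) (atomSum l₂ j) (netPoint h p j)))
        (Close-+ {v = λ j → v j - atomSum l j} {w = λ j → atomSum l₁ j - netPoint h p j}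
          1≤r (ℕₚ.*-mono-≤ {1} {2} (ℕ.s≤s ℕ.z≤n) (ℕₚ.*-mono-≤ 1≤h 1≤g)) near near′)

  -- The exponential mechanism for integer scores

  sum-combine : ∀ m {n} (f : Fin (m ℕ.* n) → ℝ) → sum f ≈ sum {m} (λ i → sum {n} (λ j → f (combine i j)))
  sum-combine zero        f = refl
  sum-combine (suc m) {n} f = trans (sum-split n f) (+-congˡ (sum-combine m λ i → f (n ↑ʳ i)))

  sum-*-const : ∀ {n} (f : Fin n → ℝ) x → sum (λ i → f i * x) ≈ sum f * x
  sum-*-const f x = sym (*-distribʳ-sum x f)

  -- With integer scores the weights are natural powers of `c`, so `exp` is evaluated only at
  -- nonnegative arguments.
  module ExponentialMechanism (B : ℝ) (1≤B : 1# ≤ B) where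

    0<B : 0# < B
    0<B = 0<-trans-≤ 0<1 1≤B

    c : ℝ
    c = B ⁻¹

    0<c : 0# < c
    0<c = ⁻¹-positive 0<B

    0≤c^ : ∀ n → 0# ≤ c ^ n
    0≤c^ n = ^-nonneg n (proj₁ 0<c)

    0≤B^ : ∀ n → 0# ≤ B ^ n
    0≤B^ n = ^-nonneg n (proj₁ 0<B)

    c≤1 : c ≤ 1#
    c≤1 = *-cancelˡ-≤ 0<B (≤-trans (≤-reflexive (*-inverseʳ 0<B)) (≤-trans 1≤B (≤-reflexive (sym (*-identityʳ B)))))

    B^n*c^n≈1 : ∀ n → B ^ n * c ^ n ≈ 1#
    B^n*c^n≈1 zero    = *-identityˡ 1#
    B^n*c^n≈1 (suc n) = begin-equality
      B * B ^ n * (c * c ^ n)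
        ≈⟨ solve 4 (λ b p c q → b :* p :* (c :* q) := (b :* c) :* (p :* q)) refl B (B ^ n) c (c ^ n) ⟩
      (B * c) * (B ^ n * c ^ n)  ≈⟨ *-cong (*-inverseʳ 0<B) (B^n*c^n≈1 n) ⟩
      1# * 1#                    ≈⟨ *-identityˡ 1# ⟩
      1#                         ∎

    c^-antitone : ∀ {m n} → m ℕ.≤ n → c ^ n ≤ c ^ m
    c^-antitone {n = n} ℕ.z≤n = c^≤1 n
      where
      c^≤1 : ∀ n → c ^ n ≤ 1#
      c^≤1 zero    = ≤-refl
      c^≤1 (suc n) = ≤-trans (*-mono-≤ (proj₁ 0<c) 0≤1 c≤1 (c^≤1 n)) (≤-reflexive (*-identityˡ 1#))
    c^-antitone (ℕ.s≤s m≤n) = *-monoˡ-≤ (proj₁ 0<c) (c^-antitone m≤n)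

    c^-shift : ∀ d {m n} → m ℕ.≤ d ℕ.+ n → c ^ n ≤ B ^ d * c ^ m
    c^-shift d {m} {n} m≤d+n = begin
      c ^ n                   ≈⟨ *-identityˡ _ ⟨
      1# * c ^ n              ≈⟨ *-congʳ (B^n*c^n≈1 d) ⟨
      B ^ d * c ^ d * c ^ n   ≈⟨ *-assoc _ _ _ ⟩
      B ^ d * (c ^ d * c ^ n) ≈⟨ *-congˡ (^-homo-* c d n) ⟨
      B ^ d * c ^ (d ℕ.+ n)   ≤⟨ *-monoˡ-≤ (0≤B^ d) (c^-antitone m≤d+n) ⟩
      B ^ d * c ^ m           ∎

    module _ {M : ℕ} (y₀ : Fin M) where

      partition : (Fin M → ℕ) → ℝ
      partition s = sum λ y → c ^ s y

      c^≤partition : ∀ s y → c ^ s y ≤ partition s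
      c^≤partition s = term≤sum (λ y → 0≤c^ (s y))

      0<partition : ∀ s → 0# < partition s
      0<partition s = 0<-trans-≤ (^-positive (s y₀) 0<c) (c^≤partition s y₀)

      probability : (Fin M → ℕ) → Fin M → ℝ
      probability s y = c ^ s y * partition s ⁻¹

      0≤partition⁻¹ : ∀ s → 0# ≤ partition s ⁻¹
      0≤partition⁻¹ s = proj₁ (⁻¹-positive (0<partition s))

      probability-nonneg : ∀ s y → 0# ≤ probability s y
      probability-nonneg s y = *-nonneg (0≤c^ (s y)) (0≤partition⁻¹ s)

      probability-total : ∀ s → sum (probability s) ≈ 1#
      probability-total s = trans (sum-*-const (λ y → c ^ s y) (partition s ⁻¹)) (*-inverseʳ (0<partition s))

      -- One factor `B ^ d` comes from the weight of y, the other from the partition function.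
      probability-ratio : ∀ d {s s′} → (∀ y → s y ℕ.≤ d ℕ.+ s′ y) → (∀ y → s′ y ℕ.≤ d ℕ.+ s y) →
                          ∀ y → probability s y ≤ B ^ d * B ^ d * probability s′ y
      probability-ratio d {s} {s′} s≤ s′≤ y = *-cancelˡ-≤ (0<partition s) (begin
        Z * (c ^ s y * Z ⁻¹)
          ≈⟨ solve 3 (λ z p i → z :* (p :* i) := p :* (z :* i)) refl Z (c ^ s y) (Z ⁻¹) ⟩
        c ^ s y * (Z * Z ⁻¹)
          ≈⟨ *-congˡ (trans (*-inverseʳ (0<partition s)) (sym (*-inverseʳ (0<partition s′)))) ⟩
        c ^ s y * (Z′ * Z′ ⁻¹)
          ≤⟨ *-mono-≤ (0≤c^ (s y)) (*-nonneg (*-nonneg (0≤B^ d) (proj₁ (0<partition s))) (0≤partition⁻¹ s′))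
                                               (c^-shift d (s′≤ y)) (*-monoʳ-≤ (0≤partition⁻¹ s′) Z′≤) ⟩
        B ^ d * c ^ s′ y * (B ^ d * Z * Z′ ⁻¹)
          ≈⟨ solve 4 (λ b p z i → b :* p :* (b :* z :* i) := z :* (b :* b :* (p :* i))) refl (B ^ d) (c ^ s′ y) Z (Z′ ⁻¹) ⟩
        Z * (B ^ d * B ^ d * (c ^ s′ y * Z′ ⁻¹)) ∎)
        where
        Z = partition s
        Z′ = partition s′
        Z′≤ : Z′ ≤ B ^ d * Z
        Z′≤ = ≤-trans (sum-mono λ y → c^-shift d (s≤ y)) (≤-reflexive (sym (*-distribˡ-sum (B ^ d) (λ y → c ^ s y))))

      -- A score r + μ + t, where μ is attained at y⋆, has weight at most c ^ μ * c ^ r * c ^ t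
      -- while the partition function is at least c ^ μ.
      probability-excess : ∀ {r κ} s (y⋆ : Fin M) → fromℕ M ≤ B ^ r → (∀ t → fromℕ t ≤ fromℕ κ * B ^ t) →
                           sum (λ y → probability s y * fromℕ (s y ℕ.∸ r)) ≤ fromℕ (s y⋆ ℕ.+ κ)
      probability-excess {r} {κ} s y⋆ M≤ t≤ = begin
        sum (λ y → c ^ s y * Z ⁻¹ * fromℕ (s y ℕ.∸ r))
          ≈⟨ sum-cong (λ y → solve 3 (λ p i e → p :* i :* e := p :* e :* i) refl (c ^ s y) (Z ⁻¹) (fromℕ (s y ℕ.∸ r))) ⟩
        sum (λ y → c ^ s y * fromℕ (s y ℕ.∸ r) * Z ⁻¹)
          ≈⟨ sum-*-const (λ y → c ^ s y * fromℕ (s y ℕ.∸ r)) (Z ⁻¹) ⟩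
        sum (λ y → c ^ s y * fromℕ (s y ℕ.∸ r)) * Z ⁻¹   ≤⟨ *-monoʳ-≤ (0≤partition⁻¹ s) total≤ ⟩
        (fromℕ μ + fromℕ κ) * Z * Z ⁻¹                   ≈⟨ *-assoc _ _ _ ⟩
        (fromℕ μ + fromℕ κ) * (Z * Z ⁻¹)                 ≈⟨ *-congˡ (*-inverseʳ (0<partition s)) ⟩
        (fromℕ μ + fromℕ κ) * 1#                         ≈⟨ *-identityʳ _ ⟩
        fromℕ μ + fromℕ κ                                ≈⟨ fromℕ-+ μ κ ⟨
        fromℕ (μ ℕ.+ κ)                                  ∎
        where
        μ = s y⋆
        Z = partition s
        rest : ℝ
        rest = c ^ μ * (c ^ r * fromℕ κ)
        0≤rest : 0# ≤ rest
        0≤rest = *-nonneg (0≤c^ μ) (*-nonneg (0≤c^ r) (fromℕ-nonneg κ))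
        c^t*t≤κ : ∀ t → c ^ t * fromℕ t ≤ fromℕ κ
        c^t*t≤κ t = begin
          c ^ t * fromℕ t              ≤⟨ *-monoˡ-≤ (0≤c^ t) (t≤ t) ⟩
          c ^ t * (fromℕ κ * B ^ t)
            ≈⟨ solve 3 (λ p k b → p :* (k :* b) := b :* p :* k) refl (c ^ t) (fromℕ κ) (B ^ t) ⟩
          B ^ t * c ^ t * fromℕ κ      ≈⟨ *-congʳ (B^n*c^n≈1 t) ⟩
          1# * fromℕ κ                 ≈⟨ *-identityˡ _ ⟩
          fromℕ κ                      ∎
        pointwise : ∀ n → c ^ n * fromℕ (n ℕ.∸ r) ≤ c ^ n * fromℕ μ + rest
        pointwise n with ℕₚ.≤-<-connex (n ℕ.∸ r) μ
        ... | inj₁ n-r≤μ = ≤-trans (*-monoˡ-≤ (0≤c^ n) (fromℕ-mono n-r≤μ)) (≤-offset rest 0≤rest refl)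
        ... | inj₂ μ<n-r = begin
          c ^ n * fromℕ (n ℕ.∸ r)                       ≡⟨ ≡.cong (λ e → c ^ n * fromℕ e) n-r≡ ⟩
          c ^ n * fromℕ (μ ℕ.+ t)                       ≈⟨ *-congˡ (fromℕ-+ μ t) ⟩
          c ^ n * (fromℕ μ + fromℕ t)                   ≈⟨ distribˡ _ _ _ ⟩
          c ^ n * fromℕ μ + c ^ n * fromℕ t
            ≤⟨ +-monoʳ-≤ _ (*-monoʳ-≤ (fromℕ-nonneg t) (c^-antitone r+μ+t≤n)) ⟩
          c ^ n * fromℕ μ + c ^ (r ℕ.+ (μ ℕ.+ t)) * fromℕ t
            ≈⟨ +-congˡ (*-congʳ (trans (^-homo-* c r (μ ℕ.+ t)) (*-congˡ (^-homo-* c μ t)))) ⟩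
          c ^ n * fromℕ μ + c ^ r * (c ^ μ * c ^ t) * fromℕ t
            ≈⟨ +-congˡ (solve 4 (λ r m p t → r :* (m :* p) :* t := m :* (r :* (p :* t))) refl (c ^ r) (c ^ μ) (c ^ t) (fromℕ t)) ⟩
          c ^ n * fromℕ μ + c ^ μ * (c ^ r * (c ^ t * fromℕ t))
            ≤⟨ +-monoʳ-≤ _ (*-monoˡ-≤ (0≤c^ μ) (*-monoˡ-≤ (0≤c^ r) (c^t*t≤κ t))) ⟩
          c ^ n * fromℕ μ + rest                        ∎
          where
          t = n ℕ.∸ r ℕ.∸ μ
          n-r≡ : n ℕ.∸ r ≡ μ ℕ.+ t
          n-r≡ = ≡.sym (ℕₚ.m+[n∸m]≡n (ℕₚ.<⇒≤ μ<n-r))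
          r≤n : r ℕ.≤ n
          r≤n with ℕₚ.≤-total r n
          ... | inj₁ r≤n = r≤n
          ... | inj₂ n≤r = contradiction (≡.subst (μ ℕ.<_) (ℕₚ.m≤n⇒m∸n≡0 n≤r) μ<n-r) ℕₚ.n≮0
          r+μ+t≤n : r ℕ.+ (μ ℕ.+ t) ℕ.≤ n
          r+μ+t≤n = ℕₚ.≤-reflexive (≡.trans (≡.cong (r ℕ.+_) (≡.sym n-r≡)) (ℕₚ.m+[n∸m]≡n r≤n))
        total≤ : sum (λ y → c ^ s y * fromℕ (s y ℕ.∸ r)) ≤ (fromℕ μ + fromℕ κ) * Z
        total≤ = begin
          sum (λ y → c ^ s y * fromℕ (s y ℕ.∸ r))     ≤⟨ sum-mono (λ y → pointwise (s y)) ⟩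
          sum (λ y → c ^ s y * fromℕ μ + rest)        ≈⟨ ∑-distrib-+ (λ y → c ^ s y * fromℕ μ) (λ _ → rest) ⟩
          sum (λ y → c ^ s y * fromℕ μ) + sum {M} (λ _ → rest)
            ≈⟨ +-cong (sum-*-const (λ y → c ^ s y) (fromℕ μ)) (sum-const M rest) ⟩
          Z * fromℕ μ + fromℕ M * rest                ≤⟨ +-monoʳ-≤ _ (*-monoʳ-≤ 0≤rest M≤) ⟩
          Z * fromℕ μ + B ^ r * (c ^ μ * (c ^ r * fromℕ κ))
            ≈⟨ +-congˡ (solve 4 (λ b m p k → b :* (m :* (p :* k)) := b :* p :* (m :* k)) refl (B ^ r) (c ^ μ) (c ^ r) (fromℕ κ)) ⟩
          Z * fromℕ μ + B ^ r * c ^ r * (c ^ μ * fromℕ κ)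
            ≈⟨ +-congˡ (trans (*-congʳ (B^n*c^n≈1 r)) (*-identityˡ _)) ⟩
          Z * fromℕ μ + c ^ μ * fromℕ κ
            ≤⟨ +-monoʳ-≤ _ (*-monoʳ-≤ (fromℕ-nonneg κ) (c^≤partition s y⋆)) ⟩
          Z * fromℕ μ + Z * fromℕ κ
            ≈⟨ solve 3 (λ z m k → z :* m :+ z :* k := (m :+ k) :* z) refl Z (fromℕ μ) (fromℕ κ) ⟩
          (fromℕ μ + fromℕ κ) * Z                     ∎

  -- Composition of the stages: privacy and expected error

  module Stages
    (k N : ℕ) (u : Fin N → Vector ℝ k)
    (u-bound : ∀ a j → u a j * u a j ≤ fromℕ 4)
    (o : Fin N) (u-zero : ∀ j → u o j ≈ 0#)
    (neg : Fin N → Fin N) (u-neg : ∀ a j → u (neg a) j ≈ - u a j)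
    (b : ℝ) (1≤b : 1# ≤ b) (h g κ τ ρ : ℕ → ℕ)
    where

    open Atoms k N u u-bound o u-zero neg u-neg public

    netSize : ℕ → ℕ
    netSize j = N ℕ.^ (g j ℕ.* g j)

    size : ℕ → ℕ
    size zero    = 1
    size (suc j) = netSize j ℕ.* size j

    net : ∀ j → Fin (netSize j) → Vector ℝ k
    net j y = netPoint (h j) (finToFun {N} {g j ℕ.* g j} y)

    -- The choices of all stages are coded by one number. The sum of the chosen net points depends
    -- on this code alone, not on the vector that is searched.
    offset : ∀ j → Fin (size j) → Vector ℝ k
    offset zero    _ _ = 0#
    offset (suc j) i c = net j (proj₁ (remQuot (size j) i)) c + offset j (proj₂ (remQuot {netSize j} (size j) i)) c

    netRadius : ℕ → ℕ
    netRadius j = 2 ℕ.* (h j ℕ.* g j)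

    radiusAfter : ℕ → ℕ → ℕ
    radiusAfter j r = r ℕ.+ netRadius j

    -- The tolerance grows by the mesh, since `net-step` finds a net point of small score only at
    -- the larger tolerance.
    scores : ∀ j → ℕ → Vector ℝ k → Fin (netSize j) → ℕ
    scores j r v y = score (radiusAfter j r) (λ c → v c - net j y c)

    base : ℕ → ℝ
    base j = b ^ τ j

    module Expo j = ExponentialMechanism (base j) (1≤x⇒1≤x^n (τ j) 1≤b)

    y₀ : ∀ j → Fin (netSize j)
    y₀ j = funToFin {g j ℕ.* g j} (λ _ → o)

    choice : ∀ j → ℕ → Vector ℝ k → Fin (netSize j) → ℝ
    choice j r v = Expo.probability j (y₀ j) (scores j r v)

    prob : ∀ j → ℕ → Vector ℝ k → Fin (size j) → ℝ
    -- Taking the decoded pair as one argument lets `remQuot-combine` be applied by congruence.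
    probPair : ∀ j → ℕ → Vector ℝ k → Fin (netSize j) × Fin (size j) → ℝ
    prob zero    r v _ = 1#
    prob (suc j) r v i = probPair j r v (remQuot (size j) i)
    probPair j r v (y , i) = choice j r v y * prob j (radiusAfter j r) (λ c → v c - net j y c) i

    prob-nonneg : ∀ j r v i → 0# ≤ prob j r v i
    prob-nonneg zero    r v i = 0≤1
    prob-nonneg (suc j) r v i =
      let y , e = remQuot {netSize j} (size j) i in
      *-nonneg (Expo.probability-nonneg j (y₀ j) (scores j r v) y) (prob-nonneg j (radiusAfter j r) (λ c → v c - net j y c) e)

    prob-combine : ∀ j r v y i → prob (suc j) r v (combine y i) ≡ probPair j r v (y , i)
    prob-combine j r v y i = ≡.cong (probPair j r v) (remQuot-combine y i)

    offset-combine : ∀ j y i c → offset (suc j) (combine y i) c ≡ net j y c + offset j i c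
    offset-combine j y i c = ≡.cong (λ (y , i) → net j y c + offset j i c) (remQuot-combine {netSize j} y i)

    prob-sum : ∀ j r v (f : Fin (size (suc j)) → ℝ) →
      sum (λ i → prob (suc j) r v i * f i) ≈
      sum {netSize j} (λ y → choice j r v y * sum {size j} (λ i → prob j (radiusAfter j r) (λ c → v c - net j y c) i * f (combine y i)))
    prob-sum j r v f = begin-equality
      sum (λ i → prob (suc j) r v i * f i)
        ≈⟨ sum-combine (netSize j) (λ i → prob (suc j) r v i * f i) ⟩
      sum {netSize j} (λ y → sum {size j} (λ i → prob (suc j) r v (combine y i) * f (combine y i)))
        ≈⟨ sum-cong {netSize j} (λ y → begin-equality
             sum {size j} (λ i → prob (suc j) r v (combine y i) * f (combine y i))
               ≈⟨ sum-cong {size j} (λ i → begin-equality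
                    prob (suc j) r v (combine y i) * f (combine y i)
                      ≡⟨ ≡.cong (_* f (combine y i)) (prob-combine j r v y i) ⟩
                    choice j r v y * prob′ y i * f (combine y i)     ≈⟨ *-assoc _ _ _ ⟩
                    choice j r v y * (prob′ y i * f (combine y i))   ∎) ⟩
             sum (λ i → choice j r v y * (prob′ y i * f (combine y i)))
               ≈⟨ *-distribˡ-sum (choice j r v y) (λ i → prob′ y i * f (combine y i)) ⟨
             choice j r v y * sum (λ i → prob′ y i * f (combine y i)) ∎) ⟩
      sum (λ y → choice j r v y * sum (λ i → prob′ y i * f (combine y i))) ∎
      where
      prob′ : Fin (netSize j) → Fin (size j) → ℝ
      prob′ y = prob j (radiusAfter j r) (λ c → v c - net j y c)

    prob-total : ∀ j r v → sum (prob j r v) ≈ 1#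
    prob-total zero    r v = +-identityʳ 1#
    prob-total (suc j) r v = begin-equality
      sum (prob (suc j) r v)                  ≈⟨ sum-cong (λ i → *-identityʳ (prob (suc j) r v i)) ⟨
      sum (λ i → prob (suc j) r v i * 1#)     ≈⟨ prob-sum j r v (λ _ → 1#) ⟩
      sum (λ y → choice j r v y * sum (λ i → prob′ y i * 1#))
        ≈⟨ sum-cong (λ y → trans (*-congˡ (trans (sum-cong λ i → *-identityʳ (prob′ y i)) (prob-total j _ _))) (*-identityʳ (choice j r v y))) ⟩
      sum (choice j r v)                      ≈⟨ Expo.probability-total j (y₀ j) (scores j r v) ⟩
      1#                                      ∎
      where
      prob′ : Fin (netSize j) → Fin (size j) → ℝ
      prob′ y = prob j (radiusAfter j r) (λ c → v c - net j y c)

    privacyLoss : ℕ → ℕ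
    privacyLoss = prefixSum τ

    -- Sequential composition: once the same net point has been subtracted from v and w, the
    -- residuals still differ by the same d atoms, so the ratios of the stages multiply.
    prob-ratio : ∀ j r d {v w} (l l⁻ : Fin d → Fin N) →
      (∀ c → w c ≈ v c + atomSum l c) → (∀ c → v c ≈ w c + atomSum l⁻ c) →
      ∀ i → prob j r v i ≤ b ^ (privacyLoss j ℕ.* (d ℕ.+ d)) * prob j r w i
    prob-ratio zero    r d l l⁻ w≈ v≈ i = ≤-reflexive (sym (*-identityˡ 1#))
    prob-ratio (suc j) r d {v} {w} l l⁻ w≈ v≈ i = begin
      choice j r v y * p v   ≤⟨ *-mono-≤ (Expo.probability-nonneg j (y₀ j) (scores j r v) y)
                                  (*-nonneg (0≤b^ (privacyLoss j ℕ.* (d ℕ.+ d))) (prob-nonneg j _ _ e)) first rest ⟩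
      base j ^ d * base j ^ d * choice j r w y * (b ^ (privacyLoss j ℕ.* (d ℕ.+ d)) * p w)
        ≈⟨ solve 5 (λ x q c y p → x :* q :* c :* (y :* p) := (x :* q) :* y :* (c :* p)) refl
             (base j ^ d) (base j ^ d) (choice j r w y) (b ^ (privacyLoss j ℕ.* (d ℕ.+ d))) (p w) ⟩
      base j ^ d * base j ^ d * b ^ (privacyLoss j ℕ.* (d ℕ.+ d)) * (choice j r w y * p w)
        ≈⟨ *-congʳ (*-congʳ (trans (sym (^-homo-* (base j) d d)) (^-assocʳ b (τ j) (d ℕ.+ d)))) ⟩
      b ^ (τ j ℕ.* (d ℕ.+ d)) * b ^ (privacyLoss j ℕ.* (d ℕ.+ d)) * (choice j r w y * p w)
        ≈⟨ *-congʳ (^-homo-* b (τ j ℕ.* (d ℕ.+ d)) (privacyLoss j ℕ.* (d ℕ.+ d))) ⟨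
      b ^ (τ j ℕ.* (d ℕ.+ d) ℕ.+ privacyLoss j ℕ.* (d ℕ.+ d)) * (choice j r w y * p w)
        ≡⟨ ≡.cong (λ e → b ^ e * (choice j r w y * p w)) (ℕₚ.*-distribʳ-+ (d ℕ.+ d) (τ j) (privacyLoss j)) ⟨
      b ^ ((τ j ℕ.+ privacyLoss j) ℕ.* (d ℕ.+ d)) * (choice j r w y * p w) ∎
      where
      y = proj₁ (remQuot {netSize j} (size j) i)
      e = proj₂ (remQuot {netSize j} (size j) i)
      p : Vector ℝ k → ℝ
      p v = prob j (radiusAfter j r) (λ c → v c - net j y c) e
      0≤b^ : ∀ n → 0# ≤ b ^ n
      0≤b^ n = ^-nonneg n (≤-trans 0≤1 1≤b)
      shift : ∀ v w (l : Fin d → Fin N) → (∀ c → w c ≈ v c + atomSum l c) → ∀ y c →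
              w c - net j y c ≈ (v c - net j y c) + atomSum l c
      shift v w l w≈ y c = trans (+-congʳ (w≈ c))
        (solve 3 (λ v s n → (v :+ s) :- n := (v :- n) :+ s) refl (v c) (atomSum l c) (net j y c))
      first : choice j r v y ≤ base j ^ d * base j ^ d * choice j r w y
      first = Expo.probability-ratio j (y₀ j) d
        (λ y → score-sensitivity {v = λ c → w c - net j y c} d l⁻ l (shift w v l⁻ v≈ y) (shift v w l w≈ y))
        (λ y → score-sensitivity {v = λ c → v c - net j y c} d l l⁻ (shift v w l w≈ y) (shift w v l⁻ v≈ y)) y
      rest : p v ≤ b ^ (privacyLoss j ℕ.* (d ℕ.+ d)) * p w
      rest = prob-ratio j (radiusAfter j r) d {λ c → v c - net j y c} {λ c → w c - net j y c} l l⁻ (shift v w l w≈ y) (shift w v l⁻ v≈ y) e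

    netError excess : ℕ → ℕ
    netError = prefixSum netRadius
    excess   = prefixSum κ

    module _ (L : ℕ)
      (1≤h : ∀ j → 1 ℕ.≤ h j) (1≤g : ∀ j → 1 ℕ.≤ g j)
      (ρ-suc : ∀ j → j ℕ.< L → ρ (suc j) ℕ.≤ h j ℕ.* (g j ℕ.* g j))
      (netSize≤ : ∀ j → j ℕ.< L → fromℕ (netSize j) ≤ base j ^ ρ j)
      (κ-bound : ∀ j → j ℕ.< L → ∀ t → fromℕ t ≤ fromℕ (κ j) * base j ^ t)
      where

      -- The cost is arbitrary, bounded only in terms of how many atoms reach the final residual. In
      -- this form the hypothesis passes to the continuation after each choice y, and the induction
      -- runs over the remaining stages.
      expected-cost : ∀ j {r s v} → j ℕ.≤ L → 1 ℕ.≤ r → Reach r s v →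
        (cost : Fin (size j) → ℝ) →
        (∀ i c → Reach (r ℕ.+ netError j) c (λ d → v d - offset j i d) → cost i ≤ fromℕ (r ℕ.+ netError j ℕ.+ 2 ℕ.* c)) →
        sum (λ i → prob j r v i * cost i) ≤ fromℕ (errorBound netRadius κ ρ j r s)
      expected-cost zero {r} {s} {v} _ 1≤r q cost cost≤ = begin
        1# * cost zero + 0#      ≈⟨ trans (+-identityʳ _) (*-identityˡ _) ⟩
        cost zero                ≤⟨ cost≤ zero s (Reach-monoʳ (ℕₚ.m≤m+n r 0) (Reach-cong (λ j →
                                      solve 1 (λ v → v := v :- con (+ 0)) refl (v j)) q)) ⟩
        fromℕ (r ℕ.+ 0 ℕ.+ 2 ℕ.* s) ≤⟨ fromℕ-mono (ℕₚ.+-monoʳ-≤ (r ℕ.+ 0) (ℕₚ.*-monoʳ-≤ 2 (ℕₚ.≤-trans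
                                      (ℕₚ.m≤n+m∸n s (ρ 0)) (ℕₚ.+-monoˡ-≤ (s ℕ.∸ ρ 0) (ℕₚ.m≤m+n (ρ 0) 0))))) ⟩
        fromℕ (errorBound netRadius κ ρ zero r s) ∎
      expected-cost (suc j) {r} {s} {v} j<L 1≤r q cost cost≤ = begin
        sum (λ i → prob (suc j) r v i * cost i)
          ≈⟨ prob-sum j r v cost ⟩
        sum (λ y → P y * sum (λ i → prob j r′ (v′ y) i * cost (combine y i)))
          ≤⟨ sum-mono (λ y → *-monoˡ-≤ (Expo.probability-nonneg j (y₀ j) (scores j r v) y) (inner y)) ⟩
        sum (λ y → P y * fromℕ (errorBound netRadius κ ρ j r′ (S y)))
          ≈⟨ sum-cong (λ y → trans (*-congˡ (expand y)) (solve 4 (λ p c t e → p :* (c :+ t :* e) := p :* c :+ t :* (p :* e)) refl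
               (P y) (fromℕ C) (fromℕ 2) (fromℕ (S y ℕ.∸ ρ j)))) ⟩
        sum (λ y → P y * fromℕ C + fromℕ 2 * (P y * fromℕ (S y ℕ.∸ ρ j)))
          ≈⟨ ∑-distrib-+ (λ y → P y * fromℕ C) (λ y → fromℕ 2 * (P y * fromℕ (S y ℕ.∸ ρ j))) ⟩
        sum (λ y → P y * fromℕ C) + sum (λ y → fromℕ 2 * (P y * fromℕ (S y ℕ.∸ ρ j)))
          ≈⟨ +-cong (trans (sum-*-const P (fromℕ C)) (trans (*-congʳ (Expo.probability-total j (y₀ j) S)) (*-identityˡ _)))
               (sym (*-distribˡ-sum (fromℕ 2) (λ y → P y * fromℕ (S y ℕ.∸ ρ j)))) ⟩
        fromℕ C + fromℕ 2 * sum (λ y → P y * fromℕ (S y ℕ.∸ ρ j))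
          ≤⟨ +-monoʳ-≤ _ (*-monoˡ-≤ (fromℕ-nonneg 2) (Expo.probability-excess j (y₀ j) {ρ j} {κ j} S y⋆ (netSize≤ j j<L) (κ-bound j j<L))) ⟩
        fromℕ C + fromℕ 2 * fromℕ (S y⋆ ℕ.+ κ j)
          ≈⟨ trans (fromℕ-+ C (2 ℕ.* (S y⋆ ℕ.+ κ j))) (+-congˡ (fromℕ-* 2 (S y⋆ ℕ.+ κ j))) ⟨
        fromℕ (C ℕ.+ 2 ℕ.* (S y⋆ ℕ.+ κ j))
          ≤⟨ fromℕ-mono final ⟩
        fromℕ (errorBound netRadius κ ρ (suc j) r s) ∎
        where
        r′ = radiusAfter j r
        v′ : Fin (netSize j) → Vector ℝ k
        v′ y c = v c - net j y c
        P = choice j r v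
        S = scores j r v
        C = r′ ℕ.+ netError j ℕ.+ 2 ℕ.* (ρ 0 ℕ.+ excess j)
        step = net-step (h j) (g j) 1≤r (1≤h j) (1≤g j) q
        -- The good candidate, from Maurey's lemma. Its score is at most `s ∸ ρ (suc j)`, the excess
        -- with which the stage began, so the mean excess grows by at most `κ j`.
        y⋆ : Fin (netSize j)
        y⋆ = funToFin {g j ℕ.* g j} {N} (proj₁ step)
        Reach-y⋆ : Reach r′ (s ℕ.∸ h j ℕ.* (g j ℕ.* g j)) (v′ y⋆)
        Reach-y⋆ = Reach-cong (λ c → +-congˡ (-‿cong (*-congˡ (sum-cong λ i →
          ≡⇒≈ (≡.cong (λ a → u a c) (≡.sym (finToFun-funToFin {g j ℕ.* g j} {N} (proj₁ step) i))))))) (proj₂ step)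
          where
          ≡⇒≈ : ∀ {x y} → x ≡ y → x ≈ y
          ≡⇒≈ ≡.refl = refl
        Sy⋆≤ : S y⋆ ℕ.≤ s ℕ.∸ ρ (suc j)
        Sy⋆≤ = ℕₚ.≤-trans (score-≤ Reach-y⋆) (ℕₚ.∸-monoʳ-≤ s (ρ-suc j j<L))
        inner : ∀ y → sum (λ i → prob j r′ (v′ y) i * cost (combine y i)) ≤ fromℕ (errorBound netRadius κ ρ j r′ (S y))
        -- The average runs over all y, so for each of them the score must be attained and not be
        -- the default 0; `net-Reach⁻` supplies the witness.
        inner y = expected-cost j (ℕₚ.<⇒≤ j<L) (ℕₚ.≤-trans 1≤r (ℕₚ.m≤m+n r _))
          (score-Reach (Reach-monoʳ (ℕₚ.m≤m+n r _) (net-Reach⁻ (h j) (finToFun {N} {g j ℕ.* g j} y) q))) (λ i → cost (combine y i))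
          λ i c p → ≡.subst (λ e → cost (combine y i) ≤ fromℕ (e ℕ.+ 2 ℕ.* c)) (≡.sym r+≡)
            (cost≤ (combine y i) c (≡.subst (λ e → Reach e c (λ d → v d - offset (suc j) (combine y i) d)) r+≡
              (Reach-cong (λ d → begin-equality
                (v d - net j y d) - offset j i d
                  ≈⟨ solve 3 (λ v n o → (v :- n) :- o := v :- (n :+ o)) refl (v d) (net j y d) (offset j i d) ⟩
                v d - (net j y d + offset j i d)          ≡⟨ ≡.cong (λ z → v d - z) (offset-combine j y i d) ⟨
                v d - offset (suc j) (combine y i) d      ∎) p)))
          where
          r+≡ : r′ ℕ.+ netError j ≡ r ℕ.+ netError (suc j)
          r+≡ = ℕₚ.+-assoc r (netRadius j) (netError j)
        expand : ∀ y → fromℕ (errorBound netRadius κ ρ j r′ (S y)) ≈ fromℕ C + fromℕ 2 * fromℕ (S y ℕ.∸ ρ j)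
        expand y = begin-equality
          fromℕ (errorBound netRadius κ ρ j r′ (S y))                   ≡⟨ ≡.cong fromℕ (≡.trans
            (≡.cong (r′ ℕ.+ netError j ℕ.+_) (ℕₚ.*-distribˡ-+ 2 (ρ 0 ℕ.+ excess j) (S y ℕ.∸ ρ j)))
            (≡.sym (ℕₚ.+-assoc (r′ ℕ.+ netError j) (2 ℕ.* (ρ 0 ℕ.+ excess j)) (2 ℕ.* (S y ℕ.∸ ρ j))))) ⟩
          fromℕ (C ℕ.+ 2 ℕ.* (S y ℕ.∸ ρ j))               ≈⟨ fromℕ-+ C _ ⟩
          fromℕ C + fromℕ (2 ℕ.* (S y ℕ.∸ ρ j))           ≈⟨ +-congˡ (fromℕ-* 2 (S y ℕ.∸ ρ j)) ⟩
          fromℕ C + fromℕ 2 * fromℕ (S y ℕ.∸ ρ j)         ∎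
        final : C ℕ.+ 2 ℕ.* (S y⋆ ℕ.+ κ j) ℕ.≤ errorBound netRadius κ ρ (suc j) r s
        final = ℕₚ.≤-trans (ℕₚ.+-monoʳ-≤ C (ℕₚ.*-monoʳ-≤ 2 (ℕₚ.+-monoˡ-≤ (κ j) Sy⋆≤)))
          (ℕₚ.≤-reflexive (errorBound-suc netRadius κ ρ j r s))

  -- Auxiliary bounds for the norm, the supremum and the minimum

  square-bound : ∀ {z r} → - r ≤ z → z ≤ r → z * z ≤ r * r
  square-bound {z} {r} -r≤z z≤r = ≤-offset ((r - z) * (z - - r))
    (*-nonneg (x≤y⇒0≤y-x z≤r) (x≤y⇒0≤y-x -r≤z))
    (solve 2 (λ z r → r :* r := z :* z :+ (r :- z) :* (z :- :- r)) refl z r)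

  sum-change : ∀ {n} (f f′ : Fin n → ℝ) i → (∀ j → j ≢ i → f j ≈ f′ j) → sum f′ ≈ sum f + (f′ i - f i)
  sum-change f f′ zero eq = trans (+-congˡ (sum-cong λ j → sym (eq (suc j) λ ())))
    (solve 3 (λ a b s → b :+ s := (a :+ s) :+ (b :- a)) refl (f zero) (f′ zero) (sum λ j → f (suc j)))
  sum-change f f′ (suc i) eq = trans
    (+-cong (sym (eq zero λ ())) (sum-change (λ j → f (suc j)) (λ j → f′ (suc j)) i λ j j≢i → eq (suc j) λ where ≡.refl → j≢i ≡.refl))
    (sym (+-assoc _ _ _))

  *-⊓-bound : ∀ {c x y z} → z ≤ c * x → z ≤ c * y → z ≤ c * (x ⊓ y)
  *-⊓-bound {x = x} {y} z≤cx z≤cy with ⊓-sel x y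
  ... | inj₁ eq = ≤-trans z≤cx (≤-reflexive (*-congˡ (sym eq)))
  ... | inj₂ eq = ≤-trans z≤cy (≤-reflexive (*-congˡ (sym eq)))

  sup-≤ : {A : Set} (f : A → ℝ) {B : ℝ} → A → (∀ a → f a ≤ B) → sup f ≤ B
  sup-≤ f {B} a f≤B = proj₂ (sup-isLub f a (B , bounded)) B bounded
    where
    bounded : IsUpperBound (Range f) B
    bounded y (a , y≈fa) = ≤-trans (≤-reflexive y≈fa) (f≤B a)

  -- Passes from the squared form of `Close` to the normalised norm; the factor w will be `W`, by
  -- which all vectors in the search are scaled.
  rms-bound : ∀ {k} → 1 ℕ.≤ k → (e : Vector ℝ k) {w B : ℝ} → 0# ≤ w → 0# ≤ B →
              sum (λ j → w * e j * (w * e j)) ≤ fromℕ k * (B * B) →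
              w * (1# / sqrt (fromℕ k) * ‖ e ‖₂) ≤ B
  rms-bound {k} 1≤k e {w} {B} 0≤w 0≤B h = square-cancel-≤ 0≤B (*-cancelˡ-≤ 0<k (begin
    fromℕ k * (w * (1# * i * ν) * (w * (1# * i * ν)))
      ≈⟨ *-congʳ (proj₂ root) ⟨
    s * s * (w * (1# * i * ν) * (w * (1# * i * ν)))
      ≈⟨ solve 4 (λ s w i ν → s :* s :* (w :* (con (+ 1) :* i :* ν) :* (w :* (con (+ 1) :* i :* ν)))
                  := (s :* i) :* (s :* i) :* (w :* w :* (ν :* ν))) refl s w i ν ⟩
    s * i * (s * i) * (w * w * (ν * ν))
      ≈⟨ *-cong (trans (*-cong s*i≈1 s*i≈1) (*-identityˡ 1#)) (*-congˡ (proj₂ norm)) ⟩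
    1# * (w * w * sum (λ j → e j * e j))
      ≈⟨ *-identityˡ _ ⟩
    w * w * sum (λ j → e j * e j)
      ≈⟨ *-distribˡ-sum (w * w) (λ j → e j * e j) ⟩
    sum (λ j → w * w * (e j * e j))
      ≈⟨ sum-cong (λ j → solve 2 (λ w e → w :* w :* (e :* e) := w :* e :* (w :* e)) refl w (e j)) ⟩
    sum (λ j → w * e j * (w * e j))
      ≤⟨ h ⟩
    fromℕ k * (B * B) ∎))
    where
    s = sqrt (fromℕ k)
    i = s ⁻¹
    ν = ‖ e ‖₂
    0<k : 0# < fromℕ k
    0<k = fromℕ-positive 1≤k
    root : 0# ≤ s × s * s ≈ fromℕ k
    root = sqrt-spec (proj₁ 0<k)
    norm : 0# ≤ ν × ν * ν ≈ sum (λ j → e j * e j)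
    norm = sqrt-spec (sum-nonneg λ j → square-nonneg (e j))
    0<s : 0# < s
    0<s = proj₁ root , λ 0≈s → proj₂ 0<k (trans (sym (zeroˡ s)) (trans (*-congʳ 0≈s) (proj₂ root)))
    s*i≈1 : s * i ≈ 1#
    s*i≈1 = *-inverseʳ 0<s

  indicator-nonneg : ∀ b → 0# ≤ (if b then 1# else 0#)
  indicator-nonneg true  = 0≤1
  indicator-nonneg false = ≤-refl

  -- The mechanism for given queries

  module Instance
    (D : Set) (T : ℕ) (D↔Fin : D ↔ Fin T) (1≤T : 1 ℕ.≤ T)
    (k : ℕ) (1≤k : 1 ℕ.≤ k) (n : ℕ) (1≤n : 1 ℕ.≤ n)
    (q : Fin k → D → ℝ) (q-bound : ∀ j d → (- 1# ≤ q j d) × (q j d ≤ 1#))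
    (ε : ℝ) (0<ε : 0# < ε)
    (ℓ : ℝ) (exp-ℓ : exp ℓ ≈ fromℕ (2 ℕ.* T))
    where

    open Inverse D↔Fin using (to; from; strictlyInverseʳ)

    error : Mechanism D n k → Vec D n → ℝ
    error M x = 1# / sqrt (fromℕ k) * 𝔼 (M x) (λ y → ‖ (λ j → y j - F q x j) ‖₂)

    d₀ : D
    d₀ = from (fromℕ< 1≤T)

    ½≤ℓ : ½ ≤ ℓ
    ½≤ℓ = 2≤exp⇒½≤ (≤-trans (fromℕ-mono (ℕₚ.*-monoʳ-≤ 2 1≤T)) (≤-reflexive (sym exp-ℓ)))

    0≤ℓ : 0# ≤ ℓ
    0≤ℓ = ≤-trans (proj₁ 0<½) ½≤ℓ

    0≤2ℓ : 0# ≤ fromℕ 2 * ℓ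
    0≤2ℓ = *-nonneg (fromℕ-nonneg 2) 0≤ℓ

    -- The effect of the 2 in log (2 T): the logarithm stays away from 0 even for T = 1.
    1≤2ℓ : 1# ≤ fromℕ 2 * ℓ
    1≤2ℓ = ≤-trans (≤-reflexive (sym (*-inverseʳ 0<2))) (*-monoˡ-≤ (fromℕ-nonneg 2) ½≤ℓ)

    -- Serves the case ε n < 12 ℓ, in which a constant error is within the bound.
    trivialMechanism : Mechanism D n k
    trivialMechanism x = record
      { size = 1 ; point = λ _ _ → 0# ; weight = λ _ → 1#
      ; nonneg = λ _ → 0≤1 ; total = +-identityʳ 1# }

    trivial-private : PureDP ε trivialMechanism
    trivial-private x x′ _ E _ = ≤-trans (≤-reflexive (sym (*-identityˡ (ℙ (trivialMechanism x′) E))))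
      (*-monoʳ-≤ (+-nonneg (*-nonneg 0≤1 (indicator-nonneg (does (lem {E (λ _ → 0#)})))) ≤-refl) (1≤exp (proj₁ 0<ε)))

    n*F : ∀ (x : Vec D n) j → fromℕ n * F q x j ≈ sum (λ i → q j (lookup x i))
    n*F x j = trans (*-congˡ (*-congʳ (*-identityˡ (fromℕ n ⁻¹)))) (x*[x⁻¹*y]≈y {fromℕ n} (sum λ i → q j (lookup x i)) (fromℕ-positive 1≤n))

    trivial-error : ∀ x → error trivialMechanism x ≤ 1#
    trivial-error x = begin
      c * (1# * ν + 0#)
        ≈⟨ solve 2 (λ c ν → c :* (con (+ 1) :* ν :+ con (+ 0)) := con (+ 1) :* (c :* ν)) refl c ν ⟩
      1# * (c * ν)            ≤⟨ rms-bound 1≤k e 0≤1 0≤1 (begin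
        sum (λ j → 1# * e j * (1# * e j)) ≤⟨ sum-mono (λ j → F-bound j) ⟩
        sum {k} (λ _ → 1# * 1#)           ≈⟨ sum-const k _ ⟩
        fromℕ k * (1# * 1#)               ∎) ⟩
      1#                      ∎
      where
      c = 1# / sqrt (fromℕ k)
      e : Vector ℝ k
      e j = 0# - F q x j
      ν = ‖ e ‖₂
      N : ℝ
      N = fromℕ n
      0<N : 0# < N
      0<N = fromℕ-positive 1≤n
      F-bound : ∀ j → 1# * e j * (1# * e j) ≤ 1# * 1#
      F-bound j = ≤-trans (≤-reflexive (solve 1 (λ f → (con (+ 1) :* (con (+ 0) :- f)) :* (con (+ 1) :* (con (+ 0) :- f)) := f :* f) refl (F q x j)))
        (square-bound
          (*-cancelˡ-≤ 0<N (begin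
            N * - 1#                          ≈⟨ sum-const n (- 1#) ⟨
            sum {n} (λ _ → - 1#)              ≤⟨ sum-mono (λ i → proj₁ (q-bound j (lookup x i))) ⟩
            sum (λ i → q j (lookup x i))      ≈⟨ n*F x j ⟨
            N * F q x j                       ∎))
          (*-cancelˡ-≤ 0<N (begin
            N * F q x j                       ≈⟨ n*F x j ⟩
            sum (λ i → q j (lookup x i))      ≤⟨ sum-mono (λ i → proj₂ (q-bound j (lookup x i))) ⟩
            sum {n} (λ _ → 1#)                ≈⟨ sum-const n 1# ⟩
            N * 1#                            ∎)))

    -- Ordered pairs of rows are taken, equal ones included, so that the atoms contain 0 and are
    -- closed under negation.
    atom : Fin (T ℕ.* T) → Vector ℝ k
    atom a j = q j (from (proj₁ (remQuot {T} T a))) - q j (from (proj₂ (remQuot {T} T a)))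

    difference : D → D → Fin (T ℕ.* T)
    difference d d′ = combine (to d) (to d′)

    atom-difference : ∀ d d′ j → atom (difference d d′) j ≡ q j d - q j d′
    atom-difference d d′ j = ≡.trans
      (≡.cong (λ (a , b) → q j (from a) - q j (from b)) (remQuot-combine (to d) (to d′)))
      (≡.cong₂ (λ d d′ → q j d - q j d′) (strictlyInverseʳ d) (strictlyInverseʳ d′))

    atom-difference-≈ : ∀ d d′ j → atom (difference d d′) j ≈ q j d - q j d′
    atom-difference-≈ d d′ j = ≡.subst (atom (difference d d′) j ≈_) (atom-difference d d′ j) refl

    atom-bound : ∀ a j → atom a j * atom a j ≤ fromℕ 4
    atom-bound a j = begin
      atom a j * atom a j ≤⟨ square-bound {r = fromℕ 2}
        (≤-trans (≤-reflexive (solve 0 (:- numeral 2 := :- con (+ 1) :- con (+ 1)) refl))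
          (+-mono-≤ (proj₁ (q-bound j _)) (neg-mono-≤ (proj₂ (q-bound j _)))))
        (≤-trans (+-mono-≤ (proj₂ (q-bound j _)) (neg-mono-≤ (proj₁ (q-bound j _))))
          (≤-reflexive (solve 0 (con (+ 1) :- :- con (+ 1) := numeral 2) refl))) ⟩
      fromℕ 2 * fromℕ 2   ≈⟨ fromℕ-* 2 2 ⟨
      fromℕ 4             ∎

    atom-zero : ∀ j → atom (difference d₀ d₀) j ≈ 0#
    atom-zero j = trans (atom-difference-≈ d₀ d₀ j) (-‿inverseʳ _)

    atom-neg : Fin (T ℕ.* T) → Fin (T ℕ.* T)
    atom-neg a = combine (proj₂ (remQuot {T} T a)) (proj₁ (remQuot {T} T a))

    atom-neg-≈ : ∀ a j → atom (atom-neg a) j ≈ - atom a j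
    atom-neg-≈ a j = ≡.subst (_≈ - atom a j)
      (≡.sym (≡.cong (λ (a , b) → q j (from a) - q j (from b)) (remQuot-combine {T} {T} (proj₂ (remQuot {T} T a)) (proj₁ (remQuot {T} T a)))))
      (solve 2 (λ x y → y :- x := :- (x :- y)) refl _ _)

    -- The 12 is 3 · 2 · 2: the costs `τ` sum to at most 3 · 4^L, the exponential mechanism pays
    -- twice, and `W * ϑ` is 2 ℓ.
    module Staged (L : ℕ) (L-bound : fromℕ (12 ℕ.* 4 ℕ.^ L) * ℓ ≤ ε * fromℕ n) where

      open Schedule n 1≤n L

      0<W : 0# < fromℕ W
      0<W = fromℕ-positive 1≤W

      -- Makes `b ^ W` equal to (2 T)², which dominates the number T² of atoms.
      ϑ : ℝ
      ϑ = fromℕ W ⁻¹ * (fromℕ 2 * ℓ)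

      0≤ϑ : 0# ≤ ϑ
      0≤ϑ = *-nonneg (proj₁ (⁻¹-positive 0<W)) 0≤2ℓ

      W*ϑ : fromℕ W * ϑ ≈ fromℕ 2 * ℓ
      W*ϑ = x*[x⁻¹*y]≈y (fromℕ 2 * ℓ) 0<W

      b : ℝ
      b = exp ϑ

      b^ : ∀ m → b ^ m ≈ exp (fromℕ m * ϑ)
      b^ m = sym (exp-^ m 0≤ϑ)

      0≤b : 0# ≤ b
      0≤b = exp-nonneg 0≤ϑ

      b^W : b ^ W ≈ fromℕ (2 ℕ.* T) * fromℕ (2 ℕ.* T)
      b^W = begin-equality
        b ^ W                 ≈⟨ b^ W ⟩
        exp (fromℕ W * ϑ)
          ≈⟨ exp-cong (*-nonneg (fromℕ-nonneg W) 0≤ϑ) (trans W*ϑ (solve 1 (λ l → numeral 2 :* l := l :+ l) refl ℓ)) ⟩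
        exp (ℓ + ℓ)           ≈⟨ exp-+ 0≤ℓ 0≤ℓ ⟩
        exp ℓ * exp ℓ         ≈⟨ *-cong exp-ℓ exp-ℓ ⟩
        fromℕ (2 ℕ.* T) * fromℕ (2 ℕ.* T) ∎

      open Stages k (T ℕ.* T) atom atom-bound (difference d₀ d₀) atom-zero atom-neg atom-neg-≈
        b (1≤exp 0≤ϑ) h g κ τ ρ

      netSize≤ : ∀ j → j ℕ.< L → fromℕ (netSize j) ≤ base j ^ ρ j
      netSize≤ j j<L = begin
        fromℕ ((T ℕ.* T) ℕ.^ (g j ℕ.* g j))   ≡⟨ ≡.cong (λ e → fromℕ ((T ℕ.* T) ℕ.^ e)) (g*g j) ⟩
        fromℕ ((T ℕ.* T) ℕ.^ 4 ℕ.^ j)         ≈⟨ fromℕ-^ (T ℕ.* T) (4 ℕ.^ j) ⟩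
        fromℕ (T ℕ.* T) ^ (4 ℕ.^ j)           ≤⟨ ^-mono-≤ (4 ℕ.^ j) (fromℕ-nonneg (T ℕ.* T)) (begin
          fromℕ (T ℕ.* T)
            ≤⟨ fromℕ-mono (ℕₚ.*-mono-≤ (ℕₚ.m≤m+n T (1 ℕ.* T)) (ℕₚ.m≤m+n T (1 ℕ.* T))) ⟩
          fromℕ (2 ℕ.* T ℕ.* (2 ℕ.* T))         ≈⟨ fromℕ-* (2 ℕ.* T) (2 ℕ.* T) ⟩
          fromℕ (2 ℕ.* T) * fromℕ (2 ℕ.* T)     ≈⟨ b^W ⟨
          b ^ W                                 ∎) ⟩
        (b ^ W) ^ (4 ℕ.^ j)                   ≈⟨ ^-assocʳ b W (4 ℕ.^ j) ⟩
        b ^ (W ℕ.* 4 ℕ.^ j)                   ≡⟨ ≡.cong (b ^_) (τ*ρ j j<L) ⟨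
        b ^ (τ j ℕ.* ρ j)                     ≈⟨ ^-assocʳ b (τ j) (ρ j) ⟨
        base j ^ ρ j                          ∎

      -- This is x ≤ exp x at x = τ t ϑ (τ and κ at j), because κ τ ϑ = W ϑ = 2 ℓ ≥ 1.
      κ-bound : ∀ j → j ℕ.< L → ∀ t → fromℕ t ≤ fromℕ (κ j) * base j ^ t
      κ-bound j j<L t = begin
        fromℕ t                                ≈⟨ *-identityˡ _ ⟨
        1# * fromℕ t                           ≤⟨ *-monoʳ-≤ (fromℕ-nonneg t) 1≤2ℓ ⟩
        fromℕ 2 * ℓ * fromℕ t                  ≈⟨ *-congʳ W*ϑ ⟨
        fromℕ W * ϑ * fromℕ t                  ≡⟨ ≡.cong (λ w → fromℕ w * ϑ * fromℕ t) (κ*τ j j<L) ⟨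
        fromℕ (κ j ℕ.* τ j) * ϑ * fromℕ t      ≈⟨ *-congʳ (*-congʳ (fromℕ-* (κ j) (τ j))) ⟩
        fromℕ (κ j) * fromℕ (τ j) * ϑ * fromℕ t
          ≈⟨ solve 4 (λ k p x t → k :* p :* x :* t := k :* (p :* t :* x)) refl (fromℕ (κ j)) (fromℕ (τ j)) ϑ (fromℕ t) ⟩
        fromℕ (κ j) * (fromℕ (τ j) * fromℕ t * ϑ) ≈⟨ *-congˡ (*-congʳ (fromℕ-* (τ j) t)) ⟨
        fromℕ (κ j) * (fromℕ (τ j ℕ.* t) * ϑ)
          ≤⟨ *-monoˡ-≤ (fromℕ-nonneg (κ j)) (≤-trans (≤-offset 1# 0≤1 (+-comm _ _))
                                                    (1+x≤exp (*-nonneg (fromℕ-nonneg (τ j ℕ.* t)) 0≤ϑ))) ⟩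
        fromℕ (κ j) * exp (fromℕ (τ j ℕ.* t) * ϑ) ≈⟨ *-congˡ (b^ (τ j ℕ.* t)) ⟨
        fromℕ (κ j) * b ^ (τ j ℕ.* t)          ≈⟨ *-congˡ (^-assocʳ b (τ j) t) ⟨
        fromℕ (κ j) * base j ^ t               ∎

      privacy-budget : b ^ (prefixSum τ L ℕ.* (P₁₂ ℕ.+ P₁₂)) ≤ exp ε
      privacy-budget = begin
        b ^ m               ≈⟨ b^ m ⟩
        exp (fromℕ m * ϑ)
          ≤⟨ exp-mono (*-nonneg (fromℕ-nonneg m) 0≤ϑ) (*-cancelˡ-≤ (fromℕ-positive 1≤n) (begin
          fromℕ n * (fromℕ m * ϑ)                      ≈⟨ *-assoc _ _ _ ⟨
          fromℕ n * fromℕ m * ϑ                        ≈⟨ *-congʳ (fromℕ-* n m) ⟨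
          fromℕ (n ℕ.* m) * ϑ                          ≤⟨ *-monoʳ-≤ 0≤ϑ (fromℕ-mono total-privacy) ⟩
          fromℕ (6 ℕ.* P₄ ℕ.* W) * ϑ
            ≈⟨ trans (*-congʳ (fromℕ-* (6 ℕ.* P₄) W)) (*-assoc _ _ _) ⟩
          fromℕ (6 ℕ.* P₄) * (fromℕ W * ϑ)             ≈⟨ *-congˡ W*ϑ ⟩
          fromℕ (6 ℕ.* P₄) * (fromℕ 2 * ℓ)             ≈⟨ *-assoc _ _ _ ⟨
          fromℕ (6 ℕ.* P₄) * fromℕ 2 * ℓ
            ≈⟨ *-congʳ (trans (*-comm _ _) (sym (fromℕ-* 2 (6 ℕ.* P₄)))) ⟩
          fromℕ (2 ℕ.* (6 ℕ.* P₄)) * ℓ                 ≡⟨ ≡.cong (λ e → fromℕ e * ℓ) (ℕₚ.*-assoc 2 6 P₄) ⟨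
          fromℕ (12 ℕ.* P₄) * ℓ                        ≤⟨ L-bound ⟩
          ε * fromℕ n                                  ≈⟨ *-comm _ _ ⟩
          fromℕ n * ε                                  ∎)) ⟩
        exp ε               ∎
        where
        m = prefixSum τ L ℕ.* (P₁₂ ℕ.+ P₁₂)

      G : ℝ
      G = fromℕ P₁₂

      counts : Vec D n → Vector ℝ k
      counts x j = sum λ i → q j (lookup x i)

      -- Subtracting the fixed row d₀ from every entry turns the query sums into sums of atoms. The
      -- centre is the same for all databases, so `outputs` may add it back.
      centre : Vector ℝ k
      centre j = G * (fromℕ n * q j d₀)

      target : Vec D n → Vector ℝ k
      target x j = G * counts x j - centre j

      -- The target is exactly `P₁₂` copies of a sum of n atoms. The tolerance is nevertheless 1,
      -- because the weighted inequality in `Close-+` requires positive tolerances.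
      target-Reach : ∀ x → Reach 1 W (target x)
      target-Reach x = ≡.subst (λ c → Reach 1 c (target x)) (ℕₚ.+-identityʳ W)
        (Reach-cong (λ j → trans (+-identityˡ _) (trans (*-congˡ (sums j)) (solve 3 (λ g s p → g :* (s :- p) := g :* s :- g :* p) refl G (counts x j) (fromℕ n * q j d₀))))
          (net-Reach⁺ P₁₂ row origin))
        where
        row : Fin n → Fin (T ℕ.* T)
        row i = difference (lookup x i) d₀
        origin : Reach 1 0 (λ _ → 0#)
        origin = (λ ()) , close (begin
          sum {k} (λ _ → (0# - 0#) * (0# - 0#))  ≈⟨ sum-const k _ ⟩
          fromℕ k * ((0# - 0#) * (0# - 0#))      ≤⟨ *-monoˡ-≤ (fromℕ-nonneg k) (begin
            (0# - 0#) * (0# - 0#)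
              ≈⟨ solve 0 ((con (+ 0) :- con (+ 0)) :* (con (+ 0) :- con (+ 0)) := con (+ 0)) refl ⟩
            0#                      ≤⟨ square-nonneg (fromℕ 1) ⟩
            fromℕ 1 * fromℕ 1       ∎) ⟩
          fromℕ k * (fromℕ 1 * fromℕ 1)          ∎)
        sums : ∀ j → atomSum row j ≈ counts x j - fromℕ n * q j d₀
        sums j = begin-equality
          sum (λ i → atom (row i) j)
            ≈⟨ sum-cong (λ i → trans (atom-difference-≈ (lookup x i) d₀ j)
            (+-congˡ (solve 1 (λ y → :- y := :- con (+ 1) :* y) refl (q j d₀)))) ⟩
          sum (λ i → q j (lookup x i) + - 1# * q j d₀)
            ≈⟨ ∑-distrib-+ (λ i → q j (lookup x i)) (λ _ → - 1# * q j d₀) ⟩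
          counts x j + sum {n} (λ _ → - 1# * q j d₀)          ≈⟨ +-congˡ (sum-const n _) ⟩
          counts x j + fromℕ n * (- 1# * q j d₀)
            ≈⟨ solve 3 (λ c n y → c :+ n :* (:- con (+ 1) :* y) := c :- n :* y) refl (counts x j) (fromℕ n) (q j d₀) ⟩
          counts x j - fromℕ n * q j d₀                       ∎

      target-change : ∀ x x′ i → (∀ j → j ≢ i → lookup x j ≡ lookup x′ j) →
        ∀ c → target x′ c ≈ target x c + atomSum {P₁₂} (λ _ → difference (lookup x′ i) (lookup x i)) c
      target-change x x′ i same c = begin-equality
        G * counts x′ c - centre c
          ≈⟨ +-congʳ (*-congˡ (sum-change (λ i → q c (lookup x i)) (λ i → q c (lookup x′ i)) i
               λ j j≢i → ≡.subst (q c (lookup x j) ≈_) (≡.cong (q c) (same j j≢i)) refl)) ⟩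
        G * (counts x c + (q c (lookup x′ i) - q c (lookup x i))) - centre c
          ≈⟨ solve 4 (λ g s d y → g :* (s :+ d) :- y := (g :* s :- y) :+ g :* d) refl G (counts x c) (q c (lookup x′ i) - q c (lookup x i)) (centre c) ⟩
        target x c + G * (q c (lookup x′ i) - q c (lookup x i))
          ≈⟨ +-congˡ (trans (sum-const P₁₂ _) (*-congˡ (atom-difference-≈ (lookup x′ i) (lookup x i) c))) ⟨
        target x c + atomSum {P₁₂} (λ _ → difference (lookup x′ i) (lookup x i)) c ∎

      outputs : Fin (size L) → Vector ℝ k
      outputs i j = fromℕ W ⁻¹ * (centre j + offset L i j)

      mechanism : Mechanism D n k
      mechanism x = record
        { size = size L ; point = outputs ; weight = prob L 1 (target x)
        ; nonneg = prob-nonneg L 1 (target x) ; total = prob-total L 1 (target x) }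

      -- Both laws have the same points in the same order, so for every event it is enough to
      -- compare the weights index by index.
      mechanism-private : PureDP ε mechanism
      mechanism-private x x′ (i , _ , same) E _ = begin
        sum (λ y → prob L 1 (target x) y * ind y)
          ≤⟨ sum-mono (λ y → *-monoʳ-≤ (indicator-nonneg (does (lem {E (outputs y)}))) (ratio y)) ⟩
        sum (λ y → exp ε * prob L 1 (target x′) y * ind y)
          ≈⟨ sum-cong (λ y → *-assoc (exp ε) (prob L 1 (target x′) y) (ind y)) ⟩
        sum (λ y → exp ε * (prob L 1 (target x′) y * ind y))
          ≈⟨ *-distribˡ-sum (exp ε) (λ y → prob L 1 (target x′) y * ind y) ⟨
        exp ε * sum (λ y → prob L 1 (target x′) y * ind y)   ∎
        where
        ind : Fin (size L) → ℝ
        ind y = if does (lem {E (outputs y)}) then 1# else 0#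
        ratio : ∀ y → prob L 1 (target x) y ≤ exp ε * prob L 1 (target x′) y
        ratio y = ≤-trans
          (prob-ratio L 1 P₁₂ (λ _ → difference (lookup x′ i) (lookup x i)) (λ _ → difference (lookup x i) (lookup x′ i))
            (target-change x x′ i same) (target-change x′ x i λ j j≢i → ≡.sym (same j j≢i)) y)
          (*-monoʳ-≤ (prob-nonneg L 1 (target x′) y) privacy-budget)

      mechanism-cost : Vec D n → Fin (size L) → ℝ
      mechanism-cost x i = fromℕ W * (1# / sqrt (fromℕ k) * ‖ (λ j → outputs i j - F q x j) ‖₂)

      W*[output-F] : ∀ x i j → fromℕ W * (outputs i j - F q x j) ≈ - (target x j - offset L i j)
      W*[output-F] x i j = begin-equality
        fromℕ W * (fromℕ W ⁻¹ * (centre j + offset L i j) - F q x j)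
          ≈⟨ trans (distribˡ _ _ _) (+-cong (x*[x⁻¹*y]≈y (centre j + offset L i j) 0<W) (sym (-‿distribʳ-* _ _))) ⟩
        (centre j + offset L i j) - fromℕ W * F q x j
          ≈⟨ +-congˡ (-‿cong (trans (*-congʳ (fromℕ-* P₁₂ n)) (trans (*-assoc _ _ _) (*-congˡ (n*F x j))))) ⟩
        (centre j + offset L i j) - G * counts x j
          ≈⟨ solve 3 (λ y o s → (y :+ o) :- s := :- ((s :- y) :- o)) refl (centre j) (offset L i j) (G * counts x j) ⟩
        - (target x j - offset L i j) ∎

      mechanism-cost-≤ : ∀ x i c → Reach (1 ℕ.+ netError L) c (λ j → target x j - offset L i j) →
                         mechanism-cost x i ≤ fromℕ (1 ℕ.+ netError L ℕ.+ 2 ℕ.* c)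
      mechanism-cost-≤ x i c p = rms-bound 1≤k (λ j → outputs i j - F q x j) (fromℕ-nonneg W)
        (fromℕ-nonneg (1 ℕ.+ netError L ℕ.+ 2 ℕ.* c))
        (≤-trans (≤-reflexive (sum-cong λ j → trans (*-cong (W*[output-F] x i j) (W*[output-F] x i j))
            (solve 1 (λ z → :- z :* :- z := z :* z) refl (target x j - offset L i j))))
          (Close.bound (Reach⇒Close c (ℕ.s≤s ℕ.z≤n) p)))

      W*error : ∀ x → fromℕ W * error mechanism x ≈ sum (λ i → prob L 1 (target x) i * mechanism-cost x i)
      W*error x = begin-equality
        fromℕ W * (a * sum (λ i → P i * ν i))           ≈⟨ *-assoc _ _ _ ⟨
        fromℕ W * a * sum (λ i → P i * ν i)             ≈⟨ *-distribˡ-sum (fromℕ W * a) (λ i → P i * ν i) ⟩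
        sum (λ i → fromℕ W * a * (P i * ν i))
          ≈⟨ sum-cong (λ i → solve 4 (λ w a p ν → w :* a :* (p :* ν) := p :* (w :* (a :* ν))) refl (fromℕ W) a (P i) (ν i)) ⟩
        sum (λ i → P i * (fromℕ W * (a * ν i)))         ∎
        where
        a = 1# / sqrt (fromℕ k)
        P : Fin (size L) → ℝ
        P = prob L 1 (target x)
        ν : Fin (size L) → ℝ
        ν i = ‖ (λ j → outputs i j - F q x j) ‖₂

      mechanism-error : ∀ x → fromℕ (2 ℕ.^ L) * error mechanism x ≤ fromℕ 12
      mechanism-error x = *-cancelˡ-≤ (fromℕ-positive 1≤V) (begin
        fromℕ V * (fromℕ (2 ℕ.^ L) * error mechanism x)    ≈⟨ *-assoc _ _ _ ⟨
        fromℕ V * fromℕ (2 ℕ.^ L) * error mechanism x      ≈⟨ *-congʳ (fromℕ-* V (2 ℕ.^ L)) ⟨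
        fromℕ (V ℕ.* 2 ℕ.^ L) * error mechanism x
          ≡⟨ ≡.cong (λ w → fromℕ w * error mechanism x) V*P₂≡W ⟩
        fromℕ W * error mechanism x                        ≈⟨ W*error x ⟩
        sum (λ i → prob L 1 (target x) i * mechanism-cost x i)
          ≤⟨ expected-cost L 1≤h 1≤g ρ-suc netSize≤ κ-bound L ℕₚ.≤-refl (ℕ.s≤s ℕ.z≤n) (target-Reach x) (mechanism-cost x) (mechanism-cost-≤ x) ⟩
        fromℕ (errorBound η κ ρ L 1 W)                     ≤⟨ fromℕ-mono total-error ⟩
        fromℕ (12 ℕ.* V)                                   ≈⟨ trans (fromℕ-* 12 V) (*-comm _ _) ⟩
        fromℕ V * fromℕ 12                                 ∎)

  -- Choice of the depth and the final constant

  -- Here m is 2^L. From e ≥ 2 follows 62 e ≥ 124, which covers the 12 required for the first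
  -- argument of the minimum and the 12 · 7 = 84 required for the second.
  final-bound : ∀ {X α m} → 1 ℕ.≤ m → 0# ≤ α → fromℕ m * X ≤ fromℕ 12 → 1# ≤ fromℕ 7 * (fromℕ m * α) →
                X ≤ fromℕ 62 * exp 1# * (1# ⊓ α)
  final-bound {X} {α} {m} 1≤m 0≤α mX≤12 1≤7mα = *-⊓-bound
    (*-cancelˡ-≤ 0<m (begin
      fromℕ m * X                                  ≤⟨ mX≤12 ⟩
      fromℕ 12                                     ≤⟨ fromℕ-mono (ℕₚ.m≤m+n 12 112) ⟩
      fromℕ 124                                    ≤⟨ 124≤62e ⟩
      c                                            ≈⟨ solve 1 (λ c → c := con (+ 1) :* (c :* con (+ 1))) refl c ⟩
      1# * (c * 1#)
        ≤⟨ *-monoʳ-≤ (*-nonneg 0≤c 0≤1) (≤-trans (≤-reflexive (sym fromℕ-1)) (fromℕ-mono 1≤m)) ⟩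
      fromℕ m * (c * 1#)                           ∎))
    (*-cancelˡ-≤ 0<m (begin
      fromℕ m * X                                  ≤⟨ mX≤12 ⟩
      fromℕ 12                                     ≈⟨ *-identityʳ _ ⟨
      fromℕ 12 * 1#                                ≤⟨ *-monoˡ-≤ (fromℕ-nonneg 12) 1≤7mα ⟩
      fromℕ 12 * (fromℕ 7 * (fromℕ m * α))         ≈⟨ *-assoc _ _ _ ⟨
      fromℕ 12 * fromℕ 7 * (fromℕ m * α)           ≈⟨ *-congʳ (fromℕ-* 12 7) ⟨
      fromℕ 84 * (fromℕ m * α)
        ≤⟨ *-monoʳ-≤ (*-nonneg (fromℕ-nonneg m) 0≤α) (≤-trans (fromℕ-mono (ℕₚ.m≤m+n 84 40)) 124≤62e) ⟩
      c * (fromℕ m * α)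
        ≈⟨ solve 3 (λ c m a → c :* (m :* a) := m :* (c :* a)) refl c (fromℕ m) α ⟩
      fromℕ m * (c * α)                            ∎))
    where
    c = fromℕ 62 * exp 1#
    0≤c : 0# ≤ c
    0≤c = *-nonneg (fromℕ-nonneg 62) (exp-nonneg 0≤1)
    0<m : 0# < fromℕ m
    0<m = fromℕ-positive 1≤m
    124≤62e : fromℕ 124 ≤ c
    124≤62e = begin
      fromℕ 124              ≈⟨ fromℕ-* 62 2 ⟩
      fromℕ 62 * fromℕ 2
        ≤⟨ *-monoˡ-≤ (fromℕ-nonneg 62) (≤-trans (≤-reflexive (+-congˡ fromℕ-1)) (1+x≤exp 0≤1)) ⟩
      c                      ∎

  -- The logarithm and the root are descriptions, so they are replaced by reals ℓ and α of which
  -- only the equations that they satisfy, and 0 ≤ α, are assumed.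
  module Result
    (D : Set) (T : ℕ) (D↔Fin : D ↔ Fin T) (1≤T : 1 ℕ.≤ T)
    (k : ℕ) (1≤k : 1 ℕ.≤ k) (n : ℕ) (1≤n : 1 ℕ.≤ n)
    (q : Fin k → D → ℝ) (q-bound : ∀ j d → (- 1# ≤ q j d) × (q j d ≤ 1#))
    (ε : ℝ) (0<ε : 0# < ε)
    (ℓ : ℝ) (exp-ℓ : exp ℓ ≈ fromℕ (2 ℕ.* T))
    (α : ℝ) (0≤α : 0# ≤ α) (α²εn≈ℓ : α * α * (ε * fromℕ n) ≈ ℓ)
    where

    open Instance D T D↔Fin 1≤T k 1≤k n 1≤n q q-bound ε 0<ε ℓ exp-ℓ

    0<εn : 0# < ε * fromℕ n
    0<εn = *-positive 0<ε (fromℕ-positive 1≤n)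

    -- The hypothesis says 1 ≤ 48 m² α², and 48 ≤ 7². The 48 is 12 · 4, from the failure of the
    -- budget at one depth more.
    1≤7mα : ∀ m → ε * fromℕ n ≤ fromℕ (48 ℕ.* (m ℕ.* m)) * ℓ → 1# ≤ fromℕ 7 * (fromℕ m * α)
    1≤7mα m h = square-cancel-≤ (*-nonneg (fromℕ-nonneg 7) (*-nonneg (fromℕ-nonneg m) 0≤α)) (begin
      1# * 1#                                  ≈⟨ *-identityˡ 1# ⟩
      1#                                       ≤⟨ *-cancelˡ-≤ 0<εn (begin
        e * 1#                                   ≈⟨ *-identityʳ e ⟩
        e                                        ≤⟨ h ⟩
        fromℕ (48 ℕ.* (m ℕ.* m)) * ℓ             ≈⟨ *-cong (fromℕ-* 48 (m ℕ.* m)) (sym α²εn≈ℓ) ⟩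
        fromℕ 48 * M * (α * α * e)
          ≈⟨ solve 4 (λ f m a e → f :* m :* (a :* e) := e :* (f :* (m :* a))) refl (fromℕ 48) M (α * α) e ⟩
        e * (fromℕ 48 * (M * (α * α)))           ∎) ⟩
      fromℕ 48 * (M * (α * α))
        ≤⟨ *-monoʳ-≤ (*-nonneg (fromℕ-nonneg (m ℕ.* m)) (square-nonneg α)) (fromℕ-mono (ℕₚ.m≤m+n 48 1)) ⟩
      fromℕ 49 * (M * (α * α))                 ≈⟨ *-cong (fromℕ-* 7 7) (*-congʳ (fromℕ-* m m)) ⟩
      fromℕ 7 * fromℕ 7 * (fromℕ m * fromℕ m * (α * α))
        ≈⟨ solve 3 (λ s m a → s :* s :* (m :* m :* (a :* a)) := s :* (m :* a) :* (s :* (m :* a))) refl (fromℕ 7) (fromℕ m) α ⟩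
      fromℕ 7 * (fromℕ m * α) * (fromℕ 7 * (fromℕ m * α)) ∎)
      where
      e = ε * fromℕ n
      M = fromℕ (m ℕ.* m)

    TooDeep : ℕ → Set
    TooDeep L = ¬ (fromℕ (12 ℕ.* 4 ℕ.^ L) * ℓ ≤ ε * fromℕ n)

    n<4^n : ∀ m → suc m ℕ.≤ 4 ℕ.^ m
    n<4^n zero    = ℕₚ.≤-refl
    n<4^n (suc m) = ℕₚ.≤-trans (ℕₚ.+-mono-≤ (ℕₚ.m^n>0 4 m) (n<4^n m)) (ℕₚ.+-monoʳ-≤ (4 ℕ.^ m) (ℕₚ.m≤m+n (4 ℕ.^ m) _))

    -- 4^m exceeds m, and ℓ is at least ½; so a natural number above ε n is already too deep.
    tooDeep : ∃ TooDeep
    tooDeep = let m , εn≤m = archimedean (ε * fromℕ n) in m , λ h → <⇒≱ 0<1 (+-cancelˡ-≤ (fromℕ m) (begin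
      fromℕ m + 1#                       ≈⟨ +-comm _ _ ⟩
      fromℕ (suc m)                      ≈⟨ *-identityʳ _ ⟨
      fromℕ (suc m) * 1#                 ≤⟨ *-monoˡ-≤ (fromℕ-nonneg (suc m)) 1≤2ℓ ⟩
      fromℕ (suc m) * (fromℕ 2 * ℓ)
        ≈⟨ trans (sym (*-assoc _ _ _)) (*-congʳ (trans (*-comm _ _) (sym (fromℕ-* 2 (suc m))))) ⟩
      fromℕ (2 ℕ.* suc m) * ℓ
        ≤⟨ *-monoʳ-≤ 0≤ℓ (fromℕ-mono (ℕₚ.*-mono-≤ (ℕₚ.m≤m+n 2 10) (n<4^n m))) ⟩
      fromℕ (12 ℕ.* 4 ℕ.^ m) * ℓ         ≤⟨ h ⟩
      ε * fromℕ n                        ≤⟨ εn≤m ⟩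
      fromℕ m                            ≈⟨ +-identityʳ _ ⟨
      fromℕ m + 0#                       ∎))

    Goal : Set₁
    Goal = Σ[ M ∈ Mechanism D n k ] PureDP ε M × sup (error M) ≤ fromℕ 62 * exp 1# * (1# ⊓ α)

    -- The argument is the first depth that exceeds the privacy budget. The staged mechanism runs at
    -- the depth before it, and if there is none, the constant output 0 suffices.
    by-depth : ∀ L → TooDeep L → (∀ d → TooDeep d → L ℕ.≤ d) → Goal
    by-depth zero deep _ = trivialMechanism , trivial-private , sup-≤ (error trivialMechanism) (replicate n d₀) λ x →
      final-bound {m = 1} ℕₚ.≤-refl 0≤α (begin
        fromℕ 1 * error trivialMechanism x ≤⟨ *-monoˡ-≤ (fromℕ-nonneg 1) (trivial-error x) ⟩
        fromℕ 1 * 1#                       ≈⟨ *-identityʳ _ ⟩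
        fromℕ 1                            ≤⟨ fromℕ-mono (ℕₚ.m≤m+n 1 11) ⟩
        fromℕ 12                           ∎)
        (1≤7mα 1 (≤-trans (proj₁ (≰⇒> deep)) (*-monoʳ-≤ 0≤ℓ (fromℕ-mono (ℕₚ.m≤m+n 12 36)))))
    by-depth (suc L) deep least = mechanism , mechanism-private , sup-≤ (error mechanism) (replicate n d₀) λ x →
      final-bound {m = 2 ℕ.^ L} (ℕₚ.m^n>0 2 L) 0≤α (mechanism-error x)
        (1≤7mα (2 ℕ.^ L) (≤-trans (proj₁ (≰⇒> deep)) (≤-reflexive (*-congʳ (≡⇒≈ (≡.cong fromℕ 12*4^≡))))))
      where
      shallow : fromℕ (12 ℕ.* 4 ℕ.^ L) * ℓ ≤ ε * fromℕ n
      -- If the budget failed at L, then L would be too deep, and minimality would give `suc L` ≤ L.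
      shallow = ≮⇒≤ λ (h , h≉) → ℕₚ.<-irrefl ≡.refl (least L λ h′ → h≉ (antisym h h′))
      open Staged L shallow
      ≡⇒≈ : ∀ {x y} → x ≡ y → x ≈ y
      ≡⇒≈ ≡.refl = refl
      12*4^≡ : 12 ℕ.* (4 ℕ.* 4 ℕ.^ L) ≡ 48 ℕ.* (2 ℕ.^ L ℕ.* 2 ℕ.^ L)
      12*4^≡ = ≡.trans (≡.sym (ℕₚ.*-assoc 12 4 (4 ℕ.^ L))) (≡.cong (48 ℕ.*_) (≡.sym (Schedule.g*g n 1≤n L L)))

    result : Goal
    result = let L , deep , minimal = least {TooDeep} (proj₁ tooDeep) (proj₂ tooDeep) in by-depth L deep minimal

theorem1p2 : (lem : ExcludedMiddle 0ℓ) (R : RealNumbers) →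
    let open Analysis lem R in
    (D : Set) (T : ℕ) → D ↔ Fin T → 1 ℕ.≤ T →
    (k : ℕ) → 1 ℕ.≤ k →
    (n : ℕ) → 1 ℕ.≤ n →
    (q : Fin k → D → ℝ) → (∀ j d → (- 1# ≤ q j d) × (q j d ≤ 1#)) →
    (ε : ℝ) → 0# < ε →
    Σ[ M₂ ∈ Mechanism D n k ]
    PureDP ε M₂ ×
    sup (λ x → (1# / sqrt (fromℕ k)) * 𝔼 (M₂ x) (λ y → ‖ (λ j → y j - F q x j) ‖₂))
    ≤ (fromℕ 62 * exp 1#) * (1# ⊓ sqrt (log (fromℕ (2 ℕ.* T)) / (ε * fromℕ n)))
theorem1p2 lem R D T D↔Fin 1≤T k 1≤k n 1≤n q q-bound ε 0<ε =
  Result.result D T D↔Fin 1≤T k 1≤k n 1≤n q q-bound ε 0<ε ℓ exp-ℓ α (proj₁ α-spec)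
    (trans (*-congʳ (proj₂ α-spec)) (trans (*-assoc ℓ (e ⁻¹) e) (trans (*-congˡ (*-inverseˡ 0<e)) (*-identityʳ ℓ))))
  where
  open Proof lem R
  ℓ = log (fromℕ (2 ℕ.* T))
  e = ε * fromℕ n
  α = sqrt (ℓ / e)
  exp-ℓ : exp ℓ ≈ fromℕ (2 ℕ.* T)
  exp-ℓ = exp-log (≤-trans (≤-reflexive (sym fromℕ-1)) (fromℕ-mono (ℕₚ.≤-trans 1≤T (ℕₚ.m≤m+n T (1 ℕ.* T)))))
  0<e : 0# < e
  0<e = *-positive 0<ε (fromℕ-positive 1≤n)
  0≤ℓ : 0# ≤ ℓ
  0≤ℓ = ≤-trans (proj₁ 0<½) (2≤exp⇒½≤ (≤-trans (fromℕ-mono (ℕₚ.*-monoʳ-≤ 2 1≤T)) (≤-reflexive (sym exp-ℓ))))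
  α-spec : 0# ≤ α × α * α ≈ ℓ / e
  α-spec = sqrt-spec (*-nonneg 0≤ℓ (proj₁ (⁻¹-positive 0<e)))
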